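{- Let $f$ and $g$ be (normalised) cuspidal eigenforms on the group $\Gamma_0(N)$ of weights $k_1$ and $k_2$ respectively, with $k_1\neq k_2$. Then: (1) there exists a positive integer $n=O\left(\left(\log(N)+\log(N)^{0.525}\right)^2\right)$ such that $a_n(f)\neq a_n(g)$; (2) assuming the Riemann hypothesis, there exists a positive integer $n=O\left(\left(\log(N)+\log(N)^{0.5}\log\log(N)\right)^2\right)$ such that $a_n(f)\neq a_n(g)$; (3) assuming Cramér's conjecture on prime gaps, there exists a positive integer $n=O\left(\left(\log(N)+(\log\log(N))^2\right)^2\right)$ such that $a_n(f)\neq a_n(g)$.
   Context: A cuspidal eigenform of weight $k$ on $\Gamma_0(N)$ is a nonzero cusp form of weight $k$ (with trivial character) on $\Gamma_0(N)\subset \mathrm{SL}_2(\mathbb{Z})$ that is a simultaneous eigenvector of all Hecke operators $T_n$, $n\geq 1$; it is not required to be a newform. $a_n(f)$ denotes the coefficient of $q^n$ in the Fourier expansion $f=\sum_{n\geq 1}a_n(f)q^n$ at the cusp $\infty$, $q=e^{2\pi i z}$. All cuspidal eigenforms are assumed normalised so that $a_1(f)=1$. $\log$ is the natural logarithm, and $\log(N)^{c}$ means $(\log N)^{c}$. The $O$-notation is asymptotic as $N\to\infty$: "there exists $n=O(B(N))$ such that $a_n(f)\neq a_n(g)$" means that there are absolute constants $C>0$ and $N_0$, independent of $f$, $g$, $k_1$, $k_2$ and $N$, such that for every $N\geq N_0$ and all $f,g$ as in the statement there is a positive integer $n\leq C\,B(N)$ with $a_n(f)\neq a_n(g)$. Let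 $p_k$ denote the $k$-th smallest prime number. Cramér's conjecture on prime gaps is the assertion that $p_{k+1}-p_k=O(\log^2(p_k))$ as $k\to\infty$. -}

module Defs where

open import Level using (0ℓ) renaming (suc to lsuc)
open import Algebra.Apartness.Bundles using (HeytingField; HeytingCommutativeRing)
open import Algebra.Bundles using (RawRing; CommutativeRing)
import Algebra.Definitions.RawSemiring as RawSemiringDefinitions
import Algebra.Properties.Ring as RingProperties
open import Data.Bool.Base using (if_then_else_)
open import Data.Empty using (⊥-elim)
open import Data.Fin.Base using (toℕ)
open import Data.Integer.Base as ℤ using (ℤ; +_; -[1+_]; 1ℤ)
import Data.Integer.Divisibility as ℤ
open import Data.List.Base using (length; filter; upTo)
open import Data.Nat.Base as ℕ using (ℕ; zero; suc; NonZero; _!)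
open import Data.Nat.Coprimality using (coprime?)
open import Data.Nat.Primality using (Prime; prime?)
open import Data.Nat.Properties as ℕ using (_!≢0)
open import Data.Product.Base using (Σ; ∃-syntax; _×_; _,_; proj₁; proj₂)
open import Data.Sum.Base using (_⊎_; inj₁; inj₂)
open import Function.Bundles using (Func)
open import Relation.Binary.Bundles using (Setoid)
import Relation.Binary.Construct.On as On
open import Relation.Binary.PropositionalEquality.Core using (_≡_)
open import Relation.Binary.Structures using (IsStrictPartialOrder)
open import Relation.Nullary.Decidable.Core using (does; _×-dec_)
open import Relation.Nullary.Negation.Core using (¬_)

-- The real numbers, axiomatised as a Cauchy complete Archimedean ordered
-- field.  The axioms determine ℝ up to isomorphism classically; trichotomy is
-- not assumed (only x # y ⇔ x < y ⊎ y < x), so that the Cauchy reals of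
-- constructive mathematics are a model too.

record RealNumbers : Set (lsuc 0ℓ) where
  infix 4 _<_ _≤_ ∣_-_∣<_
  field
    heytingField : HeytingField 0ℓ 0ℓ 0ℓ

  open HeytingField heytingField public renaming (Carrier to ℝ)

  commutativeRing : CommutativeRing 0ℓ 0ℓ
  commutativeRing = HeytingCommutativeRing.commutativeRing heytingCommutativeRing

  open CommutativeRing commutativeRing public using (rawRing; ring)

  open RawSemiringDefinitions (RawRing.rawSemiring rawRing) public using (_^_)
    renaming (_×_ to _·_)

  fromℕ : ℕ → ℝ
  fromℕ n = n · 1#

  field
    _<_                  : ℝ → ℝ → Set
    isStrictPartialOrder : IsStrictPartialOrder _≈_ _<_
    #⇒<⊎>                : ∀ {x y} → x # y → x < y ⊎ y < x
    <⇒#                  : ∀ {x y} → x < y → x # y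
    0<1                  : 0# < 1#
    +-monoˡ-<            : ∀ z {x y} → x < y → x + z < y + z
    *-pos                : ∀ {x y} → 0# < x → 0# < y → 0# < x * y
    archimedean          : ∀ x → ∃[ n ] x < fromℕ n

  open IsStrictPartialOrder isStrictPartialOrder public
    using (<-resp-≈; <-respʳ-≈; <-respˡ-≈)
    renaming (irrefl to <-irrefl; trans to <-trans)

  _≤_ : ℝ → ℝ → Set
  x ≤ y = ¬ (y < x)

  ∣_-_∣<_ : ℝ → ℝ → ℝ → Set
  ∣ x - y ∣< ε = (x - y < ε) × (y - x < ε)

  field
    complete : (s : ℕ → ℝ) →
      (∀ ε → 0# < ε → ∃[ M ] (∀ m n → M ℕ.≤ m → M ℕ.≤ n → ∣ s m - s n ∣< ε)) →
      ∃[ l ] (∀ ε → 0# < ε → ∃[ M ] (∀ n → M ℕ.≤ n → ∣ s n - l ∣< ε))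

record SL₂ℤ : Set where
  field
    a b c d : ℤ
    det     : a ℤ.* d ℤ.- b ℤ.* c ≡ 1ℤ

Γ₀ : ℕ → SL₂ℤ → Set
Γ₀ N γ = + N ℤ.∣ SL₂ℤ.c γ

module Analysis (R : RealNumbers) where

  open RealNumbers R public
    hiding (_+_; _*_; -_; _≈_; _#_; _^_; 0#; 1#; _-_)

  open RealNumbers R
    using ()
    renaming ( _+_ to _+ᵣ_; _*_ to _*ᵣ_; -_ to -ᵣ_; _-_ to _-ᵣ_; _^_ to _^ᵣ_
             ; _≈_ to _≈ᵣ_; _#_ to _#ᵣ_; 0# to 0ᵣ; 1# to 1ᵣ) public

  infix 9 1/_

  fromℕ-pos : ∀ n .{{_ : NonZero n}} → 0ᵣ < fromℕ n
  fromℕ-pos (suc zero)      = <-respʳ-≈ (sym (+-identityʳ 1ᵣ)) 0<1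
  fromℕ-pos n@(suc (suc m)) =
    <-trans (fromℕ-pos (suc m))
      (<-respʳ-≈ (+-comm (fromℕ (suc m)) 1ᵣ)
        (<-respˡ-≈ (+-identityʳ _)
          (<-respˡ-≈ (+-comm 0ᵣ (fromℕ (suc m)))
            (<-respʳ-≈ (+-comm 1ᵣ (fromℕ (suc m)))
              (+-monoˡ-< (fromℕ (suc m)) 0<1)))))

  -- An inverse of fromℕ n - 0#, since x # y is what makes x - y invertible.
  1/-inverse : ∀ n .{{_ : NonZero n}} →
               ∃[ r ] (r *ᵣ (fromℕ n -ᵣ 0ᵣ) ≈ᵣ 1ᵣ) × ((fromℕ n -ᵣ 0ᵣ) *ᵣ r ≈ᵣ 1ᵣ)
  1/-inverse n = #⇒invertible (#-sym (<⇒# (fromℕ-pos n)))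

  1/_ : ∀ n .{{_ : NonZero n}} → ℝ
  1/ n = proj₁ (1/-inverse n)

  private
    open RingProperties ring using (-0#≈0#; -‿distribˡ-*)

    x-0≈x : ∀ x → x -ᵣ 0ᵣ ≈ᵣ x
    x-0≈x x = trans (+-congˡ -0#≈0#) (+-identityʳ x)

  1/-pos : ∀ n .{{_ : NonZero n}} → 0ᵣ < 1/ n
  1/-pos n with 1/-inverse n
  ... | r , rx≈1 , xr≈1 with #⇒<⊎> (invertible⇒# {r} {0ᵣ}
          (x , trans (*-congˡ (x-0≈x r)) xr≈1 , trans (*-congʳ (x-0≈x r)) rx≈1))
    where
    x = fromℕ n -ᵣ 0ᵣ
  ... | inj₂ 0<r = 0<r
  ... | inj₁ r<0 = ⊥-elim (<-irrefl refl (<-trans 0<1 1<0))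
    where
    x = fromℕ n -ᵣ 0ᵣ
    0<x : 0ᵣ < x
    0<x = <-respʳ-≈ (sym (x-0≈x _)) (fromℕ-pos n)
    0<-r : 0ᵣ < -ᵣ r
    0<-r = <-respʳ-≈ (+-identityˡ _) (<-respˡ-≈ (-‿inverseʳ r) (+-monoˡ-< (-ᵣ r) r<0))
    0<-1 : 0ᵣ < -ᵣ 1ᵣ
    0<-1 = <-respʳ-≈ (trans (sym (-‿distribˡ-* r x)) (-‿cong rx≈1)) (*-pos 0<-r 0<x)
    1<0 : 1ᵣ < 0ᵣ
    1<0 = <-respʳ-≈ (-‿inverseˡ 1ᵣ) (<-respˡ-≈ (+-identityˡ 1ᵣ) (+-monoˡ-< 1ᵣ 0<-1))

  _^ℤ_ : (n : ℕ) .{{_ : NonZero n}} → ℤ → ℝ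
  n ^ℤ (+ m)    = fromℕ n ^ᵣ m
  n ^ℤ -[1+ m ] = (1/ n) ^ᵣ suc m

  fromℤ : ℤ → ℝ
  fromℤ (+ n)    = fromℕ n
  fromℤ -[1+ n ] = -ᵣ fromℕ (suc n)

  infix 6 _+i_

  record ℂ : Set where
    constructor _+i_
    field
      Re Im : ℝ

  open ℂ public

  ℂ-rawRing : RawRing 0ℓ 0ℓ
  ℂ-rawRing = record
    { Carrier = ℂ
    ; _≈_     = λ z w → (Re z ≈ᵣ Re w) × (Im z ≈ᵣ Im w)
    ; _+_     = λ z w → (Re z +ᵣ Re w) +i (Im z +ᵣ Im w)
    ; _*_     = λ z w → (Re z *ᵣ Re w -ᵣ Im z *ᵣ Im w) +i (Re z *ᵣ Im w +ᵣ Im z *ᵣ Re w)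
    ; -_      = λ z → (-ᵣ Re z) +i (-ᵣ Im z)
    ; 0#      = 0ᵣ +i 0ᵣ
    ; 1#      = 1ᵣ +i 0ᵣ
    }

  open RawRing ℂ-rawRing public using (_≈_; _+_; _*_; -_; 0#; 1#)
  open RawSemiringDefinitions (RawRing.rawSemiring ℂ-rawRing) public using (_^_; sum)

  ℂ-setoid : Setoid 0ℓ 0ℓ
  ℂ-setoid = record
    { _≈_           = _≈_
    ; isEquivalence = record
      { refl  = refl , refl
      ; sym   = λ (p , q) → sym p , sym q
      ; trans = λ (p , q) (p′ , q′) → trans p p′ , trans q q′
      }
    }

  infix 4 _#_
  infixl 6 _-_

  _#_ : ℂ → ℂ → Set
  z # w = (Re z #ᵣ Re w) ⊎ (Im z #ᵣ Im w)

  _-_ : ℂ → ℂ → ℂ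
  z - w = z + - w

  fromℝ : ℝ → ℂ
  fromℝ x = x +i 0ᵣ

  ∣_∣² : ℂ → ℝ
  ∣ z ∣² = Re z *ᵣ Re z +ᵣ Im z *ᵣ Im z

  Σ[_]_ : ℕ → (ℕ → ℂ) → ℂ
  Σ[ n ] t = sum {n} (λ i → t (toℕ i))

  HasSum : (ℕ → ℂ) → ℂ → Set
  HasSum t s = ∀ ε → 0ᵣ < ε → ∃[ M ] (∀ n → M ℕ.≤ n → ∣ Σ[ n ] t - s ∣² < ε *ᵣ ε)

  -- The graphs of the elementary functions; each is a functional relation.

  IsExp : ℂ → ℂ → Set
  IsExp z w = HasSum (λ n → fromℝ (1/_ (n !) {{n !≢0}}) * z ^ n) w

  IsLog : ℝ → ℝ → Set
  IsLog x y = IsExp (fromℝ y) (fromℝ x)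

  IsRealPower : ℝ → ℝ → ℝ → Set
  IsRealPower x r y = ∃[ l ] IsLog x l × IsExp (fromℝ (r *ᵣ l)) (fromℝ y)

  IsSin : ℝ → ℝ → Set
  IsSin x s = ∃[ c ] IsExp (0ᵣ +i x) (c +i s)

  -- π is the least positive zero of the sine.
  IsPi : ℝ → Set
  IsPi π = 0ᵣ < π × IsSin π 0ᵣ ×
           (∀ x → 0ᵣ < x → x < π → ∃[ s ] IsSin x s × 0ᵣ < s)

  -- q = e^{2πiz/h}
  IsNome : (h : ℕ) .{{_ : NonZero h}} → ℂ → ℂ → Set
  IsNome h z q = ∃[ π ] IsPi π × IsExp ((0ᵣ +i (fromℕ 2 *ᵣ π *ᵣ 1/ h)) * z) q

  -- u = z^k, for z # 0
  IsPower : ℂ → ℤ → ℂ → Set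
  IsPower z (+ m)    u = u ≈ z ^ m
  IsPower z -[1+ m ] u = u * z ^ suc m ≈ 1#

  On : (ℂ → Set) → Setoid 0ℓ 0ℓ
  On U = On.setoid {B = Σ ℂ U} ℂ-setoid proj₁

  Function : (ℂ → Set) → Set
  Function U = Func (On U) ℂ-setoid

  open Func public using (to)

  Holomorphic : (U : ℂ → Set) → Function U → Set
  Holomorphic U f = ∀ (z : Σ ℂ U) → ∃[ D ] ∀ ε → 0ᵣ < ε → ∃[ δ ] 0ᵣ < δ ×
    (∀ (w : Σ ℂ U) → let h = proj₁ w - proj₁ z in ∣ h ∣² < δ *ᵣ δ →
      ∣ to f w - to f z - D * h ∣² ≤ ε *ᵣ ε *ᵣ ∣ h ∣²)

  UpperHalf : ℂ → Set
  UpperHalf z = 0ᵣ < Im z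

  ℍ : Set
  ℍ = Σ ℂ UpperHalf

  factor : SL₂ℤ → ℂ → ℂ
  factor γ z = fromℝ (fromℤ (SL₂ℤ.c γ)) * z + fromℝ (fromℤ (SL₂ℤ.d γ))

  -- w = (az + b)/(cz + d)
  IsMöbius : SL₂ℤ → ℍ → ℍ → Set
  IsMöbius γ (z , _) (w , _) =
    w * factor γ z ≈ fromℝ (fromℤ (SL₂ℤ.a γ)) * z + fromℝ (fromℤ (SL₂ℤ.b γ))

  -- s = (cz + d)^{-k} f(γz), the value at z of f slashed by γ in weight k
  IsSlash : Function UpperHalf → ℤ → SL₂ℤ → ℍ → ℂ → Set
  IsSlash f k γ z s = ∃[ w ] ∃[ j ]
    IsMöbius γ z w × IsPower (factor γ (proj₁ z)) k j × to f w ≈ j * s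

  -- f(z) = Σ_{n ≥ 1} b_n q^n with q = e^{2πiz/h}, for a function given by its
  -- graph F; the value b 0 is irrelevant.
  HasCuspidalExpansion : (h : ℕ) .{{_ : NonZero h}} → (ℍ → ℂ → Set) → (ℕ → ℂ) → Set
  HasCuspidalExpansion h F b = ∀ z s → F z s →
    ∃[ q ] IsNome h (proj₁ z) q × HasSum (λ n → b (suc n) * q ^ suc n) s

  -- Vanishing at all cusps: every f|γ, γ ∈ SL₂(ℤ), is a power series without
  -- constant term in e^{2πiz/N} (the width of each cusp of Γ₀(N) divides N).
  record CuspForm (N : ℕ) .{{_ : NonZero N}} (k : ℤ) : Set where
    field
      form        : Function UpperHalf
      holomorphic : Holomorphic UpperHalf form
      modular     : ∀ γ → Γ₀ N γ → ∀ z → IsSlash form k γ z (to form z)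
      cuspidal    : ∀ γ → ∃[ b ] HasCuspidalExpansion N (IsSlash form k γ) b

  -- (az + b)/d
  heckePoint : (a b d : ℕ) .{{_ : NonZero a}} .{{_ : NonZero d}} → ℍ → ℍ
  heckePoint a b d (z , 0<y) =
    ((fromℕ a *ᵣ Re z +ᵣ fromℕ b) *ᵣ 1/ d) +i (fromℕ a *ᵣ Im z *ᵣ 1/ d) ,
    *-pos (*-pos (fromℕ-pos a) 0<y) (1/-pos d)

  -- (T_n f)(z) = n^{k-1} Σ_{ad = n, (a,N) = 1} d^{-k} Σ_{0 ≤ b < d} f((az + b)/d).
  -- The summation variables are shifted: a = suc a′ and d = suc d′.
  T : (N : ℕ) (k : ℤ) (n : ℕ) .{{_ : NonZero n}} → Function UpperHalf → ℍ → ℂ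
  T N k n f z = fromℝ (n ^ℤ (k ℤ.- 1ℤ)) * Σ[ n ] λ a′ → Σ[ n ] λ d′ →
    let a = suc a′; d = suc d′ in
    if does (a ℕ.* d ℕ.≟ n ×-dec coprime? a N)
    then fromℝ (d ^ℤ (ℤ.- k)) * Σ[ d ] (λ b → to f (heckePoint a b d z))
    else 0#

  record NormalisedEigenform (N : ℕ) .{{_ : NonZero N}} (k : ℤ) : Set where
    field
      cuspForm : CuspForm N k

    open CuspForm cuspForm public

    field
      nonzero    : ∃[ z ] to form z # 0#
      eigen      : ∀ n .{{_ : NonZero n}} →
                   ∃[ eigenvalue ] ∀ z → T N k n form z ≈ eigenvalue * to form z
      coeff      : ℕ → ℂ
      expansion  : HasCuspidalExpansion 1 (λ z s → s ≈ to form z) coeff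
      normalised : coeff 1 ≈ 1#

  open NormalisedEigenform public using (coeff)

  -- t = n^{-s}
  IsDirichletTerm : ℂ → ℕ → ℂ → Set
  IsDirichletTerm s n t = ∃[ l ] IsLog (fromℕ n) l × IsExp (- (fromℝ l * s)) t

  record IsRiemannZeta (ζ : Function (_# 1#)) : Set where
    field
      holomorphic : Holomorphic (_# 1#) ζ
      series      : ∀ s → 1ᵣ < Re (proj₁ s) →
                    ∃[ t ] (∀ n → IsDirichletTerm (proj₁ s) (suc n) (t n)) × HasSum t (to ζ s)

  RiemannHypothesis : Set
  RiemannHypothesis = ∀ ζ → IsRiemannZeta ζ → ∀ s → to ζ s ≈ 0# →
    ¬ (∃[ n ] proj₁ s ≈ - fromℝ (fromℕ (2 ℕ.* suc n))) → Re (proj₁ s) ≈ᵣ 1/ 2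

  -- p is the k-th smallest prime; the smallest one has k = 1.
  IsNthPrime : ℕ → ℕ → Set
  IsNthPrime k p = Prime p × length (filter prime? (upTo (suc p))) ≡ k

  CramérConjecture : Set
  CramérConjecture = ∃[ C ] 0ᵣ < C × (∃[ k₀ ] ∀ k → k₀ ℕ.≤ k →
    ∀ p p′ → IsNthPrime k p → IsNthPrime (suc k) p′ →
    ∀ l → IsLog (fromℕ p) l → fromℕ p′ -ᵣ fromℕ p ≤ C *ᵣ l ^ᵣ 2)

  -- x = (log N + (log N)^{0.525})²
  Bound₁ : ℕ → ℝ → Set
  Bound₁ N x = ∃[ l ] ∃[ s ] IsLog (fromℕ N) l ×
    IsRealPower l (fromℕ 21 *ᵣ 1/ 40) s × x ≈ᵣ (l +ᵣ s) ^ᵣ 2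

  -- x = (log N + (log N)^{0.5} log log N)²
  Bound₂ : ℕ → ℝ → Set
  Bound₂ N x = ∃[ l ] ∃[ s ] ∃[ ll ] IsLog (fromℕ N) l ×
    IsRealPower l (1/ 2) s × IsLog l ll × x ≈ᵣ (l +ᵣ s *ᵣ ll) ^ᵣ 2

  -- x = (log N + (log log N)²)²
  Bound₃ : ℕ → ℝ → Set
  Bound₃ N x = ∃[ l ] ∃[ ll ] IsLog (fromℕ N) l × IsLog l ll ×
    x ≈ᵣ (l +ᵣ ll ^ᵣ 2) ^ᵣ 2

  -- Eigenforms of different weights on Γ₀(N) are distinguished by their n-th
  -- coefficients for some n = O(B(N)), B being given by its graph.
  DistinguishedWithinO : (ℕ → ℝ → Set) → Set
  DistinguishedWithinO B = ∃[ C ] 0ᵣ < C × (∃[ N₀ ]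
    ∀ N .{{_ : NonZero N}} → N₀ ℕ.≤ N →
    ∀ k₁ k₂ → ¬ (k₁ ≡ k₂) →
    (f : NormalisedEigenform N k₁) (g : NormalisedEigenform N k₂) →
    ∀ x → B N x →
    ∃[ n ] 1 ℕ.≤ n × fromℕ n ≤ C *ᵣ x × coeff f n # coeff g n)

{-# OPTIONS --safe #-}
module Submission where

-- Let p be a prime with p ∤ N.  Comparing the coefficients of w^p and w^{p²},
-- w = e^{2πiz/p}, in T_p f = λ f gives λ = a_p and a_p² = a_{p²} + p^{k-1}.
-- Hence forms of different weights differ in a_p or in a_{p²}.  That some prime
-- p = O(log N) does not divide N is Chebyshev's estimate: if all primes up to s²
-- divide N, then every k ≤ s² divides N (s!)², while a common multiple of
-- 1, …, d + 1 is at least 2^d.  So n ≤ p² = O(log² N), within all three bounds.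
--
-- The points z = i p y₀ j have w = r^j for a real 0 < r ≤ 1/2, so an identity of
-- power series in w becomes one of asymptotic expansions along r^j → 0, and only
-- finitely many coefficients are compared.  Equalities and weak inequalities of
-- reals are negative statements, so they may be proved by contradiction.

open import Algebra.Bundles using (AbelianGroup; CommutativeRing; RawRing)
open import Data.Empty using (⊥-elim)
open import Data.Integer.Base as ℤ using (ℤ; +_; -[1+_]; 1ℤ)
import Data.Integer.Properties as ℤ
open import Data.List.Base using ([]; _∷_)
open import Data.List.Relation.Unary.All using (_∷_)
open import Data.Nat.Base as ℕ using (ℕ; zero; suc; NonZero; z≤n; s≤s; _!)
open import Data.Nat.ListAction using (product)
open import Data.Nat.Primality
  using (Prime; prime?; prime⇒irreducible; prime⇒nonTrivial; prime⇒nonZero; ¬prime[0]; ¬prime[1])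
import Data.Nat.Properties as ℕ
open import Data.Product.Base using (∃-syntax; _×_; _,_; proj₁; proj₂)
open import Data.Sum.Base using (_⊎_; inj₁; inj₂; [_,_]′)
open import Function.Base using (_∘_)
open import Level using (0ℓ; Level)
open import Relation.Binary.PropositionalEquality.Core as ≡ using (_≡_)
open import Relation.Nullary.Decidable using (Dec; does; yes; no; decidable-stable; ¬?; _×-dec_)
open import Relation.Nullary.Negation.Core using (¬_)
open import Defs

-- The relation at w^p does not involve the weight; it first shows in the relation at w^(p²),
-- through p^(k-1). Hence n must be allowed to reach p², and a prime of size log N yields a bound of
-- size log² N. The conclusion is apartness of complex numbers, with an actual choice between p and
-- p². Both are extracted from the apartness of p^(k₁-1) and p^(k₂-1): equality of integer weights
-- is decidable, and cotransitivity pushes the apartness of the two values of a_p² - a_(p²) back to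
-- one of the coefficients. Exponential, logarithm and π are given only as graphs, so the
-- exponential is built from its series. Every series is arranged to be dominated by A ρ^n with ρ ≤
-- 1/2, for which a tail is at most twice its first majorant. The prime estimate stays in ℕ, with a
-- binary logarithm m, and meets the natural logarithm only through e^(1/2) ≤ 2.

-- A prime of size O(log N) that does not divide N

module SmallNonDivisor where

  open import Data.Nat.Base hiding (NonZero; zero; suc; _!)
  open import Data.Nat.Properties
  open import Data.Nat.Divisibility
  open import Data.Nat.GCD using (gcd; gcd[m,n]∣m; gcd[m,n]∣n; gcd-greatest)
  open import Data.Nat.Induction using (<-wellFounded; Acc; acc)
  open import Data.Nat.Primality.Factorisation using (factorise)
  open import Data.Nat.Tactic.RingSolver using (solve-∀)
  open import Relation.Binary.PropositionalEquality using (refl; sym; trans; cong; cong₂; subst; subst₂; module ≡-Reasoning)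

  module LeibnizTriangle (M m : ℕ) .{{_ : NonZero M}}
                         (M-div : ∀ k → 1 ≤ k → k ≤ m → k ∣ M) where

    -- Cleared of denominators, v is M times the beta integral of x^i (1 - x)^j over [0, 1], which
    -- is i! j! / (i + j + 1)!. The apex i = j = 0 is M itself.
    IsEntry : ℕ → ℕ → ℕ → Set
    IsEntry i j v = v * suc (i + j) ! ≡ M * (i ! * j !)

    -- The edge i = 0 is M / (j + 1), integral by `M-div`. The other entries come from x^(i+1) (1 -
    -- x)^j = x^i (1 - x)^j - x^i (1 - x)^(j+1); the truncated subtraction is exact because the
    -- factorial identity exhibits the subtrahend as a summand.
    entry : ∀ i j → i + j < m → ∃[ v ] IsEntry i j v
    entry zero j j<m with M-div (suc j) (s≤s z≤n) j<m
    ... | divides q M≡q*[1+j] = q , (begin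
      q * (suc j * j !)      ≡⟨ *-assoc q (suc j) (j !) ⟨
      q * suc j * j !        ≡⟨ cong (_* j !) M≡q*[1+j] ⟨
      M * j !                ≡⟨ cong (M *_) (*-identityˡ (j !)) ⟨
      M * (1 * j !)          ∎)
      where open ≡-Reasoning
    entry (suc i) j i+j<m with entry i j (<-trans (n<1+n _) i+j<m)
                             | entry i (suc j) (subst (_< m) (sym (+-suc i j)) i+j<m)
    ... | a , a-entry | b , b-entry = a ∸ b , (begin
      (a ∸ b) * F′                             ≡⟨ *-distribʳ-∸ F′ a b ⟩
      a * F′ ∸ b * F′                          ≡⟨ cong (a * F′ ∸_) (trans (cong (λ n → b * suc n !) (sym (+-suc i j))) b-entry) ⟩
      a * F′ ∸ M * (i ! * (suc j * j !))       ≡⟨ cong (_∸ M * (i ! * (suc j * j !))) (trans (lemma₁ a (suc s) (suc s !)) (cong (suc (suc s) *_) a-entry)) ⟩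
      suc (suc s) * (M * (i ! * j !)) ∸ M * (i ! * (suc j * j !))
        ≡⟨ cong (_∸ M * (i ! * (suc j * j !))) (lemma₂ i j M (i !) (j !)) ⟩
      M * (suc i * i ! * j !) + M * (i ! * (suc j * j !)) ∸ M * (i ! * (suc j * j !))
        ≡⟨ m+n∸n≡m (M * (suc i * i ! * j !)) (M * (i ! * (suc j * j !))) ⟩
      M * (suc i * i ! * j !)                  ∎)
      where
      open ≡-Reasoning
      s  = i + j
      F′ = suc (suc s) !
      lemma₁ : ∀ a s f → a * (suc s * f) ≡ suc s * (a * f)
      lemma₁ = solve-∀
      lemma₂ : ∀ i j M f g → suc (suc (i + j)) * (M * (f * g)) ≡ M * (suc i * f * g) + M * (f * (suc j * g))
      lemma₂ = solve-∀

    -- Descending one row writes an entry as a sum of two, so d rows give 2^d summands. Each is at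
    -- least 1, since an entry 0 would force M i! j! = 0.
    2^d≤entry : ∀ d i j v → i + j + d < m → IsEntry i j v → 2 ^ d ≤ v
    2^d≤entry zero i j zero _ v-entry = ⊥-elim
      (≢-nonZero⁻¹ (M * (i ! * j !)) {{m*n≢0 M _ {{it}} {{i !* j !≢0}}}} (sym v-entry))
      where it = ≢-nonZero (≢-nonZero⁻¹ M)
    2^d≤entry zero i j (suc v) _ _ = s≤s z≤n
    2^d≤entry (suc d) i j v i+j+d<m v-entry
      with entry (suc i) j (≤-<-trans (m≤m+n _ d) i+j+d<m′) | entry i (suc j) (subst (_< m) (sym (+-suc i j)) (≤-<-trans (m≤m+n _ d) i+j+d<m′))
      where
      i+j+d<m′ : suc (i + j) + d < m
      i+j+d<m′ = subst (_< m) (+-suc (i + j) d) i+j+d<m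
    ... | a , a-entry | b , b-entry = begin
      2 ^ d + (2 ^ d + 0)   ≡⟨ cong (λ n → 2 ^ d + n) (+-identityʳ (2 ^ d)) ⟩
      2 ^ d + 2 ^ d         ≤⟨ +-mono-≤ (2^d≤entry d (suc i) j a i+j+d<m′ a-entry)
                                        (2^d≤entry d i (suc j) b (subst (λ n → n + d < m) (sym (+-suc i j)) i+j+d<m′) b-entry) ⟩
      a + b                 ≡⟨ *-cancelʳ-≡ v (a + b) F′ {{suc (suc s) !≢0}} v≡a+b ⟨
      v                     ∎
      where
      open ≤-Reasoning
      i+j+d<m′ : suc (i + j) + d < m
      i+j+d<m′ = subst (_< m) (+-suc (i + j) d) i+j+d<m
      s  = i + j
      F′ = suc (suc s) !
      lemma : ∀ i j v M f g h → v * h ≡ M * (f * g) →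
        v * (suc (suc (i + j)) * h) ≡ M * (suc i * f * g) + M * (f * (suc j * g))
      lemma i j v M f g h eq = trans (rearrange v (suc (suc (i + j))) h) (trans (cong (suc (suc (i + j)) *_) eq) (expand i j M f g))
        where
        rearrange : ∀ a b c → a * (b * c) ≡ b * (a * c)
        rearrange = solve-∀
        expand : ∀ i j M f g → suc (suc (i + j)) * (M * (f * g)) ≡ M * (suc i * f * g) + M * (f * (suc j * g))
        expand = solve-∀
      v≡a+b : v * F′ ≡ (a + b) * F′
      v≡a+b = trans (lemma i j v M (i !) (j !) (suc s !) v-entry)
             (trans (sym (cong₂ _+_ a-entry (trans (cong (λ n → b * suc n !) (sym (+-suc i j))) b-entry)))
                    (sym (*-distribʳ-+ F′ a b)))

  -- The entries M / ((n + 1) (n C k)) of the Leibniz harmonic triangle, scaled by M,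
  -- are positive integers, and each is the sum of the two below it.
  2^d≤commonMultiple : ∀ d M .{{_ : NonZero M}} → (∀ k → 1 ≤ k → k ≤ suc d → k ∣ M) → 2 ^ d ≤ M
  2^d≤commonMultiple d M M-div = LeibnizTriangle.2^d≤entry M (suc d) M-div d 0 0 M ≤-refl refl

  primeDivisor : ∀ n → 1 < n → ∃[ p ] Prime p × p ∣ n
  primeDivisor n@(suc _) 1<n with factorise n
  ... | record { factors = []    ; isFactorisation = n≡1 } = ⊥-elim (<-irrefl (sym n≡1) 1<n)
  ... | record { factors = p ∷ ps ; isFactorisation = n≡p*Πps ; factorsPrime = prime-p ∷ _ } =
    p , prime-p , divides (product ps) (trans n≡p*Πps (*-comm p (product ps)))

  -- k = a b² with a squarefree, so that a divides N once all its prime factors do.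
  squarePart : ∀ N k .{{_ : NonZero k}} → (∀ p → Prime p → p ∣ k → p ∣ N) →
               ∃[ b ] b * b ∣ k × k ∣ N * (b * b)
  squarePart N k = go k (<-wellFounded k)
    where
    go : ∀ k .{{_ : NonZero k}} → Acc _<_ k → (∀ p → Prime p → p ∣ k → p ∣ N) →
         ∃[ b ] b * b ∣ k × k ∣ N * (b * b)
    go k (acc rec) primes∣N with gcd[m,n]∣m k N
    ... | divides zero k≡0 = ⊥-elim (≢-nonZero⁻¹ k k≡0)
    ... | divides 1 k≡g = 1 , 1∣ k ,
      subst (_∣ N * 1) (trans (sym (*-identityˡ _)) (sym k≡g)) (∣-trans (gcd[m,n]∣n k N) (m∣m*n 1))
    -- A prime p dividing the cofactor h of gcd(k, N) in k divides k, hence N, hence the gcd as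
    -- well. So p² divides k and is split off; the process stops when k divides N.
    ... | divides h@(suc (suc _)) k≡h*g with primeDivisor h (s≤s (s≤s z≤n))
    ...   | p , prime-p , p∣h = descend p∣h (gcd-greatest p∣k (primes∣N p prime-p p∣k))
      where
      p∣k = subst (p ∣_) (sym k≡h*g) (∣m⇒∣m*n (gcd k N) p∣h)
      1<p : 1 < p
      1<p = nonTrivial⇒n>1 p {{prime⇒nonTrivial prime-p}}
      square-* : ∀ b p → b * p * (b * p) ≡ b * b * (p * p)
      square-* = solve-∀
      regroup : ∀ N b p → N * (b * b) * (p * p) ≡ N * (b * p * (b * p))
      regroup = solve-∀
      interchange : ∀ a b p → a * p * (b * p) ≡ a * b * (p * p)
      interchange = solve-∀
      remove : ∀ k′ → k ≡ k′ * (p * p) → ∃[ b ] b * b ∣ k × k ∣ N * (b * b)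
      remove k′ k≡k′p² = extend (go k′ {{k′≢0}} (rec k′<k) λ q prime-q q∣k′ →
        primes∣N q prime-q (subst (q ∣_) (sym k≡k′p²) (∣m⇒∣m*n (p * p) q∣k′)))
        where
        k′≢0 : NonZero k′
        k′≢0 = ≢-nonZero λ k′≡0 → ≢-nonZero⁻¹ k (trans k≡k′p² (cong (_* (p * p)) k′≡0))
        k′<k : k′ < k
        k′<k = subst (k′ <_) (sym k≡k′p²)
          (m<m*n k′ (p * p) {{k′≢0}} (*-mono-≤ {2} {p} {1} 1<p (<⇒≤ 1<p)))
        extend : ∃[ b ] b * b ∣ k′ × k′ ∣ N * (b * b) → ∃[ b ] b * b ∣ k × k ∣ N * (b * b)
        extend (b , b²∣k′ , k′∣Nb²) = b * p ,
          subst₂ _∣_ (sym (square-* b p)) (sym k≡k′p²) (*-monoˡ-∣ (p * p) b²∣k′) ,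
          subst₂ _∣_ (sym k≡k′p²) (regroup N b p) (*-monoˡ-∣ (p * p) k′∣Nb²)
      descend : p ∣ h → p ∣ gcd k N → ∃[ b ] b * b ∣ k × k ∣ N * (b * b)
      descend (divides h′ h≡h′p) (divides g′ g≡g′p) =
        remove (h′ * g′) (trans k≡h*g (trans (cong₂ _*_ h≡h′p g≡g′p) (interchange h′ g′ p)))

  n!≤n^n : ∀ n → n ! ≤ n ^ n
  n!≤n^n zero    = ≤-refl
  n!≤n^n (suc n) = *-monoʳ-≤ (suc n) (≤-trans (n!≤n^n n) (^-monoˡ-≤ n (n≤1+n n)))

  4^n≡2^n*2^n : ∀ n → 4 ^ n ≡ 2 ^ n * 2 ^ n
  4^n≡2^n*2^n zero    = refl
  4^n≡2^n*2^n (suc n) = trans (cong (4 *_) (4^n≡2^n*2^n n)) (lemma (2 ^ n))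
    where
    lemma : ∀ a → 4 * (a * a) ≡ 2 * a * (2 * a)
    lemma = solve-∀

  m*m≤n*n⇒m≤n : ∀ m n → m * m ≤ n * n → m ≤ n
  m*m≤n*n⇒m≤n m n m²≤n² = ≮⇒≥ λ n<m → <⇒≱ (*-mono-< n<m n<m) m²≤n²

  n∣n! : ∀ n .{{_ : NonZero n}} → n ∣ n !
  n∣n! (suc n) = m∣m*n (n !)

  -- Here s = 2^t: a square b² dividing some k ≤ s² has b ≤ s, so b divides s!. With s a power of 2,
  -- the estimate s! ≤ s^s is again by a power of 2.
  4^t-1≤ : ∀ t N .{{_ : NonZero N}} → (∀ p → Prime p → p ≤ 4 ^ t → p ∣ N) →
           2 ^ pred (4 ^ t) ≤ N * ((2 ^ t) ! * (2 ^ t) !)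
  4^t-1≤ t N small∣N = 2^d≤commonMultiple (pred (4 ^ t)) _
    {{m*n≢0 N _ {{≢-nonZero (≢-nonZero⁻¹ N)}} {{(2 ^ t) !* (2 ^ t) !≢0}}}} k∣
    where
    k∣ : ∀ k → 1 ≤ k → k ≤ suc (pred (4 ^ t)) → k ∣ N * ((2 ^ t) ! * (2 ^ t) !)
    k∣ k@(suc _) 1≤k k≤ = extend (squarePart N k (λ p pp p∣k → small∣N p pp (≤-trans (∣⇒≤ p∣k) k≤4^t)))
      where
      k≤4^t : k ≤ 4 ^ t
      k≤4^t = subst (k ≤_) (suc-pred (4 ^ t) {{m^n≢0 4 t}}) k≤
      extend : ∃[ b ] b * b ∣ k × k ∣ N * (b * b) → k ∣ N * ((2 ^ t) ! * (2 ^ t) !)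
      extend (zero , 0∣k , _) = ⊥-elim (≢-nonZero⁻¹ k (0∣⇒≡0 0∣k))
      extend (b@(suc _) , b²∣k , k∣Nb²) = ∣-trans k∣Nb² (*-monoʳ-∣ N (*-pres-∣ b∣ b∣))
        where
        b≤2^t : b ≤ 2 ^ t
        b≤2^t = m*m≤n*n⇒m≤n b (2 ^ t) (≤-trans (∣⇒≤ b²∣k) (subst (k ≤_) (4^n≡2^n*2^n t) k≤4^t))
        b∣ : b ∣ (2 ^ t) !
        b∣ = ∣-trans (n∣n! b) (m≤n⇒m!∣n! b≤2^t)

  -- The offset 4 is the least possible: at 3 the inequality would read 17 ≤ 16.
  4u+5≤2*2^u : ∀ u → 4 * (4 + u) + 5 ≤ 2 * 2 ^ (4 + u)
  4u+5≤2*2^u zero    = m≤m+n 21 11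
  4u+5≤2*2^u (suc u) = begin
    4 * suc (4 + u) + 5          ≤⟨ m≤m+n _ (4 * (3 + u) + 5) ⟩
    4 * suc (4 + u) + 5 + (4 * (3 + u) + 5)    ≡⟨ lemma u ⟩
    2 * (4 * (4 + u) + 5)        ≤⟨ *-monoʳ-≤ 2 (4u+5≤2*2^u u) ⟩
    2 * (2 * 2 ^ (4 + u))        ∎
    where
    open ≤-Reasoning
    lemma : ∀ u → 4 * suc (4 + u) + 5 + (4 * (3 + u) + 5) ≡ 2 * (4 * (4 + u) + 5)
    lemma = solve-∀

  -- The exponent 4^(u+1) is split into two halves 2 · 4^u: one is the lower bound wanted for the
  -- binary logarithm of N, the other absorbs (s!)² ≤ s^(2s) with s = 2^(u+1). The extra 1 pays for
  -- the `pred` in `4^t-1≤`.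
  exponent-bound : ∀ v → let u = 4 + v in
    suc (2 * 4 ^ u + (suc u * 2 ^ suc u + suc u * 2 ^ suc u)) ≤ 4 ^ suc u
  exponent-bound v = begin
    suc (2 * 4 ^ u + (suc u * 2 ^ suc u + suc u * 2 ^ suc u))
      ≤⟨ +-monoˡ-≤ _ (m^n>0 2 u) ⟩
    2 ^ u + (2 * 4 ^ u + (suc u * 2 ^ suc u + suc u * 2 ^ suc u))
      ≡⟨ lemma₁ u (2 ^ u) (4 ^ u) ⟩
    2 * 4 ^ u + (4 * u + 5) * 2 ^ u
      ≤⟨ +-monoʳ-≤ (2 * 4 ^ u) (*-monoˡ-≤ (2 ^ u) (4u+5≤2*2^u v)) ⟩
    2 * 4 ^ u + 2 * 2 ^ u * 2 ^ u
      ≡⟨ cong (λ n → 2 * 4 ^ u + n) (trans (*-assoc 2 (2 ^ u) (2 ^ u)) (cong (2 *_) (sym (4^n≡2^n*2^n u)))) ⟩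
    2 * 4 ^ u + 2 * 4 ^ u
      ≡⟨ lemma₂ (4 ^ u) ⟩
    4 * 4 ^ u ∎
    where
    open ≤-Reasoning
    u = 4 + v
    lemma₁ : ∀ u a b → a + (2 * b + (suc u * (2 * a) + suc u * (2 * a))) ≡ 2 * b + (4 * u + 5) * a
    lemma₁ = solve-∀
    lemma₂ : ∀ b → 2 * b + 2 * b ≡ 4 * b
    lemma₂ = solve-∀

  -- Otherwise N (s!)² would be less than 2^(4^t - 1), too small for a common multiple of 1, ...,
  -- 4^t.
  2^[2*4^u]≤ : ∀ v N .{{_ : NonZero N}} → let u = 4 + v in
               (∀ p → Prime p → p ≤ 4 ^ suc u → p ∣ N) → 2 ^ (2 * 4 ^ u) ≤ N
  2^[2*4^u]≤ v N small∣N = ≮⇒≥ λ N<2^m → <⇒≱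
    (begin-strict
      N * ((2 ^ t) ! * (2 ^ t) !)                      ≤⟨ *-monoʳ-≤ N (*-mono-≤ [2^t]!≤ [2^t]!≤) ⟩
      N * (2 ^ e * 2 ^ e)                          <⟨ *-monoˡ-< (2 ^ e * 2 ^ e) {{m*n≢0 (2 ^ e) (2 ^ e) {{m^n≢0 2 e}} {{m^n≢0 2 e}}}} N<2^m ⟩
      2 ^ (2 * 4 ^ u) * (2 ^ e * 2 ^ e)            ≡⟨ cong (2 ^ (2 * 4 ^ u) *_) (^-distribˡ-+-* 2 e e) ⟨
      2 ^ (2 * 4 ^ u) * 2 ^ (e + e)                ≡⟨ ^-distribˡ-+-* 2 (2 * 4 ^ u) (e + e) ⟨
      2 ^ (2 * 4 ^ u + (e + e))                    ≤⟨ ^-monoʳ-≤ 2 (pred-mono-≤ (exponent-bound v)) ⟩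
      2 ^ pred (4 ^ t)                             ∎)
    (4^t-1≤ t N small∣N)
    where
    open ≤-Reasoning
    u = 4 + v
    t = suc u
    e = t * 2 ^ t
    [2^t]!≤ : (2 ^ t) ! ≤ 2 ^ e
    [2^t]!≤ = ≤-trans (n!≤n^n (2 ^ t)) (≤-reflexive (^-*-assoc 2 t (2 ^ t)))

  -- Primality and divisibility are decidable and the range is finite, so refuting that all small
  -- primes divide N produces a witness.
  primeNonDivisor-≤ : ∀ v N .{{_ : NonZero N}} → N < 2 ^ (2 * 4 ^ (4 + v)) →
                      ∃[ p ] Prime p × ¬ (p ∣ N) × p ≤ 4 ^ (5 + v)
  primeNonDivisor-≤ v N N<2^m
    with anyUpTo? (λ p → prime? p ×-dec ¬? (p ∣? N)) (suc (4 ^ (5 + v)))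
  ... | yes (p , s≤s p≤ , prime-p , p∤N) = p , prime-p , p∤N , p≤
  ... | no none = ⊥-elim (<⇒≱ N<2^m (2^[2*4^u]≤ v N λ p pp p≤ →
          decidable-stable (p ∣? N) λ p∤N → none (p , s≤s p≤ , pp , p∤N)))

  -- The value 2^128 is the lower end of the first window (v = 0) among 2^(2 · 4^(3+v)) ≤ N < 2^(2 ·
  -- 4^(4+v)); `primeNonDivisor-≤` handles the upper ends.
  N₀ : ℕ
  N₀ = 2 ^ (2 * 4 ^ 3)

  n<2^n : ∀ n → n < 2 ^ n
  n<2^n zero    = ≤-refl
  n<2^n (suc n) = begin-strict
    suc n           ≤⟨ n<2^n n ⟩
    2 ^ n           <⟨ m<m+n (2 ^ n) (≤-trans (m^n>0 2 n) (m≤m+n (2 ^ n) 0)) ⟩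
    2 ^ n + (2 ^ n + 0) ∎
    where open ≤-Reasoning

  -- With m = 2 · 4^(3+v) the windows are 2^m ≤ N < 2^(4m). The upper end gives a prime p ≤ 4^(5+v)
  -- = 8m, and the lower end ties m to log N.
  primeNonDivisor : ∀ N .{{_ : NonZero N}} → N₀ ≤ N →
    ∃[ p ] ∃[ m ] Prime p × ¬ (p ∣ N) × p ≤ 8 * m × 2 ^ m ≤ N
  primeNonDivisor N = search N 0 N<2^[N]
    where
    open ≤-Reasoning
    N<2^[N] : N < 2 ^ (2 * 4 ^ (4 + (N + 0)))
    N<2^[N] = begin-strict
      N                                     <⟨ n<2^n N ⟩
      2 ^ N                                 ≤⟨ ^-monoʳ-≤ 2 N≤ ⟩
      2 ^ (2 * 4 ^ (4 + (N + 0)))           ∎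
      where
      N≤ : N ≤ 2 * 4 ^ (4 + (N + 0))
      N≤ = begin
        N                        ≤⟨ <⇒≤ (n<2^n N) ⟩
        2 ^ N                    ≤⟨ ^-monoˡ-≤ N (m≤m+n 2 2) ⟩
        4 ^ N                    ≤⟨ ^-monoʳ-≤ 4 (≤-trans (≤-reflexive (sym (+-identityʳ N))) (m≤n+m (N + 0) 4)) ⟩
        4 ^ (4 + (N + 0))        ≤⟨ m≤m+n _ _ ⟩
        2 * 4 ^ (4 + (N + 0))    ∎
    -- Windows are tried upwards from v; the invariant keeps N below the upper end of window fuel +
    -- v. Fuel N suffices, as N < 2^N and N ≤ 2 · 4^(4+N).
    search : ∀ fuel v → N < 2 ^ (2 * 4 ^ (4 + (fuel + v))) → 2 ^ (2 * 4 ^ (3 + v)) ≤ N →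
             ∃[ p ] ∃[ m ] Prime p × ¬ (p ∣ N) × p ≤ 8 * m × 2 ^ m ≤ N
    found : ∀ v → N < 2 ^ (2 * 4 ^ (4 + v)) → 2 ^ (2 * 4 ^ (3 + v)) ≤ N →
            ∃[ p ] ∃[ m ] Prime p × ¬ (p ∣ N) × p ≤ 8 * m × 2 ^ m ≤ N
    found v N< ≤N with primeNonDivisor-≤ v N N<
    ... | p , prime-p , p∤N , p≤ = p , 2 * 4 ^ (3 + v) , prime-p , p∤N ,
      ≤-trans p≤ (≤-reflexive (lemma (4 ^ (3 + v)))) , ≤N
      where
      lemma : ∀ a → 4 * (4 * a) ≡ 8 * (2 * a)
      lemma = solve-∀
    search zero       v N< ≤N = found v N< ≤N
    search (suc fuel) v N< ≤N with N <? 2 ^ (2 * 4 ^ (4 + v))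
    ... | yes N<′ = found v N<′ ≤N
    ... | no  N≮  = search fuel (suc v) (subst (λ n → N < 2 ^ (2 * 4 ^ (4 + n))) (sym (+-suc fuel v)) N<) (≮⇒≥ N≮)

-- A solver for ring identities with integer numerals

module IntegerRingSolver {c ℓ : Level} (R : CommutativeRing c ℓ) where

  open import Algebra.Solver.Ring.AlmostCommutativeRing
    using (fromCommutativeRing; _-Raw-AlmostCommutative⟶_)
  open import Data.Integer.Properties as ℤ using ([1+m]⊖[1+n]≡m⊖n)
  open import Data.Maybe.Base using (Maybe; map)
  open import Data.Sign.Base as Sign using (Sign)
  open import Relation.Nullary.Decidable.Core using (dec⇒maybe)
  open CommutativeRing R
  open import Algebra.Properties.Ring ring
  open import Algebra.Properties.AbelianGroup +-abelianGroup using (⁻¹-∙-comm)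
  open import Algebra.Properties.Semiring.Mult.TCOptimised semiring using (1+×; ×-homo-+; ×1-homo-*) renaming (_×_ to _·_)
  open import Relation.Binary.Reasoning.Setoid setoid

  -- Numerals come from ℤ, whose equality is decidable, unlike that of ℝ or ℂ. The optimised
  -- multiple sends 1 to the unit itself, whereas `fromℕ 2` is 1 + (1 + 0); identities about such
  -- numbers spell that sum out.
  ⟦_⟧ : ℤ → Carrier
  ⟦ + n ⟧      = n · 1#
  ⟦ -[1+ n ] ⟧ = - (suc n · 1#)

  [x+y]-[x+z]≈y-z : ∀ x y z → (x + y) - (x + z) ≈ y - z
  [x+y]-[x+z]≈y-z x y z = begin
    (x + y) - (x + z)      ≈⟨ +-cong (+-comm x y) (sym (⁻¹-∙-comm x z)) ⟩
    (y + x) + (- x - z)    ≈⟨ +-assoc y x _ ⟩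
    y + (x + (- x - z))    ≈⟨ +-congˡ (+-assoc x (- x) (- z)) ⟨
    y + ((x - x) - z)      ≈⟨ +-congˡ (+-congʳ (-‿inverseʳ x)) ⟩
    y + (0# - z)           ≈⟨ +-congˡ (+-identityˡ (- z)) ⟩
    y - z                  ∎

  ⊖-homo : ∀ m n → ⟦ m ℤ.⊖ n ⟧ ≈ m · 1# - n · 1#
  ⊖-homo zero    zero    = sym (-‿inverseʳ 0#)
  ⊖-homo zero    (suc n) = sym (+-identityˡ _)
  ⊖-homo (suc m) zero    = sym (trans (+-congˡ -0#≈0#) (+-identityʳ _))
  ⊖-homo (suc m) (suc n) = begin
    ⟦ suc m ℤ.⊖ suc n ⟧             ≡⟨ ≡.cong ⟦_⟧ ([1+m]⊖[1+n]≡m⊖n m n) ⟩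
    ⟦ m ℤ.⊖ n ⟧                     ≈⟨ ⊖-homo m n ⟩
    m · 1# - n · 1#                 ≈⟨ [x+y]-[x+z]≈y-z 1# _ _ ⟨
    (1# + m · 1#) - (1# + n · 1#)   ≈⟨ +-cong (sym (1+× m 1#)) (-‿cong (sym (1+× n 1#))) ⟩
    suc m · 1# - suc n · 1#         ∎

  +-homo : ∀ i j → ⟦ i ℤ.+ j ⟧ ≈ ⟦ i ⟧ + ⟦ j ⟧
  +-homo (+ m)      (+ n)      = ×-homo-+ 1# m n
  +-homo (+ m)      (-[1+ n ]) = ⊖-homo m (suc n)
  +-homo (-[1+ m ]) (+ n)      = trans (⊖-homo n (suc m)) (+-comm _ _)
  +-homo (-[1+ m ]) (-[1+ n ]) = begin
    - (suc (suc (m ℕ.+ n)) · 1#)         ≈⟨ -‿cong (1+× (suc (m ℕ.+ n)) 1#) ⟩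
    - (1# + (suc m ℕ.+ n) · 1#)          ≈⟨ -‿cong (+-congˡ (×-homo-+ 1# (suc m) n)) ⟩
    - (1# + (suc m · 1# + n · 1#))       ≈⟨ -‿cong (x∙yz≈y∙xz 1# (suc m · 1#) (n · 1#)) ⟩
    - (suc m · 1# + (1# + n · 1#))       ≈⟨ -‿cong (+-congˡ (1+× n 1#)) ⟨
    - (suc m · 1# + suc n · 1#)          ≈⟨ ⁻¹-∙-comm _ _ ⟨
    - (suc m · 1#) - suc n · 1#          ∎
    where open import Algebra.Properties.CommutativeSemigroup +-commutativeSemigroup using (x∙yz≈y∙xz)

  +◃-homo : ∀ n → ⟦ Sign.+ ℤ.◃ n ⟧ ≈ n · 1#
  +◃-homo zero    = refl
  +◃-homo (suc n) = refl

  -◃-homo : ∀ n → ⟦ Sign.- ℤ.◃ n ⟧ ≈ - (n · 1#)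
  -◃-homo zero    = sym -0#≈0#
  -◃-homo (suc n) = refl

  *-homo : ∀ i j → ⟦ i ℤ.* j ⟧ ≈ ⟦ i ⟧ * ⟦ j ⟧
  *-homo (+ m)      (+ n)      = trans (+◃-homo (m ℕ.* n)) (×1-homo-* m n)
  *-homo (+ m)      (-[1+ n ]) = trans (-◃-homo (m ℕ.* suc n)) (trans (-‿cong (×1-homo-* m (suc n))) (-‿distribʳ-* _ _))
  *-homo (-[1+ m ]) (+ n)      = trans (-◃-homo (suc m ℕ.* n)) (trans (-‿cong (×1-homo-* (suc m) n)) (-‿distribˡ-* _ _))
  *-homo (-[1+ m ]) (-[1+ n ]) = begin
    (suc m ℕ.* suc n) · 1#          ≈⟨ ×1-homo-* (suc m) (suc n) ⟩
    suc m · 1# * suc n · 1#         ≈⟨ -‿involutive _ ⟨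
    - - (suc m · 1# * suc n · 1#)   ≈⟨ -‿cong (-‿distribʳ-* _ _) ⟩
    - (suc m · 1# * - (suc n · 1#)) ≈⟨ -‿distribˡ-* _ _ ⟩
    - (suc m · 1#) * - (suc n · 1#) ∎

  -‿homo : ∀ i → ⟦ ℤ.- i ⟧ ≈ - ⟦ i ⟧
  -‿homo (+ zero)    = sym -0#≈0#
  -‿homo (+ (suc n)) = refl
  -‿homo (-[1+ n ])  = sym (-‿involutive _)

  homomorphism : CommutativeRing.rawRing ℤ.+-*-commutativeRing -Raw-AlmostCommutative⟶ fromCommutativeRing R
  homomorphism = record
    { ⟦_⟧    = ⟦_⟧
    ; +-homo = +-homo
    ; *-homo = *-homo
    ; -‿homo = -‿homo
    ; 0-homo = refl
    ; 1-homo = refl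
    }

  ⟦_⟧-weaklyDecidable : ∀ i j → Maybe (⟦ i ⟧ ≈ ⟦ j ⟧)
  ⟦ i ⟧-weaklyDecidable j = map (λ i≡j → reflexive (≡.cong ⟦_⟧ i≡j)) (dec⇒maybe (i ℤ.≟ j))

  open import Algebra.Solver.Ring _ _ homomorphism ⟦_⟧-weaklyDecidable public
    using (solve; _:=_; _:+_; _:*_; _:-_; :-_; con)

-- Constructive order and apartness on ℝ

module RealProperties (R : RealNumbers) where

  open RealNumbers R
  open Analysis R using (1/_; 1/-inverse; 1/-pos; fromℕ-pos)
  open IntegerRingSolver commutativeRing
  open CommutativeRing commutativeRing using (semiring; commutativeSemiring)
  open import Algebra.Apartness.Properties.HeytingCommutativeRing heytingCommutativeRing
    using (#-congʳ)
  open import Algebra.Properties.Semiring.Exp semiring public using (^-congˡ; ^-homo-*; ^-assocʳ)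
  open import Algebra.Properties.Semiring.Mult semiring using (×1-homo-*)
  open import Relation.Binary.Structures using (IsPreorder)

  x-0≈x : ∀ x → x - 0# ≈ x
  x-0≈x = solve 1 (λ x → x :- con (+ 0) := x) refl

  -- Apartness is invertibility of the difference; passing to x - y only inserts a subtracted 0.
  #⇒-#0 : ∀ {x y} → x # y → x - y # 0#
  #⇒-#0 {x} {y} x#y with #⇒invertible x#y
  ... | i , ix≈1 , xi≈1 = invertible⇒#
    (i , trans (*-congˡ (x-0≈x (x - y))) ix≈1 , trans (*-congʳ (x-0≈x (x - y))) xi≈1)

  -#0⇒# : ∀ {x y} → x - y # 0# → x # y
  -#0⇒# {x} {y} x-y#0 with #⇒invertible x-y#0
  ... | i , ix≈1 , xi≈1 = invertible⇒#
    (i , trans (*-congˡ (sym (x-0≈x (x - y)))) ix≈1 , trans (*-congʳ (sym (x-0≈x (x - y)))) xi≈1)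

  <-asym : ∀ {x y} → x < y → ¬ (y < x)
  <-asym x<y y<x = <-irrefl refl (<-trans x<y y<x)

  <⇒≤ : ∀ {x y} → x < y → x ≤ y
  <⇒≤ = <-asym

  ≤-reflexive : ∀ {x y} → x ≈ y → x ≤ y
  ≤-reflexive x≈y y<x = <-irrefl (sym x≈y) y<x

  ≤-refl : ∀ {x} → x ≤ x
  ≤-refl = ≤-reflexive refl

  -- The substitute for trichotomy. Apartness supplies the comparison with z, and transitivity
  -- repairs the case in which it points the wrong way.
  <-cotrans : ∀ {x y} → x < y → ∀ z → x < z ⊎ z < y
  <-cotrans {x} {y} x<y z with #-cotrans (<⇒# x<y) z
  ... | inj₁ x#z = [ inj₁ , (λ z<x → inj₂ (<-trans z<x x<y)) ]′ (#⇒<⊎> x#z)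
  ... | inj₂ z#y = [ inj₂ , (λ y<z → inj₁ (<-trans x<y y<z)) ]′ (#⇒<⊎> z#y)

  <-≤-trans : ∀ {x y z} → x < y → y ≤ z → x < z
  <-≤-trans {z = z} x<y y≤z = [ (λ x<z → x<z) , (λ z<y → ⊥-elim (y≤z z<y)) ]′ (<-cotrans x<y z)

  ≤-<-trans : ∀ {x y z} → x ≤ y → y < z → x < z
  ≤-<-trans {x} x≤y y<z = [ (λ y<x → ⊥-elim (x≤y y<x)) , (λ x<z → x<z) ]′ (<-cotrans y<z x)

  ≤-trans : ∀ {x y z} → x ≤ y → y ≤ z → x ≤ z
  ≤-trans x≤y y≤z z<x = y≤z (<-≤-trans z<x x≤y)

  ≤-antisym : ∀ {x y} → x ≤ y → y ≤ x → x ≈ y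
  ≤-antisym x≤y y≤x = proj₁ (tight _ _) ([ y≤x , x≤y ]′ ∘ #⇒<⊎>)

  ≤-isPreorder : IsPreorder _≈_ _≤_
  ≤-isPreorder = record { isEquivalence = isEquivalence ; reflexive = ≤-reflexive ; trans = ≤-trans }

  module ≤-Reasoning where
    open import Relation.Binary.Reasoning.Base.Triple
      ≤-isPreorder <-asym <-trans <-resp-≈ <⇒≤ <-≤-trans ≤-<-trans public
      hiding (step-≡; step-≡-⟩; step-≡-⟨; step-≡-∣; step-≡˘)

  open ≤-Reasoning

  0<y-x⇒x<y : ∀ {x y} → 0# < y - x → x < y
  0<y-x⇒x<y {x} {y} 0<y-x = begin-strict
    x             ≈⟨ +-identityˡ x ⟨
    0# + x        <⟨ +-monoˡ-< x 0<y-x ⟩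
    (y - x) + x   ≈⟨ solve 2 (λ x y → (y :- x) :+ x := y) refl x y ⟩
    y             ∎

  x<y⇒0<y-x : ∀ {x y} → x < y → 0# < y - x
  x<y⇒0<y-x {x} {y} x<y = begin-strict
    0#      ≈⟨ -‿inverseʳ x ⟨
    x - x   <⟨ +-monoˡ-< (- x) x<y ⟩
    y - x   ∎

  0≤y-x⇒x≤y : ∀ {x y} → 0# ≤ y - x → x ≤ y
  0≤y-x⇒x≤y {x} {y} 0≤y-x y<x = 0≤y-x (begin-strict
    y - x       ≈⟨ solve 2 (λ x y → y :- x := :- (x :- y)) refl x y ⟩
    - (x - y)   ≈⟨ +-identityˡ _ ⟨
    0# - (x - y)      <⟨ +-monoˡ-< (- (x - y)) (x<y⇒0<y-x y<x) ⟩
    (x - y) - (x - y) ≈⟨ -‿inverseʳ _ ⟩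
    0#          ∎)

  x≤y⇒0≤y-x : ∀ {x y} → x ≤ y → 0# ≤ y - x
  x≤y⇒0≤y-x {x} {y} x≤y y-x<0 = x≤y (0<y-x⇒x<y (begin-strict
    0#                ≈⟨ -‿inverseʳ _ ⟨
    (y - x) - (y - x) <⟨ +-monoˡ-< (- (y - x)) y-x<0 ⟩
    0# - (y - x)      ≈⟨ solve 2 (λ x y → con (+ 0) :- (y :- x) := x :- y) refl x y ⟩
    x - y             ∎))

  +-monoˡ-≤ : ∀ z {x y} → x ≤ y → x + z ≤ y + z
  +-monoˡ-≤ z {x} {y} x≤y = 0≤y-x⇒x≤y (begin
    0#                  ≤⟨ x≤y⇒0≤y-x x≤y ⟩
    y - x               ≈⟨ solve 3 (λ x y z → y :- x := (y :+ z) :- (x :+ z)) refl x y z ⟩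
    (y + z) - (x + z)   ∎)

  +-mono-≤ : ∀ {x y u v} → x ≤ y → u ≤ v → x + u ≤ y + v
  +-mono-≤ {x} {y} {u} {v} x≤y u≤v = begin
    x + u   ≤⟨ +-monoˡ-≤ u x≤y ⟩
    y + u   ≈⟨ +-comm y u ⟩
    u + y   ≤⟨ +-monoˡ-≤ y u≤v ⟩
    v + y   ≈⟨ +-comm v y ⟩
    y + v   ∎

  +-monoʳ-≤ : ∀ z {x y} → x ≤ y → z + x ≤ z + y
  +-monoʳ-≤ z x≤y = +-mono-≤ (≤-refl {z}) x≤y

  +-mono-<-≤ : ∀ {x y u v} → x < y → u ≤ v → x + u < y + v
  +-mono-<-≤ {x} {y} {u} {v} x<y u≤v = begin-strict
    x + u   <⟨ +-monoˡ-< u x<y ⟩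
    y + u   ≤⟨ +-monoʳ-≤ y u≤v ⟩
    y + v   ∎

  0≤+ : ∀ {x y} → 0# ≤ x → 0# ≤ y → 0# ≤ x + y
  0≤+ {x} {y} 0≤x 0≤y = ≤-trans (≤-reflexive (sym (+-identityˡ 0#))) (+-mono-≤ 0≤x 0≤y)

  x≤x+y : ∀ {x y} → 0# ≤ y → x ≤ x + y
  x≤x+y {x} {y} 0≤y = ≤-trans (≤-reflexive (sym (+-identityʳ x))) (+-monoʳ-≤ x 0≤y)

  0<+ : ∀ {x y} → 0# < x → 0# ≤ y → 0# < x + y
  0<+ 0<x 0≤y = <-≤-trans 0<x (x≤x+y 0≤y)

  0<-x : ∀ {x} → x < 0# → 0# < - x
  0<-x {x} x<0 = <-respʳ-≈ (+-identityˡ _) (x<y⇒0<y-x x<0)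

  -- If i inverts xy, then y i inverts x.
  xy#0⇒x#0 : ∀ {x y} → x * y # 0# → x # 0#
  xy#0⇒x#0 {x} {y} xy#0 with #⇒invertible xy#0
  ... | i , ixy≈1 , _ = invertible⇒#
    (y * i , trans (trans (*-congˡ (x-0≈x x)) lemma) ixy≈1 , trans (trans (*-congʳ (x-0≈x x)) lemma′) ixy≈1)
    where
    lemma : y * i * x ≈ i * (x * y - 0#)
    lemma = solve 3 (λ x y i → y :* i :* x := i :* (x :* y :- con (+ 0))) refl x y i
    lemma′ : x * (y * i) ≈ i * (x * y - 0#)
    lemma′ = solve 3 (λ x y i → x :* (y :* i) := i :* (x :* y :- con (+ 0))) refl x y i

  xy#0⇒y#0 : ∀ {x y} → x * y # 0# → y # 0#
  xy#0⇒y#0 {x} {y} xy#0 = xy#0⇒x#0 (#-congʳ (*-comm x y) xy#0)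

  0≤∧#0⇒0< : ∀ {x} → 0# ≤ x → x # 0# → 0# < x
  0≤∧#0⇒0< 0≤x x#0 = [ (λ x<0 → ⊥-elim (0≤x x<0)) , (λ 0<x → 0<x) ]′ (#⇒<⊎> x#0)

  -- The signs of x and y cannot be decided, but assuming xy < 0 makes both factors apart from 0,
  -- and nonnegative factors are then positive.
  0≤* : ∀ {x y} → 0# ≤ x → 0# ≤ y → 0# ≤ x * y
  0≤* 0≤x 0≤y xy<0 = <-asym xy<0 (*-pos (0≤∧#0⇒0< 0≤x (xy#0⇒x#0 (<⇒# xy<0)))
                                         (0≤∧#0⇒0< 0≤y (xy#0⇒y#0 (<⇒# xy<0))))

  #0⇒0<xx : ∀ {x} → x # 0# → 0# < x * x
  #0⇒0<xx {x} x#0 with #⇒<⊎> x#0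
  ... | inj₂ 0<x = *-pos 0<x 0<x
  ... | inj₁ x<0 = <-respʳ-≈ (solve 1 (λ x → (:- x) :* (:- x) := x :* x) refl x) (*-pos (0<-x x<0) (0<-x x<0))

  0≤xx : ∀ x → 0# ≤ x * x
  0≤xx x xx<0 = <-asym xx<0 (#0⇒0<xx (xy#0⇒x#0 (<⇒# xx<0)))

  0≤1 : 0# ≤ 1#
  0≤1 = <⇒≤ 0<1

  *-monoˡ-≤ : ∀ z {x y} → 0# ≤ z → x ≤ y → x * z ≤ y * z
  *-monoˡ-≤ z {x} {y} 0≤z x≤y = 0≤y-x⇒x≤y (begin
    0#              ≤⟨ 0≤* (x≤y⇒0≤y-x x≤y) 0≤z ⟩
    (y - x) * z     ≈⟨ solve 3 (λ x y z → (y :- x) :* z := y :* z :- x :* z) refl x y z ⟩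
    y * z - x * z   ∎)

  *-monoʳ-≤ : ∀ z {x y} → 0# ≤ z → x ≤ y → z * x ≤ z * y
  *-monoʳ-≤ z {x} {y} 0≤z x≤y =
    ≤-trans (≤-reflexive (*-comm z x)) (≤-trans (*-monoˡ-≤ z 0≤z x≤y) (≤-reflexive (*-comm y z)))

  *-mono-≤ : ∀ {x y u v} → 0# ≤ x → 0# ≤ v → x ≤ y → u ≤ v → x * u ≤ y * v
  *-mono-≤ {x} {y} {u} {v} 0≤x 0≤v x≤y u≤v = ≤-trans (*-monoʳ-≤ x 0≤x u≤v) (*-monoˡ-≤ v 0≤v x≤y)

  *-monoˡ-< : ∀ z {x y} → 0# < z → x < y → x * z < y * z
  *-monoˡ-< z {x} {y} 0<z x<y = 0<y-x⇒x<y (begin-strict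
    0#              <⟨ *-pos (x<y⇒0<y-x x<y) 0<z ⟩
    (y - x) * z     ≈⟨ solve 3 (λ x y z → (y :- x) :* z := y :* z :- x :* z) refl x y z ⟩
    y * z - x * z   ∎)

  *-cancelˡ-≤ : ∀ z {x y} → 0# < z → z * x ≤ z * y → x ≤ y
  *-cancelˡ-≤ z {x} {y} 0<z zx≤zy y<x =
    zx≤zy (<-respˡ-≈ (*-comm y z) (<-respʳ-≈ (*-comm x z) (*-monoˡ-< z 0<z y<x)))

  -- A strict inequality needs positive evidence: z (y - x) is apart from 0, hence so is y - x, and
  -- then its sign can be read off.
  *-cancelˡ-< : ∀ z {x y} → 0# < z → z * x < z * y → x < y
  *-cancelˡ-< z {x} {y} 0<z zx<zy = [ y-x≮0 , 0<y-x⇒x<y ]′ (#⇒<⊎> (xy#0⇒y#0 z[y-x]#0))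
    where
    z[y-x]#0 : z * (y - x) # 0#
    z[y-x]#0 = #-congʳ (solve 3 (λ x y z → z :* y :- z :* x := z :* (y :- x)) refl x y z)
                       (#⇒-#0 (#-sym (<⇒# zx<zy)))
    y-x≮0 : y - x < 0# → x < y
    y-x≮0 y-x<0 = ⊥-elim (*-monoʳ-≤ z (<⇒≤ 0<z) (0≤y-x⇒x≤y (<⇒≤ (<-respʳ-≈
      (solve 2 (λ x y → :- (y :- x) := x :- y) refl x y) (0<-x y-x<0)))) zx<zy)

  xx≤yy⇒x≤y : ∀ {x y} → 0# ≤ y → x * x ≤ y * y → x ≤ y
  xx≤yy⇒x≤y {x} {y} 0≤y xx≤yy y<x = xx≤yy (0<y-x⇒x<y (begin-strict
    0#                  <⟨ *-pos (x<y⇒0<y-x y<x) (0<+ (≤-<-trans 0≤y y<x) 0≤y) ⟩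
    (x - y) * (x + y)   ≈⟨ solve 2 (λ x y → (x :- y) :* (x :+ y) := x :* x :- y :* y) refl x y ⟩
    x * x - y * y       ∎))

  inverse : ∀ {x} → 0# < x → ∃[ y ] 0# < y × x * y ≈ 1#
  inverse {x} 0<x with #⇒invertible (#-sym (<⇒# 0<x))
  ... | y , _ , [x-0]y≈1 = y , *-cancelˡ-< x 0<x (begin-strict
    x * 0#   ≈⟨ zeroʳ x ⟩
    0#       <⟨ 0<1 ⟩
    1#       ≈⟨ xy≈1 ⟨
    x * y    ∎) , xy≈1
    where
    xy≈1 : x * y ≈ 1#
    xy≈1 = trans (*-congʳ (sym (x-0≈x x))) [x-0]y≈1

  fromℕ-* : ∀ m n → fromℕ (m ℕ.* n) ≈ fromℕ m * fromℕ n
  fromℕ-* = ×1-homo-*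

  0≤fromℕ : ∀ n → 0# ≤ fromℕ n
  0≤fromℕ zero    = ≤-refl
  0≤fromℕ (suc n) = 0≤+ 0≤1 (0≤fromℕ n)

  fromℕ-mono-≤ : ∀ {m n} → m ℕ.≤ n → fromℕ m ≤ fromℕ n
  fromℕ-mono-≤ {n = n} z≤n = 0≤fromℕ n
  fromℕ-mono-≤ (s≤s m≤n)   = +-monoʳ-≤ 1# (fromℕ-mono-≤ m≤n)

  1/n*n≈1 : ∀ n .{{_ : NonZero n}} → 1/ n * fromℕ n ≈ 1#
  1/n*n≈1 n = trans (*-congˡ (sym (x-0≈x _))) (proj₁ (proj₂ (1/-inverse n)))

  n*1/n≈1 : ∀ n .{{_ : NonZero n}} → fromℕ n * 1/ n ≈ 1#
  n*1/n≈1 n = trans (*-comm _ _) (1/n*n≈1 n)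

  0<^ : ∀ {x} n → 0# < x → 0# < x ^ n
  0<^ zero    0<x = 0<1
  0<^ (suc n) 0<x = *-pos 0<x (0<^ n 0<x)

  0≤^ : ∀ {x} n → 0# ≤ x → 0# ≤ x ^ n
  0≤^ zero    0≤x = 0≤1
  0≤^ (suc n) 0≤x = 0≤* 0≤x (0≤^ n 0≤x)

  ^-monoˡ-≤ : ∀ {x y} n → 0# ≤ x → x ≤ y → x ^ n ≤ y ^ n
  ^-monoˡ-≤ zero    0≤x x≤y = ≤-refl
  ^-monoˡ-≤ (suc n) 0≤x x≤y = *-mono-≤ 0≤x (0≤^ n (≤-trans 0≤x x≤y)) x≤y (^-monoˡ-≤ n 0≤x x≤y)

  x^n≤1 : ∀ {x} n → 0# ≤ x → x ≤ 1# → x ^ n ≤ 1#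
  x^n≤1 zero    0≤x x≤1 = ≤-refl
  x^n≤1 {x} (suc n) 0≤x x≤1 = ≤-trans (*-mono-≤ 0≤x 0≤1 x≤1 (x^n≤1 n 0≤x x≤1)) (≤-reflexive (*-identityˡ 1#))

  fromℕ-^ : ∀ m n → fromℕ (m ℕ.^ n) ≈ fromℕ m ^ n
  fromℕ-^ m zero    = +-identityʳ 1#
  fromℕ-^ m (suc n) = trans (fromℕ-* m (m ℕ.^ n)) (*-congˡ (fromℕ-^ m n))

  1^n≈1 : ∀ n → 1# ^ n ≈ 1#
  1^n≈1 zero    = refl
  1^n≈1 (suc n) = trans (*-identityˡ _) (1^n≈1 n)

  open import Algebra.Properties.CommutativeSemiring.Exp commutativeSemiring public using (^-distrib-*)

  inverse-^ : ∀ {x y} n → x * y ≈ 1# → x ^ n * y ^ n ≈ 1#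
  inverse-^ {x} {y} n xy≈1 = trans (sym (^-distrib-* x y n)) (trans (^-congˡ n xy≈1) (1^n≈1 n))

  ½ : ℝ
  ½ = 1/ 2

  0<½ : 0# < ½
  0<½ = 1/-pos 2

  ½+½≈1 : ½ + ½ ≈ 1#
  ½+½≈1 = trans (solve 1 (λ h → h :+ h := h :* (con (+ 1) :+ (con (+ 1) :+ con (+ 0)))) refl ½) (1/n*n≈1 2)

  ½^n*[1+n]≤1 : ∀ n → ½ ^ n * fromℕ (suc n) ≤ 1#
  ½^n*[1+n]≤1 n = begin
    ½ ^ n * fromℕ (suc n)     ≤⟨ *-monoʳ-≤ (½ ^ n) (0≤^ n (<⇒≤ 0<½)) (fromℕ-mono-≤ (n<2^n n)) ⟩
    ½ ^ n * fromℕ (2 ℕ.^ n)   ≈⟨ *-congˡ (fromℕ-^ 2 n) ⟩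
    ½ ^ n * fromℕ 2 ^ n       ≈⟨ inverse-^ n (1/n*n≈1 2) ⟩
    1#                        ∎
    where open SmallNonDivisor using (n<2^n)

  -- M is chosen above A / ε. Then (n + 1) A ½^n ≤ A < (n + 1) ε for n ≥ M, the first step being n <
  -- 2^n.
  ½^n-small : ∀ A {ε} → 0# ≤ A → 0# < ε → ∃[ M ] (∀ n → M ℕ.≤ n → A * ½ ^ n < ε)
  ½^n-small A {ε} 0≤A 0<ε = let (i , 0<i , εi≈1) = inverse 0<ε; (M , Ai<M) = archimedean (A * i) in M , λ n M≤n → *-cancelˡ-< (fromℕ (suc n)) (fromℕ-pos (suc n)) (begin-strict
    fromℕ (suc n) * (A * ½ ^ n)   ≈⟨ solve 3 (λ f a p → f :* (a :* p) := a :* (p :* f)) refl (fromℕ (suc n)) A (½ ^ n) ⟩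
    A * (½ ^ n * fromℕ (suc n))   ≤⟨ *-monoʳ-≤ A 0≤A (½^n*[1+n]≤1 n) ⟩
    A * 1#                        ≈⟨ *-congˡ εi≈1 ⟨
    A * (ε * i)                   ≈⟨ solve 3 (λ a e i → a :* (e :* i) := a :* i :* e) refl A ε i ⟩
    A * i * ε                     <⟨ *-monoˡ-< ε 0<ε (<-≤-trans Ai<M (fromℕ-mono-≤ (ℕ.m≤n⇒m≤1+n M≤n))) ⟩
    fromℕ (suc n) * ε             ∎)


-- Complex numbers: modulus bounds, limits, finite sums, geometric series

module ComplexProperties (R : RealNumbers) where

  open Analysis R
  open RealProperties R
  open ≤-Reasoning
  module ℝ-Solver = IntegerRingSolver commutativeRing
  open ℝ-Solver using (_:=_; _:+_; _:*_; _:-_; :-_; con)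

  -‿cong₂ : ∀ {x y u v} → x ≈ᵣ y → u ≈ᵣ v → x -ᵣ u ≈ᵣ y -ᵣ v
  -‿cong₂ x≈y u≈v = +-cong x≈y (-‿cong u≈v)

  ℂ-commutativeRing : CommutativeRing 0ℓ 0ℓ
  ℂ-commutativeRing = record
    { RawRing ℂ-rawRing
    ; isCommutativeRing = record
      { isRing = record
        { +-isAbelianGroup = record
          { isGroup = record
            { isMonoid = record
              { isSemigroup = record
                { isMagma = record
                  { isEquivalence = record
                    { refl  = refl , refl
                    ; sym   = λ (p , q) → sym p , sym q
                    ; trans = λ (p , q) (p′ , q′) → trans p p′ , trans q q′
                    }
                  ; ∙-cong = λ (p , q) (p′ , q′) → +-cong p p′ , +-cong q q′
                  }
                ; assoc = λ (a +i b) (c +i d) (e +i f) → +-assoc a c e , +-assoc b d f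
                }
              ; identity = (λ (a +i b) → +-identityˡ a , +-identityˡ b) , (λ (a +i b) → +-identityʳ a , +-identityʳ b)
              }
            ; inverse = (λ (a +i b) → -‿inverseˡ a , -‿inverseˡ b) , (λ (a +i b) → -‿inverseʳ a , -‿inverseʳ b)
            ; ⁻¹-cong = λ (p , q) → -‿cong p , -‿cong q
            }
          ; comm = λ (a +i b) (c +i d) → +-comm a c , +-comm b d
          }
        ; *-cong = λ (p , q) (p′ , q′) → -‿cong₂ (*-cong p p′) (*-cong q q′) , +-cong (*-cong p q′) (*-cong q p′)
        ; *-assoc = λ (a +i b) (c +i d) (e +i f) →
            ℝ-Solver.solve 6 (λ a b c d e f → (a :* c :- b :* d) :* e :- (a :* d :+ b :* c) :* f := a :* (c :* e :- d :* f) :- b :* (c :* f :+ d :* e)) refl a b c d e f ,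
            ℝ-Solver.solve 6 (λ a b c d e f → (a :* c :- b :* d) :* f :+ (a :* d :+ b :* c) :* e := a :* (c :* f :+ d :* e) :+ b :* (c :* e :- d :* f)) refl a b c d e f
        ; *-identity = (λ (a +i b) →
              ℝ-Solver.solve 2 (λ a b → con (+ 1) :* a :- con (+ 0) :* b := a) refl a b ,
              ℝ-Solver.solve 2 (λ a b → con (+ 1) :* b :+ con (+ 0) :* a := b) refl a b)
            , (λ (a +i b) →
              ℝ-Solver.solve 2 (λ a b → a :* con (+ 1) :- b :* con (+ 0) := a) refl a b ,
              ℝ-Solver.solve 2 (λ a b → a :* con (+ 0) :+ b :* con (+ 1) := b) refl a b)
        ; distrib = (λ (a +i b) (c +i d) (e +i f) →
              ℝ-Solver.solve 6 (λ a b c d e f → a :* (c :+ e) :- b :* (d :+ f) := (a :* c :- b :* d) :+ (a :* e :- b :* f)) refl a b c d e f ,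
              ℝ-Solver.solve 6 (λ a b c d e f → a :* (d :+ f) :+ b :* (c :+ e) := (a :* d :+ b :* c) :+ (a :* f :+ b :* e)) refl a b c d e f)
            , (λ (a +i b) (c +i d) (e +i f) →
              ℝ-Solver.solve 6 (λ a b c d e f → (c :+ e) :* a :- (d :+ f) :* b := (c :* a :- d :* b) :+ (e :* a :- f :* b)) refl a b c d e f ,
              ℝ-Solver.solve 6 (λ a b c d e f → (c :+ e) :* b :+ (d :+ f) :* a := (c :* b :+ d :* a) :+ (e :* b :+ f :* a)) refl a b c d e f)
        }
      ; *-comm = λ (a +i b) (c +i d) →
          ℝ-Solver.solve 4 (λ a b c d → a :* c :- b :* d := c :* a :- d :* b) refl a b c d ,
          ℝ-Solver.solve 4 (λ a b c d → a :* d :+ b :* c := c :* b :+ d :* a) refl a b c d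
      }
    }

  module ℂ-Ring = CommutativeRing ℂ-commutativeRing
  module ℂ-Solver = IntegerRingSolver ℂ-commutativeRing
  open ℂ-Solver using () renaming (_:=_ to _⊜_; _:+_ to _⊕_; _:-_ to _⊖_)
  open import Algebra.Properties.Semiring.Exp ℂ-Ring.semiring public
    using () renaming (^-congˡ to ^ℂ-congˡ; ^-homo-* to ^ℂ-homo-*; ^-assocʳ to ^ℂ-assocʳ)
  open import Algebra.Properties.CommutativeSemiring.Exp ℂ-Ring.commutativeSemiring public
    using () renaming (^-distrib-* to ^ℂ-distrib-*)

  ∣∣²-cong : ∀ {z w} → z ≈ w → ∣ z ∣² ≈ᵣ ∣ w ∣²
  ∣∣²-cong (p , q) = +-cong (*-cong p p) (*-cong q q)

  ∣z*w∣²≈ : ∀ z w → ∣ z * w ∣² ≈ᵣ ∣ z ∣² *ᵣ ∣ w ∣²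
  ∣z*w∣²≈ (a +i b) (c +i d) = ℝ-Solver.solve 4 (λ a b c d →
    (a :* c :- b :* d) :* (a :* c :- b :* d) :+ (a :* d :+ b :* c) :* (a :* d :+ b :* c) :=
    (a :* a :+ b :* b) :* (c :* c :+ d :* d)) refl a b c d

  infix 4 ∣_∣≤_

  -- Comparing squares avoids square roots; 0 ≤ r is kept because r² forgets the sign. Being a
  -- record, the bound lets z and r be inferred from its type.
  record ∣_∣≤_ (z : ℂ) (r : ℝ) : Set where
    constructor _,_
    field
      0≤bound : 0ᵣ ≤ r
      ∣∣²≤    : ∣ z ∣² ≤ r *ᵣ r

  open ∣_∣≤_ public

  0≤∣∣² : ∀ z → 0ᵣ ≤ ∣ z ∣²
  0≤∣∣² (a +i b) = 0≤+ (0≤xx a) (0≤xx b)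

  ∣∣≤-cong : ∀ {z w r} → z ≈ w → ∣ z ∣≤ r → ∣ w ∣≤ r
  ∣∣≤-cong z≈w (0≤r , z²≤r²) = 0≤r , ≤-trans (≤-reflexive (∣∣²-cong (ℂ-Ring.sym z≈w))) z²≤r²

  ∣∣≤-weaken : ∀ {z r s} → r ≤ s → ∣ z ∣≤ r → ∣ z ∣≤ s
  ∣∣≤-weaken r≤s (0≤r , z²≤r²) = ≤-trans 0≤r r≤s , ≤-trans z²≤r² (*-mono-≤ 0≤r (≤-trans 0≤r r≤s) r≤s r≤s)

  ∣z*w∣≤ : ∀ {z w r s} → ∣ z ∣≤ r → ∣ w ∣≤ s → ∣ z * w ∣≤ r *ᵣ s
  ∣z*w∣≤ {z} {w} {r} {s} (0≤r , z²≤) (0≤s , w²≤) = 0≤* 0≤r 0≤s , (begin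
    ∣ z * w ∣²                 ≈⟨ ∣z*w∣²≈ z w ⟩
    ∣ z ∣² *ᵣ ∣ w ∣²           ≤⟨ *-mono-≤ (0≤∣∣² z) (0≤* 0≤s 0≤s) z²≤ w²≤ ⟩
    (r *ᵣ r) *ᵣ (s *ᵣ s)       ≈⟨ ℝ-Solver.solve 2 (λ r s → (r :* r) :* (s :* s) := (r :* s) :* (r :* s)) refl r s ⟩
    (r *ᵣ s) *ᵣ (r *ᵣ s)       ∎)

  -- The cross term is twice p, the real part of z times the conjugate of w, and p ≤ rs is
  -- Cauchy-Schwarz: p² + p′² = |z|² |w|² with the square p′² dropped.
  ∣z+w∣≤ : ∀ {z w r s} → ∣ z ∣≤ r → ∣ w ∣≤ s → ∣ z + w ∣≤ r +ᵣ s
  ∣z+w∣≤ {a +i b} {c +i d} {r} {s} (0≤r , z²≤) (0≤s , w²≤) = 0≤+ 0≤r 0≤s , (begin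
    (a +ᵣ c) *ᵣ (a +ᵣ c) +ᵣ (b +ᵣ d) *ᵣ (b +ᵣ d)
      ≈⟨ ℝ-Solver.solve 4 (λ a b c d → (a :+ c) :* (a :+ c) :+ (b :+ d) :* (b :+ d) :=
           ((a :* a :+ b :* b) :+ (c :* c :+ d :* d)) :+ ((a :* c :+ b :* d) :+ (a :* c :+ b :* d))) refl a b c d ⟩
    ((a *ᵣ a +ᵣ b *ᵣ b) +ᵣ (c *ᵣ c +ᵣ d *ᵣ d)) +ᵣ (p +ᵣ p)
      ≤⟨ +-mono-≤ (+-mono-≤ z²≤ w²≤) (+-mono-≤ p≤rs p≤rs) ⟩
    (r *ᵣ r +ᵣ s *ᵣ s) +ᵣ (r *ᵣ s +ᵣ r *ᵣ s)
      ≈⟨ ℝ-Solver.solve 2 (λ r s → (r :* r :+ s :* s) :+ (r :* s :+ r :* s) := (r :+ s) :* (r :+ s)) refl r s ⟩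
    (r +ᵣ s) *ᵣ (r +ᵣ s) ∎)
    where
    p = a *ᵣ c +ᵣ b *ᵣ d
    p′ = a *ᵣ d -ᵣ b *ᵣ c
    p≤rs : p ≤ r *ᵣ s
    p≤rs = xx≤yy⇒x≤y (0≤* 0≤r 0≤s) (begin
      p *ᵣ p                    ≤⟨ x≤x+y (0≤xx p′) ⟩
      p *ᵣ p +ᵣ p′ *ᵣ p′        ≈⟨ ℝ-Solver.solve 4 (λ a b c d →
        (a :* c :+ b :* d) :* (a :* c :+ b :* d) :+ (a :* d :- b :* c) :* (a :* d :- b :* c) :=
        (a :* a :+ b :* b) :* (c :* c :+ d :* d)) refl a b c d ⟩
      (a *ᵣ a +ᵣ b *ᵣ b) *ᵣ (c *ᵣ c +ᵣ d *ᵣ d)   ≤⟨ *-mono-≤ (0≤∣∣² (a +i b)) (0≤* 0≤s 0≤s) z²≤ w²≤ ⟩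
      (r *ᵣ r) *ᵣ (s *ᵣ s)      ≈⟨ ℝ-Solver.solve 2 (λ r s → (r :* r) :* (s :* s) := (r :* s) :* (r :* s)) refl r s ⟩
      (r *ᵣ s) *ᵣ (r *ᵣ s)      ∎)

  ∣-z∣≤ : ∀ {z r} → ∣ z ∣≤ r → ∣ - z ∣≤ r
  ∣-z∣≤ {a +i b} (0≤r , z²≤) = 0≤r , ≤-trans (≤-reflexive
    (ℝ-Solver.solve 2 (λ a b → (:- a) :* (:- a) :+ (:- b) :* (:- b) := a :* a :+ b :* b) refl a b)) z²≤

  ∣z-w∣≤ : ∀ {z w r s} → ∣ z ∣≤ r → ∣ w ∣≤ s → ∣ z - w ∣≤ r +ᵣ s
  ∣z-w∣≤ z≤ w≤ = ∣z+w∣≤ z≤ (∣-z∣≤ w≤)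

  ∣fromℝ∣≤ : ∀ {x} → 0ᵣ ≤ x → ∣ fromℝ x ∣≤ x
  ∣fromℝ∣≤ {x} 0≤x = 0≤x , ≤-reflexive (ℝ-Solver.solve 1 (λ x → x :* x :+ con (+ 0) :* con (+ 0) := x :* x) refl x)

  ∣1∣≤1 : ∣ 1# ∣≤ 1ᵣ
  ∣1∣≤1 = ∣fromℝ∣≤ 0≤1

  ∣0∣≤ : ∀ {r} → 0ᵣ ≤ r → ∣ 0# ∣≤ r
  ∣0∣≤ 0≤r = ∣∣≤-weaken 0≤r (∣fromℝ∣≤ ≤-refl)

  ∣z^n∣≤ : ∀ {z r} n → ∣ z ∣≤ r → ∣ z ^ n ∣≤ r ^ᵣ n
  ∣z^n∣≤ zero    z≤ = ∣1∣≤1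
  ∣z^n∣≤ (suc n) z≤ = ∣z*w∣≤ z≤ (∣z^n∣≤ n z≤)

  -- A majorant of |z| that needs no square root, as x ≤ (1 + x)² for x = |z|².
  bound : ℂ → ℝ
  bound z = 1ᵣ +ᵣ ∣ z ∣²

  0<bound : ∀ z → 0ᵣ < bound z
  0<bound z = 0<+ 0<1 (0≤∣∣² z)

  ∣z∣≤bound : ∀ z → ∣ z ∣≤ bound z
  ∣z∣≤bound z = <⇒≤ (0<bound z) , (begin
    x                                     ≤⟨ x≤x+y (0≤+ (0≤+ 0≤1 (0≤∣∣² z)) (0≤xx x)) ⟩
    x +ᵣ ((1ᵣ +ᵣ x) +ᵣ x *ᵣ x)            ≈⟨ ℝ-Solver.solve 1 (λ x → x :+ ((con (+ 1) :+ x) :+ x :* x) := (con (+ 1) :+ x) :* (con (+ 1) :+ x)) refl x ⟩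
    (1ᵣ +ᵣ x) *ᵣ (1ᵣ +ᵣ x)                ∎)
    where x = ∣ z ∣²

  Re≤ : ∀ {z r} → ∣ z ∣≤ r → Re z ≤ r
  Re≤ {a +i b} (0≤r , z²≤) = xx≤yy⇒x≤y 0≤r (≤-trans (x≤x+y (0≤xx b)) z²≤)

  Im≤ : ∀ {z r} → ∣ z ∣≤ r → Im z ≤ r
  Im≤ {a +i b} (0≤r , z²≤) = xx≤yy⇒x≤y 0≤r (≤-trans (≤-trans (x≤x+y (0≤xx a)) (≤-reflexive (+-comm _ _))) z²≤)

  ∀<⇒≤ : ∀ {x y} → (∀ ε → 0ᵣ < ε → x ≤ y +ᵣ ε) → x ≤ y
  ∀<⇒≤ {x} {y} x≤y+ε y<x = x≤y+ε (½ *ᵣ (x -ᵣ y)) (*-pos 0<½ (x<y⇒0<y-x y<x)) (0<y-x⇒x<y (begin-strict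
    0ᵣ                                <⟨ *-pos 0<½ (x<y⇒0<y-x y<x) ⟩
    ½ *ᵣ (x -ᵣ y)                     ≈⟨ ℝ-Solver.solve 3 (λ h x y → h :* (x :- y) := (h :+ h) :* (x :- y) :- h :* (x :- y)) refl ½ x y ⟩
    (½ +ᵣ ½) *ᵣ (x -ᵣ y) -ᵣ ½ *ᵣ (x -ᵣ y) ≈⟨ -‿cong₂ (*-congʳ ½+½≈1) refl ⟩
    1ᵣ *ᵣ (x -ᵣ y) -ᵣ ½ *ᵣ (x -ᵣ y)   ≈⟨ ℝ-Solver.solve 3 (λ e x y → con (+ 1) :* (x :- y) :- e := x :- (y :+ e)) refl (½ *ᵣ (x -ᵣ y)) x y ⟩
    x -ᵣ (y +ᵣ ½ *ᵣ (x -ᵣ y))         ∎))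

  ∣∣≤0⇒≈0 : ∀ {z} → (∀ ε → 0ᵣ < ε → ∣ z ∣≤ ε) → z ≈ 0#
  ∣∣≤0⇒≈0 {z} z≤ε = ≤-antisym (small Re≤) (-x≤0⇒0≤x (small (λ z≤ → Re≤ (∣-z∣≤ z≤))))
                , ≤-antisym (small Im≤) (-x≤0⇒0≤x (small (λ z≤ → Im≤ (∣-z∣≤ z≤))))
    where
    small : ∀ {x} → (∀ {r} → ∣ z ∣≤ r → x ≤ r) → x ≤ 0ᵣ
    small {x} x≤ = ∀<⇒≤ λ ε 0<ε → ≤-trans (x≤ (z≤ε ε 0<ε)) (≤-reflexive (sym (+-identityˡ ε)))
    -x≤0⇒0≤x : ∀ {x} → -ᵣ x ≤ 0ᵣ → 0ᵣ ≤ x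
    -x≤0⇒0≤x -x≤0 x<0 = -x≤0 (0<-x x<0)

  IsLimit : (ℕ → ℂ) → ℂ → Set
  IsLimit S s = ∀ ε → 0ᵣ < ε → ∃[ M ] (∀ n → M ℕ.≤ n → ∣ S n - s ∣≤ ε)

  hasSum⇒isLimit : ∀ {t s} → HasSum t s → IsLimit (Σ[_] t) s
  hasSum⇒isLimit sums ε 0<ε = let (M , within) = sums ε 0<ε in M , λ n M≤n → <⇒≤ 0<ε , <⇒≤ (within n M≤n)

  half-half : ∀ ε → ½ *ᵣ ε +ᵣ ½ *ᵣ ε ≈ᵣ ε
  half-half ε = trans (ℝ-Solver.solve 2 (λ h e → h :* e :+ h :* e := (h :+ h) :* e) refl ½ ε) (trans (*-congʳ ½+½≈1) (*-identityˡ ε))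

  ∣∣≤-closed : ∀ {z r} → 0ᵣ ≤ r → (∀ ε → 0ᵣ < ε → ∣ z ∣≤ r +ᵣ ε) → ∣ z ∣≤ r
  ∣∣≤-closed {z} {r} 0≤r near = 0≤r , ∀<⇒≤ within
    where
    within : ∀ η → 0ᵣ < η → ∣ z ∣² ≤ r *ᵣ r +ᵣ η
    -- The slack is e = η / k with k = 2r + 1 + η. Then e ≤ 1 + η, so (r + e)² - r² = e (2r + e) ≤ e
    -- k = η.
    within η 0<η = let (i , 0<i , ki≈1) = inverse 0<k in begin
      ∣ z ∣²                                             ≤⟨ ∣∣²≤ (near (η *ᵣ i) (*-pos 0<η 0<i)) ⟩
      (r +ᵣ η *ᵣ i) *ᵣ (r +ᵣ η *ᵣ i)                     ≈⟨ ℝ-Solver.solve 2 (λ r e → (r :+ e) :* (r :+ e) := r :* r :+ e :* ((r :+ r) :+ e)) refl r (η *ᵣ i) ⟩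
      r *ᵣ r +ᵣ η *ᵣ i *ᵣ ((r +ᵣ r) +ᵣ η *ᵣ i)           ≤⟨ +-monoʳ-≤ _ (*-monoʳ-≤ _ (<⇒≤ (*-pos 0<η 0<i)) (+-monoʳ-≤ _ (ηi≤ i 0<i ki≈1))) ⟩
      r *ᵣ r +ᵣ η *ᵣ i *ᵣ k                              ≈⟨ +-congˡ (ℝ-Solver.solve 3 (λ n i k → n :* i :* k := n :* (k :* i)) refl η i k) ⟩
      r *ᵣ r +ᵣ η *ᵣ (k *ᵣ i)                            ≈⟨ +-congˡ (trans (*-congˡ ki≈1) (*-identityʳ η)) ⟩
      r *ᵣ r +ᵣ η                                        ∎
      where
      k = (r +ᵣ r) +ᵣ (1ᵣ +ᵣ η)
      0<k : 0ᵣ < k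
      0<k = <-respʳ-≈ (+-comm _ _) (0<+ (0<+ 0<1 (<⇒≤ 0<η)) (0≤+ 0≤r 0≤r))
      ηi≤ : ∀ i → 0ᵣ < i → k *ᵣ i ≈ᵣ 1ᵣ → η *ᵣ i ≤ 1ᵣ +ᵣ η
      ηi≤ i 0<i ki≈1 = begin
        η *ᵣ i                                     ≤⟨ x≤x+y (0≤* (0≤+ (0≤+ 0≤r 0≤r) 0≤1) (<⇒≤ 0<i)) ⟩
        η *ᵣ i +ᵣ ((r +ᵣ r) +ᵣ 1ᵣ) *ᵣ i            ≈⟨ ℝ-Solver.solve 3 (λ n i r → n :* i :+ ((r :+ r) :+ con (+ 1)) :* i := ((r :+ r) :+ (con (+ 1) :+ n)) :* i) refl η i r ⟩
        k *ᵣ i                                     ≈⟨ ki≈1 ⟩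
        1ᵣ                                         ≤⟨ x≤x+y (<⇒≤ 0<η) ⟩
        1ᵣ +ᵣ η                                    ∎

  limit-bound : ∀ {S s c r} j → IsLimit S s → (∀ n → j ℕ.≤ n → ∣ S n - c ∣≤ r) → ∣ s - c ∣≤ r
  limit-bound {S} {s} {c} {r} j lim near = ∣∣≤-closed (0≤bound (near j ℕ.≤-refl)) λ ε 0<ε →
    let (M , within) = lim ε 0<ε; n = M ℕ.⊔ j in
    ∣∣≤-cong (ℂ-Solver.solve 3 (λ S s c → (S ⊖ c) ⊖ (S ⊖ s) ⊜ s ⊖ c) ℂ-Ring.refl (S n) s c)
      (∣z-w∣≤ (near n (ℕ.m≤n⊔m M j)) (within n (ℕ.m≤m⊔n M j)))

  limit-unique : ∀ {S s s′} → IsLimit S s → IsLimit S s′ → s ≈ s′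
  limit-unique {s = s} {s′} lim lim′ = ℂ-Ring.trans
    (ℂ-Solver.solve 2 (λ s s′ → s ⊜ (s ⊖ s′) ⊕ s′) ℂ-Ring.refl s s′)
    (ℂ-Ring.trans (ℂ-Ring.+-congʳ {x = s′} (∣∣≤0⇒≈0 λ ε 0<ε → let (M , within) = lim′ ε 0<ε in limit-bound M lim within))
                  (ℂ-Ring.+-identityˡ s′))

  limit-cong : ∀ {S S′ s s′} → (∀ n → S n ≈ S′ n) → s ≈ s′ → IsLimit S s → IsLimit S′ s′
  limit-cong S≈S′ s≈s′ lim ε 0<ε = let (M , within) = lim ε 0<ε in
    M , λ n M≤n → ∣∣≤-cong (ℂ-Ring.+-cong (S≈S′ n) (ℂ-Ring.-‿cong s≈s′)) (within n M≤n)

  Σ-cong : ∀ {t u} n → (∀ i → i ℕ.< n → t i ≈ u i) → Σ[ n ] t ≈ Σ[ n ] u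
  Σ-cong zero    t≈u = ℂ-Ring.refl
  Σ-cong (suc n) t≈u = ℂ-Ring.+-cong (t≈u 0 (s≤s z≤n)) (Σ-cong n λ i i<n → t≈u (suc i) (s≤s i<n))

  Σ-snoc : ∀ t n → Σ[ suc n ] t ≈ Σ[ n ] t + t n
  Σ-snoc t zero    = ℂ-Ring.+-comm (t 0) 0#
  Σ-snoc t (suc n) = ℂ-Ring.trans (ℂ-Ring.+-congˡ {t 0} (Σ-snoc (t ∘ suc) n))
    (ℂ-Ring.sym (ℂ-Ring.+-assoc (t 0) (Σ[ n ] (t ∘ suc)) (t (suc n))))

  Σ-split : ∀ t m n → Σ[ m ℕ.+ n ] t ≈ Σ[ m ] t + Σ[ n ] (λ i → t (m ℕ.+ i))
  Σ-split t zero    n = ℂ-Ring.sym (ℂ-Ring.+-identityˡ (Σ[ n ] t))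
  Σ-split t (suc m) n = ℂ-Ring.trans (ℂ-Ring.+-congˡ {t 0} (Σ-split (t ∘ suc) m n))
    (ℂ-Ring.sym (ℂ-Ring.+-assoc (t 0) (Σ[ m ] (t ∘ suc)) _))

  Σ-zero : ∀ {t} n → (∀ i → i ℕ.< n → t i ≈ 0#) → Σ[ n ] t ≈ 0#
  Σ-zero zero    t≈0 = ℂ-Ring.refl
  Σ-zero (suc n) t≈0 = ℂ-Ring.trans
    (ℂ-Ring.+-cong (t≈0 0 (s≤s z≤n)) (Σ-zero n λ i i<n → t≈0 (suc i) (s≤s i<n))) (ℂ-Ring.+-identityˡ 0#)

  Σ-+ : ∀ t u n → Σ[ n ] (λ i → t i + u i) ≈ Σ[ n ] t + Σ[ n ] u
  Σ-+ t u zero    = ℂ-Ring.sym (ℂ-Ring.+-identityˡ 0#)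
  Σ-+ t u (suc n) = ℂ-Ring.trans (ℂ-Ring.+-congˡ {t 0 + u 0} (Σ-+ (t ∘ suc) (u ∘ suc) n))
    (ℂ-Solver.solve 4 (λ a b c d → (a ⊕ b) ⊕ (c ⊕ d) ⊜ (a ⊕ c) ⊕ (b ⊕ d)) ℂ-Ring.refl (t 0) (u 0) _ _)

  Σ-*ˡ : ∀ c t n → Σ[ n ] (λ i → c * t i) ≈ c * Σ[ n ] t
  Σ-*ˡ c t zero    = ℂ-Ring.sym (ℂ-Ring.zeroʳ c)
  Σ-*ˡ c t (suc n) = ℂ-Ring.trans (ℂ-Ring.+-congˡ {c * t 0} (Σ-*ˡ c (t ∘ suc) n))
    (ℂ-Ring.sym (ℂ-Ring.distribˡ c (t 0) _))

  Σ-swap : ∀ (t : ℕ → ℕ → ℂ) m n → Σ[ m ] (λ i → Σ[ n ] (t i)) ≈ Σ[ n ] (λ j → Σ[ m ] (λ i → t i j))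
  Σ-swap t zero    n = ℂ-Ring.sym (Σ-zero n λ _ _ → ℂ-Ring.refl)
  Σ-swap t (suc m) n = ℂ-Ring.trans (ℂ-Ring.+-congˡ {Σ[ n ] (t 0)} (Σ-swap (t ∘ suc) m n))
    (ℂ-Ring.sym (Σ-+ (t 0) (λ j → Σ[ m ] (λ i → t (suc i) j)) n))

  -- Peeling off the first term replaces A by Aρ ≤ A / 2, so the bound 2A reproduces itself: A + 2Aρ
  -- ≤ 2A. The ratio is capped at 1/2 so that no factor 1 / (1 - ρ) appears.
  ∣Σ∣≤geometric : ∀ {ρ} → 0ᵣ ≤ ρ → ρ ≤ ½ → ∀ {A t} n → 0ᵣ ≤ A → (∀ i → ∣ t i ∣≤ A *ᵣ ρ ^ᵣ i) → ∣ Σ[ n ] t ∣≤ A +ᵣ A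
  ∣Σ∣≤geometric 0≤ρ ρ≤½ zero 0≤A t≤ = ∣0∣≤ (0≤+ 0≤A 0≤A)
  ∣Σ∣≤geometric {ρ} 0≤ρ ρ≤½ {A} (suc n) 0≤A t≤ = ∣z+w∣≤
    (∣∣≤-weaken (≤-reflexive (*-identityʳ A)) (t≤ 0))
    (∣∣≤-weaken 2Aρ≤A (∣Σ∣≤geometric 0≤ρ ρ≤½ n (0≤* 0≤A 0≤ρ) λ i →
      ∣∣≤-weaken (≤-reflexive (sym (*-assoc A ρ (ρ ^ᵣ i)))) (t≤ (suc i))))
    where
    2Aρ≤A : A *ᵣ ρ +ᵣ A *ᵣ ρ ≤ A
    2Aρ≤A = ≤-trans (+-mono-≤ (*-monoʳ-≤ A 0≤A ρ≤½) (*-monoʳ-≤ A 0≤A ρ≤½))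
                    (≤-reflexive (trans (sym (distribˡ A ½ ½)) (trans (*-congˡ ½+½≈1) (*-identityʳ A))))

  module GeometricSeries {ρ A : ℝ} {t : ℕ → ℂ} (0≤ρ : 0ᵣ ≤ ρ) (ρ≤½ : ρ ≤ ½) (0≤A : 0ᵣ ≤ A)
                         (t≤ : ∀ i → ∣ t i ∣≤ A *ᵣ ρ ^ᵣ i) where

    tail : ℕ → ℝ
    tail j = A *ᵣ ρ ^ᵣ j +ᵣ A *ᵣ ρ ^ᵣ j

    ∣Σn-Σj∣≤tail : ∀ j n → j ℕ.≤ n → ∣ Σ[ n ] t - Σ[ j ] t ∣≤ tail j
    ∣Σn-Σj∣≤tail j n j≤n = ≡.subst (λ m → ∣ Σ[ m ] t - Σ[ j ] t ∣≤ tail j) (ℕ.m+[n∸m]≡n j≤n)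
      (∣∣≤-cong (ℂ-Ring.sym difference)
        (∣Σ∣≤geometric 0≤ρ ρ≤½ d (0≤* 0≤A (0≤^ j 0≤ρ)) λ i →
          ∣∣≤-weaken (≤-reflexive (trans (*-congˡ (^-homo-* ρ j i)) (sym (*-assoc A _ _)))) (t≤ (j ℕ.+ i))))
      where
      d = n ℕ.∸ j
      difference : Σ[ j ℕ.+ d ] t - Σ[ j ] t ≈ Σ[ d ] (λ i → t (j ℕ.+ i))
      difference = ℂ-Ring.trans (ℂ-Ring.+-congʳ {x = - Σ[ j ] t} (Σ-split t j d))
        (ℂ-Solver.solve 2 (λ a b → (a ⊕ b) ⊖ a ⊜ b) ℂ-Ring.refl (Σ[ j ] t) _)

    sum-tail : ∀ {s} → IsLimit (Σ[_] t) s → ∀ j → ∣ s - Σ[ j ] t ∣≤ tail j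
    sum-tail lim j = limit-bound j lim (∣Σn-Σj∣≤tail j)

    tail-small : ∀ ε → 0ᵣ < ε → ∃[ M ] tail M < ε
    tail-small ε 0<ε = let (M , small) = ½^n-small (A +ᵣ A) (0≤+ 0≤A 0≤A) 0<ε in
      M , ≤-<-trans (≤-trans (≤-reflexive (sym (distribʳ _ A A)))
        (*-monoʳ-≤ _ (0≤+ 0≤A 0≤A) (^-monoˡ-≤ M 0≤ρ ρ≤½))) (small M ℕ.≤-refl)

    near : ∀ M m n → M ℕ.≤ m → M ℕ.≤ n → ∣ Σ[ m ] t - Σ[ n ] t ∣≤ tail M +ᵣ tail M
    near M m n M≤m M≤n = ∣∣≤-cong
      (ℂ-Solver.solve 3 (λ x y z → (x ⊖ z) ⊖ (y ⊖ z) ⊜ x ⊖ y) ℂ-Ring.refl (Σ[ m ] t) (Σ[ n ] t) (Σ[ M ] t))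
      (∣z-w∣≤ (∣Σn-Σj∣≤tail M m M≤m) (∣Σn-Σj∣≤tail M n M≤n))

    -- Modulus bounds are weak inequalities while completeness asks for strict ones; the
    -- intermediate r < ε bridges the two.
    cauchy : ∀ ε → 0ᵣ < ε → ∃[ M ] (∀ m n → M ℕ.≤ m → M ℕ.≤ n → ∃[ r ] r < ε × ∣ Σ[ m ] t - Σ[ n ] t ∣≤ r)
    cauchy ε 0<ε = let (M , small) = tail-small (½ *ᵣ ε) (*-pos 0<½ 0<ε) in
      M , λ m n M≤m M≤n → tail M +ᵣ tail M ,
        <-≤-trans (+-mono-<-≤ small (<⇒≤ small)) (≤-reflexive (half-half ε)) , near M m n M≤m M≤n

    -- Completeness concerns real sequences, so it is applied to Re and Im, through the properties
    -- of ψ that they share.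
    module Component (ψ : ℂ → ℝ) (ψ≤ : ∀ {z r} → ∣ z ∣≤ r → ψ z ≤ r) (ψ-− : ∀ z w → ψ (z - w) ≈ᵣ ψ z -ᵣ ψ w) where

      component : ∃[ l ] (∀ ε → 0ᵣ < ε → ∃[ M ] (∀ n → M ℕ.≤ n → ∣ ψ (Σ[ n ] t) - l ∣< ε))
      component = complete (λ n → ψ (Σ[ n ] t)) λ ε 0<ε → let (M , close) = cauchy ε 0<ε in
        M , λ m n M≤m M≤n → below close m n M≤m M≤n , below close n m M≤n M≤m
        where
        below : ∀ {ε M} → (∀ m n → M ℕ.≤ m → M ℕ.≤ n → ∃[ r ] r < ε × ∣ Σ[ m ] t - Σ[ n ] t ∣≤ r) →
                ∀ m n → M ℕ.≤ m → M ℕ.≤ n → ψ (Σ[ m ] t) -ᵣ ψ (Σ[ n ] t) < ε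
        below close m n M≤m M≤n = let (r , r<ε , close′) = close m n M≤m M≤n in
          ≤-<-trans (≤-trans (≤-reflexive (sym (ψ-− _ _))) (ψ≤ close′)) r<ε

    module ReComponent = Component Re Re≤ (λ _ _ → refl)
    module ImComponent = Component Im Im≤ (λ _ _ → refl)

    ∣x∣<⇒xx≤ : ∀ {x e} → x < e → -ᵣ x < e → x *ᵣ x ≤ e *ᵣ e
    ∣x∣<⇒xx≤ {x} {e} x<e -x<e = 0≤y-x⇒x≤y (≤-trans (<⇒≤ (*-pos (x<y⇒0<y-x x<e) (x<y⇒0<y-x -x<e)))
      (≤-reflexive (ℝ-Solver.solve 2 (λ x e → (e :- x) :* (e :- :- x) := e :* e :- x :* x) refl x e)))

    converges : ∃[ s ] IsLimit (Σ[_] t) s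
    converges = let (x , x-lim) = ReComponent.component; (y , y-lim) = ImComponent.component in
      (x +i y) , λ ε 0<ε →
        let 0<e = *-pos 0<½ 0<ε
            (M , x-close) = x-lim (½ *ᵣ ε) 0<e; (M′ , y-close) = y-lim (½ *ᵣ ε) 0<e in
        M ℕ.⊔ M′ , λ n M≤n →
          let (x< , <x) = x-close n (ℕ.≤-trans (ℕ.m≤m⊔n M M′) M≤n)
              (y< , <y) = y-close n (ℕ.≤-trans (ℕ.m≤n⊔m M M′) M≤n)
          in combine 0<ε x< <x y< <y
      where
      combine : ∀ {ε u v x y} → 0ᵣ < ε → u -ᵣ x < ½ *ᵣ ε → x -ᵣ u < ½ *ᵣ ε →
                v -ᵣ y < ½ *ᵣ ε → y -ᵣ v < ½ *ᵣ ε → ∣ (u +i v) - (x +i y) ∣≤ ε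
      combine {ε} {u} {v} {x} {y} 0<ε x< <x y< <y = <⇒≤ 0<ε , (begin
        (u -ᵣ x) *ᵣ (u -ᵣ x) +ᵣ (v -ᵣ y) *ᵣ (v -ᵣ y)
          ≤⟨ +-mono-≤ (∣x∣<⇒xx≤ x< (<-respˡ-≈ (swap u x) <x)) (∣x∣<⇒xx≤ y< (<-respˡ-≈ (swap v y) <y)) ⟩
        ½ *ᵣ ε *ᵣ (½ *ᵣ ε) +ᵣ ½ *ᵣ ε *ᵣ (½ *ᵣ ε)
          ≤⟨ x≤x+y (0≤+ 0≤e² 0≤e²) ⟩
        (½ *ᵣ ε *ᵣ (½ *ᵣ ε) +ᵣ ½ *ᵣ ε *ᵣ (½ *ᵣ ε)) +ᵣ (½ *ᵣ ε *ᵣ (½ *ᵣ ε) +ᵣ ½ *ᵣ ε *ᵣ (½ *ᵣ ε))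
          ≈⟨ ℝ-Solver.solve 1 (λ e → (e :* e :+ e :* e) :+ (e :* e :+ e :* e) := (e :+ e) :* (e :+ e)) refl (½ *ᵣ ε) ⟩
        (½ *ᵣ ε +ᵣ ½ *ᵣ ε) *ᵣ (½ *ᵣ ε +ᵣ ½ *ᵣ ε)
          ≈⟨ *-cong (half-half ε) (half-half ε) ⟩
        ε *ᵣ ε ∎)
        where
        0≤e² = 0≤xx (½ *ᵣ ε)
        swap : ∀ a b → b -ᵣ a ≈ᵣ -ᵣ (a -ᵣ b)
        swap = ℝ-Solver.solve 2 (λ a b → b :- a := :- (a :- b)) refl

-- The exponential function and logarithmic estimates

-- For n ≥ m the factors of n! beyond m! are all at least m. The use is |z|^n / n! ≤ m^m (|z| /
-- m)^n, a geometric majorant whose ratio can be made small.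
m^n≤m^m*n! : ∀ m n → m ℕ.^ n ℕ.≤ m ℕ.^ m ℕ.* n !
m^n≤m^m*n! zero    zero    = ℕ.≤-refl
m^n≤m^m*n! zero    (suc n) = z≤n
m^n≤m^m*n! m@(suc _) n = [ below , above ]′ (ℕ.≤-total n m)
  where
  below : n ℕ.≤ m → m ℕ.^ n ℕ.≤ m ℕ.^ m ℕ.* n !
  below n≤m = ℕ.≤-trans (ℕ.^-monoʳ-≤ m n≤m) (ℕ.m≤m*n (m ℕ.^ m) (n !) {{n ℕ.!≢0}})
  m^k≤[m+k]! : ∀ k → m ℕ.^ k ℕ.≤ (k ℕ.+ m) !
  m^k≤[m+k]! zero    = ℕ.1≤n! m
  m^k≤[m+k]! (suc k) = ℕ.*-mono-≤ (ℕ.m≤n⇒m≤1+n (ℕ.m≤n+m m k)) (m^k≤[m+k]! k)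
  above : m ℕ.≤ n → m ℕ.^ n ℕ.≤ m ℕ.^ m ℕ.* n !
  above m≤n = ≡.subst (λ n → m ℕ.^ n ℕ.≤ m ℕ.^ m ℕ.* n !) (ℕ.m∸n+n≡m m≤n) (begin
    m ℕ.^ (k ℕ.+ m)                 ≡⟨ ℕ.^-distribˡ-+-* m k m ⟩
    m ℕ.^ k ℕ.* m ℕ.^ m             ≡⟨ ℕ.*-comm (m ℕ.^ k) (m ℕ.^ m) ⟩
    m ℕ.^ m ℕ.* m ℕ.^ k             ≤⟨ ℕ.*-monoʳ-≤ (m ℕ.^ m) (m^k≤[m+k]! k) ⟩
    m ℕ.^ m ℕ.* (k ℕ.+ m) !         ∎)
    where
    open ℕ.≤-Reasoning
    k = n ℕ.∸ m

module Exponential (R : RealNumbers) where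

  open Analysis R
  open RealProperties R
  open ComplexProperties R
  open ≤-Reasoning
  open ℝ-Solver using (_:=_; _:+_; _:*_; _:-_; :-_; con)
  open ℂ-Solver using () renaming (_:=_ to _⊜_; _:+_ to _⊕_; _:*_ to _⊗_; _:-_ to _⊖_; :-_ to ⊖′_; con to conℂ)

  1/-unique : ∀ n .{{_ : NonZero n}} {x} → x *ᵣ fromℕ n ≈ᵣ 1ᵣ → x ≈ᵣ 1/ n
  1/-unique n {x} xn≈1 = trans (sym (*-identityʳ x)) (trans (*-congˡ (sym (n*1/n≈1 n)))
    (trans (sym (*-assoc x _ _)) (trans (*-congʳ xn≈1) (*-identityˡ (1/ n)))))

  1/1≈1 : 1/ 1 ≈ᵣ 1ᵣ
  1/1≈1 = sym (1/-unique 1 (trans (*-identityˡ _) (+-identityʳ 1ᵣ)))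

  1/n≤1 : ∀ n .{{_ : NonZero n}} → 1/ n ≤ 1ᵣ
  1/n≤1 n@(suc m) = begin
    1/ n              ≈⟨ *-identityʳ (1/ n) ⟨
    1/ n *ᵣ 1ᵣ        ≤⟨ *-monoʳ-≤ (1/ n) (<⇒≤ (1/-pos n)) (x≤x+y (0≤fromℕ m)) ⟩
    1/ n *ᵣ fromℕ n   ≈⟨ 1/n*n≈1 n ⟩
    1ᵣ                ∎

  ¼ : ℝ
  ¼ = ½ *ᵣ ½

  0≤¼ : 0ᵣ ≤ ¼
  0≤¼ = 0≤xx ½

  ½≤1 : ½ ≤ 1ᵣ
  ½≤1 = 1/n≤1 2

  ¼≤½ : ¼ ≤ ½
  ¼≤½ = ≤-trans (*-monoʳ-≤ ½ (<⇒≤ 0<½) ½≤1) (≤-reflexive (*-identityʳ ½))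

  1/!_ : ℕ → ℝ
  1/! n = 1/_ (n !) {{n ℕ.!≢0}}

  0≤1/! : ∀ n → 0ᵣ ≤ 1/! n
  0≤1/! n = <⇒≤ (1/-pos (n !) {{n ℕ.!≢0}})

  1/![1+n] : ∀ n → fromℕ (suc n) *ᵣ 1/! (suc n) ≈ᵣ 1/! n
  1/![1+n] n = 1/-unique (n !) {{n ℕ.!≢0}} (trans
    (ℝ-Solver.solve 3 (λ a b c → a :* b :* c := b :* (a :* c)) refl (fromℕ (suc n)) (1/! (suc n)) (fromℕ (n !)))
    (trans (*-congˡ (sym (fromℕ-* (suc n) (n !)))) (1/n*n≈1 (suc n !) {{suc n ℕ.!≢0}})))

  expTerm : ℂ → ℕ → ℂ
  expTerm z n = fromℝ (1/! n) * z ^ n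

  expTerm-0 : ∀ z → expTerm z 0 ≈ 1#
  expTerm-0 z = ℂ-Ring.trans (ℂ-Ring.*-identityʳ (fromℝ (1/! 0))) (1/1≈1 , refl)

  fromℂ : ℕ → ℂ
  fromℂ n = fromℝ (fromℕ n)

  fromℝ-* : ∀ x y → fromℝ (x *ᵣ y) ≈ fromℝ x * fromℝ y
  fromℝ-* x y = ℝ-Solver.solve 2 (λ x y → x :* y := x :* y :- con (+ 0) :* con (+ 0)) refl x y ,
                ℝ-Solver.solve 2 (λ x y → con (+ 0) := x :* con (+ 0) :+ con (+ 0) :* y) refl x y

  fromℝ-+ : ∀ x y → fromℝ (x +ᵣ y) ≈ fromℝ x + fromℝ y
  fromℝ-+ x y = refl , sym (+-identityˡ 0ᵣ)

  fromℝ-cong : ∀ {x y} → x ≈ᵣ y → fromℝ x ≈ fromℝ y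
  fromℝ-cong x≈y = x≈y , refl

  fromℝ-^ : ∀ x n → fromℝ (x ^ᵣ n) ≈ fromℝ x ^ n
  fromℝ-^ x zero    = ℂ-Ring.refl
  fromℝ-^ x (suc n) = ℂ-Ring.trans (fromℝ-* x (x ^ᵣ n)) (ℂ-Ring.*-congˡ {fromℝ x} (fromℝ-^ x n))

  1^ℂ≈1 : ∀ n → 1# ^ n ≈ 1#
  1^ℂ≈1 n = ℂ-Ring.trans (ℂ-Ring.sym (fromℝ-^ 1ᵣ n)) (fromℝ-cong (1^n≈1 n))

  expTerm-suc : ∀ z n → fromℂ (suc n) * expTerm z (suc n) ≈ z * expTerm z n
  expTerm-suc z n = ℂ-Ring.trans
    (ℂ-Solver.solve 4 (λ a b z p → a ⊗ (b ⊗ (z ⊗ p)) ⊜ (a ⊗ b) ⊗ (z ⊗ p)) ℂ-Ring.refl (fromℂ (suc n)) (fromℝ (1/! (suc n))) z (z ^ n))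
    (ℂ-Ring.trans
      (ℂ-Ring.*-congʳ {z * z ^ n} (ℂ-Ring.trans (ℂ-Ring.sym (fromℝ-* (fromℕ (suc n)) (1/! (suc n)))) (fromℝ-cong (1/![1+n] n))))
      (ℂ-Solver.solve 3 (λ a z p → a ⊗ (z ⊗ p) ⊜ z ⊗ (a ⊗ p)) ℂ-Ring.refl (fromℝ (1/! n)) z (z ^ n)))

  -- Taking m at least four times a bound for |z| makes the ratio of the majorant 1/4. Ratio 1/4
  -- rather than 1/2 leaves room for the factor n that the Cauchy product costs in `exp-+`.
  ∣expTerm∣≤ : ∀ z → ∃[ A ] 0ᵣ ≤ A × (∀ n → ∣ expTerm z n ∣≤ A *ᵣ ¼ ^ᵣ n)
  ∣expTerm∣≤ z = let (m , 4a<m) = archimedean 4a in fromℕ (m ℕ.^ m) , 0≤fromℕ (m ℕ.^ m) , bounded m (<⇒≤ 4a<m)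
    where
    a = bound z
    0≤a : 0ᵣ ≤ a
    0≤a = <⇒≤ (0<bound z)
    4a = (a +ᵣ a) +ᵣ (a +ᵣ a)
    a≤m/4 : ∀ {m} → 4a ≤ m → a ≤ ¼ *ᵣ m
    a≤m/4 {m} 4a≤m = begin
      a                                 ≈⟨ trans (*-identityˡ (1ᵣ *ᵣ a)) (*-identityˡ a) ⟨
      1ᵣ *ᵣ (1ᵣ *ᵣ a)                   ≈⟨ *-cong ½+½≈1 (*-congʳ ½+½≈1) ⟨
      (½ +ᵣ ½) *ᵣ ((½ +ᵣ ½) *ᵣ a)       ≈⟨ ℝ-Solver.solve 2 (λ h a → (h :+ h) :* ((h :+ h) :* a) := (h :* h) :* ((a :+ a) :+ (a :+ a))) refl ½ a ⟩
      ¼ *ᵣ 4a                           ≤⟨ *-monoʳ-≤ ¼ 0≤¼ 4a≤m ⟩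
      ¼ *ᵣ m                            ∎
    bounded : ∀ m → 4a ≤ fromℕ m → ∀ n → ∣ expTerm z n ∣≤ fromℕ (m ℕ.^ m) *ᵣ ¼ ^ᵣ n
    bounded m 4a≤m n = ∣∣≤-weaken (begin
      1/! n *ᵣ a ^ᵣ n                               ≤⟨ *-monoʳ-≤ (1/! n) (0≤1/! n) (^-monoˡ-≤ n 0≤a (a≤m/4 4a≤m)) ⟩
      1/! n *ᵣ (¼ *ᵣ fromℕ m) ^ᵣ n                  ≈⟨ *-congˡ (trans (^-distrib-* ¼ (fromℕ m) n) (*-congˡ (sym (fromℕ-^ m n)))) ⟩
      1/! n *ᵣ (¼ ^ᵣ n *ᵣ fromℕ (m ℕ.^ n))          ≤⟨ *-monoʳ-≤ (1/! n) (0≤1/! n) (*-monoʳ-≤ (¼ ^ᵣ n) (0≤^ n 0≤¼) (fromℕ-mono-≤ (m^n≤m^m*n! m n))) ⟩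
      1/! n *ᵣ (¼ ^ᵣ n *ᵣ fromℕ (m ℕ.^ m ℕ.* n !))  ≈⟨ *-congˡ (*-congˡ (fromℕ-* (m ℕ.^ m) (n !))) ⟩
      1/! n *ᵣ (¼ ^ᵣ n *ᵣ (fromℕ (m ℕ.^ m) *ᵣ fromℕ (n !)))
        ≈⟨ ℝ-Solver.solve 4 (λ i q m f → i :* (q :* (m :* f)) := (i :* f) :* (m :* q)) refl (1/! n) (¼ ^ᵣ n) (fromℕ (m ℕ.^ m)) (fromℕ (n !)) ⟩
      (1/! n *ᵣ fromℕ (n !)) *ᵣ (fromℕ (m ℕ.^ m) *ᵣ ¼ ^ᵣ n)
        ≈⟨ trans (*-congʳ (1/n*n≈1 (n !) {{n ℕ.!≢0}})) (*-identityˡ _) ⟩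
      fromℕ (m ℕ.^ m) *ᵣ ¼ ^ᵣ n                     ∎)
      (∣z*w∣≤ (∣fromℝ∣≤ (0≤1/! n)) (∣z^n∣≤ n (∣z∣≤bound z)))

  abstract
    -- Abstract, so that `exp z` does not unfold into a Cauchy limit: it is known only through
    -- `exp-limit`.
    exp-limit′ : ∀ z → ∃[ w ] IsLimit (Σ[_] (expTerm z)) w
    exp-limit′ z = let (A , 0≤A , bounded) = ∣expTerm∣≤ z in GeometricSeries.converges 0≤¼ ¼≤½ 0≤A bounded

    exp : ℂ → ℂ
    exp z = proj₁ (exp-limit′ z)

    exp-limit : ∀ z → IsLimit (Σ[_] (expTerm z)) (exp z)
    exp-limit z = proj₂ (exp-limit′ z)

  isExp⇒≈exp : ∀ {z w} → IsExp z w → w ≈ exp z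
  isExp⇒≈exp {z} w-exp = limit-unique (hasSum⇒isLimit {expTerm z} w-exp) (exp-limit z)

  exp-cong : ∀ {z w} → z ≈ w → exp z ≈ exp w
  exp-cong {z} {w} z≈w = limit-unique
    (limit-cong (λ n → Σ-cong {expTerm z} {expTerm w} n λ i _ → ℂ-Ring.*-congˡ {fromℝ (1/! i)} (^ℂ-congˡ i z≈w)) ℂ-Ring.refl (exp-limit z))
    (exp-limit w)

  -- Σ_{i + j + 1 = n} f i * g j
  conv : (ℕ → ℂ) → (ℕ → ℂ) → ℕ → ℂ
  conv f g zero    = 0#
  conv f g (suc n) = f 0 * g n + conv (f ∘ suc) g n

  conv-cong : ∀ {f f′ g g′} n → (∀ i → f i ≈ f′ i) → (∀ j → g j ≈ g′ j) → conv f g n ≈ conv f′ g′ n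
  conv-cong zero    f≈f′ g≈g′ = ℂ-Ring.refl
  conv-cong (suc n) f≈f′ g≈g′ = ℂ-Ring.+-cong (ℂ-Ring.*-cong (f≈f′ 0) (g≈g′ n)) (conv-cong n (f≈f′ ∘ suc) g≈g′)

  conv-+ˡ : ∀ f f′ g n → conv (λ i → f i + f′ i) g n ≈ conv f g n + conv f′ g n
  conv-+ˡ f f′ g zero    = ℂ-Ring.sym (ℂ-Ring.+-identityˡ 0#)
  conv-+ˡ f f′ g (suc n) = ℂ-Ring.trans (ℂ-Ring.+-congˡ {(f 0 + f′ 0) * g n} (conv-+ˡ (f ∘ suc) (f′ ∘ suc) g n))
    (ℂ-Solver.solve 5 (λ a b c d e → (a ⊕ b) ⊗ c ⊕ (d ⊕ e) ⊜ (a ⊗ c ⊕ d) ⊕ (b ⊗ c ⊕ e)) ℂ-Ring.refl (f 0) (f′ 0) (g n) _ _)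

  conv-+ʳ : ∀ f g g′ n → conv f (λ j → g j + g′ j) n ≈ conv f g n + conv f g′ n
  conv-+ʳ f g g′ zero    = ℂ-Ring.sym (ℂ-Ring.+-identityˡ 0#)
  conv-+ʳ f g g′ (suc n) = ℂ-Ring.trans (ℂ-Ring.+-congˡ {f 0 * (g n + g′ n)} (conv-+ʳ (f ∘ suc) g g′ n))
    (ℂ-Solver.solve 5 (λ a b c d e → c ⊗ (a ⊕ b) ⊕ (d ⊕ e) ⊜ (c ⊗ a ⊕ d) ⊕ (c ⊗ b ⊕ e)) ℂ-Ring.refl (g n) (g′ n) (f 0) _ _)

  conv-*ˡ : ∀ c f g n → conv (λ i → c * f i) g n ≈ c * conv f g n
  conv-*ˡ c f g zero    = ℂ-Ring.sym (ℂ-Ring.zeroʳ c)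
  conv-*ˡ c f g (suc n) = ℂ-Ring.trans (ℂ-Ring.+-congˡ {(c * f 0) * g n} (conv-*ˡ c (f ∘ suc) g n))
    (ℂ-Solver.solve 4 (λ c a b d → (c ⊗ a) ⊗ b ⊕ c ⊗ d ⊜ c ⊗ (a ⊗ b ⊕ d)) ℂ-Ring.refl c (f 0) (g n) _)

  conv-*ʳ : ∀ c f g n → conv f (λ j → c * g j) n ≈ c * conv f g n
  conv-*ʳ c f g zero    = ℂ-Ring.sym (ℂ-Ring.zeroʳ c)
  conv-*ʳ c f g (suc n) = ℂ-Ring.trans (ℂ-Ring.+-congˡ {f 0 * (c * g n)} (conv-*ʳ c (f ∘ suc) g n))
    (ℂ-Solver.solve 4 (λ c a b d → a ⊗ (c ⊗ b) ⊕ c ⊗ d ⊜ c ⊗ (a ⊗ b ⊕ d)) ℂ-Ring.refl c (f 0) (g n) _)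

  conv-const : ∀ f c n → conv f (λ _ → c) n ≈ Σ[ n ] f * c
  conv-const f c zero    = ℂ-Ring.sym (ℂ-Ring.zeroˡ c)
  conv-const f c (suc n) = ℂ-Ring.trans (ℂ-Ring.+-congˡ {f 0 * c} (conv-const (f ∘ suc) c n))
    (ℂ-Ring.sym (ℂ-Ring.distribʳ c (f 0) _))

  conv-shiftʳ : ∀ f {g} n → g 0 ≈ 0# → conv f g (suc n) ≈ conv f (g ∘ suc) n
  conv-shiftʳ f {g} zero    g0≈0 = ℂ-Ring.trans (ℂ-Ring.+-identityʳ (f 0 * g 0))
    (ℂ-Ring.trans (ℂ-Ring.*-congˡ {f 0} g0≈0) (ℂ-Ring.zeroʳ (f 0)))
  conv-shiftʳ f {g} (suc n) g0≈0 = ℂ-Ring.+-congˡ {f 0 * g (suc n)} (conv-shiftʳ (f ∘ suc) n g0≈0)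

  -- The triangle i + j < n is summed along its diagonals on the left, and for fixed i on the right.
  Σ-conv : ∀ f g n → Σ[ n ] (λ k → conv f g (suc k)) ≈ conv f (λ j → Σ[ suc j ] g) n
  Σ-conv f g zero    = ℂ-Ring.refl
  Σ-conv f g (suc n) = ℂ-Ring.trans (Σ-snoc (λ k → conv f g (suc k)) n) (ℂ-Ring.trans
    (ℂ-Ring.+-congʳ {conv f g (suc n)} (ℂ-Ring.trans (Σ-conv f g n) (ℂ-Ring.sym (conv-shiftʳ f n ℂ-Ring.refl))))
    (ℂ-Ring.trans (ℂ-Ring.sym (conv-+ʳ f (Σ[_] g) g (suc n)))
      (conv-cong {f} (suc n) (λ _ → ℂ-Ring.refl) (λ j → ℂ-Ring.sym (Σ-snoc g j)))))

  weighted : (ℕ → ℂ) → ℕ → ℂ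
  weighted f i = fromℂ i * f i

  fromℂ-suc : ∀ n → fromℂ (suc n) ≈ 1# + fromℂ n
  fromℂ-suc n = fromℝ-+ 1ᵣ (fromℕ n)

  weighted-0 : ∀ f → weighted f 0 ≈ 0#
  weighted-0 f = ℂ-Ring.zeroˡ (f 0)

  -- Multiplying the n-th coefficient by n is the derivation q d/dq of power series. This is its
  -- Leibniz rule in degree n, shifted as `conv` is.
  conv-weighted : ∀ f g n →
    fromℂ n * conv f g (suc n) ≈ conv (weighted f) g (suc n) + conv f (weighted g) (suc n)
  conv-weighted f g zero = ℂ-Solver.solve 2 (λ a b →
    conℂ (+ 0) ⊗ (a ⊗ b ⊕ conℂ (+ 0)) ⊜ (conℂ (+ 0) ⊗ a ⊗ b ⊕ conℂ (+ 0)) ⊕ (a ⊗ (conℂ (+ 0) ⊗ b) ⊕ conℂ (+ 0))) ℂ-Ring.refl (f 0) (g 0)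
  conv-weighted f g (suc n) = ℂ-Ring.trans
    (ℂ-Solver.solve 4 (λ ν a b c → ν ⊗ (a ⊗ b ⊕ c) ⊜ ν ⊗ (a ⊗ b) ⊕ ν ⊗ c) ℂ-Ring.refl (fromℂ (suc n)) (f 0) (g (suc n)) C)
    (ℂ-Ring.trans (ℂ-Ring.+-congˡ {fromℂ (suc n) * (f 0 * g (suc n))}
      (ℂ-Ring.trans (ℂ-Ring.*-congʳ {C} (fromℂ-suc n))
      (ℂ-Ring.trans (ℂ-Ring.distribʳ C 1# (fromℂ n))
        (ℂ-Ring.+-cong (ℂ-Ring.*-identityˡ C) (conv-weighted (f ∘ suc) g n)))))
    (ℂ-Ring.trans
      (ℂ-Solver.solve 6 (λ ν a b c d e → ν ⊗ (a ⊗ b) ⊕ (c ⊕ (d ⊕ e)) ⊜ (conℂ (+ 0) ⊗ a ⊗ b ⊕ (c ⊕ d)) ⊕ (a ⊗ (ν ⊗ b) ⊕ e))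
        ℂ-Ring.refl (fromℂ (suc n)) (f 0) (g (suc n)) C (conv (weighted (f ∘ suc)) g (suc n)) (conv (f ∘ suc) (weighted g) (suc n)))
      (ℂ-Ring.+-congʳ {conv f (weighted g) (suc (suc n))} (ℂ-Ring.+-congˡ {weighted f 0 * g (suc n)} (ℂ-Ring.sym shifted)))))
    where
    C = conv (f ∘ suc) g (suc n)
    shifted : conv (weighted f ∘ suc) g (suc n) ≈ C + conv (weighted (f ∘ suc)) g (suc n)
    shifted = ℂ-Ring.trans
      (conv-cong (suc n) (λ i → ℂ-Ring.trans (ℂ-Ring.*-congʳ {f (suc i)} (fromℂ-suc i))
        (ℂ-Solver.solve 2 (λ ν a → (conℂ (+ 1) ⊕ ν) ⊗ a ⊜ a ⊕ ν ⊗ a) ℂ-Ring.refl (fromℂ i) (f (suc i)))) (λ _ → ℂ-Ring.refl))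
      (conv-+ˡ (f ∘ suc) (weighted (f ∘ suc)) g (suc n))

  fromℂ-cancelˡ : ∀ n .{{_ : NonZero n}} {z w} → fromℂ n * z ≈ fromℂ n * w → z ≈ w
  fromℂ-cancelˡ n {z} {w} nz≈nw = ℂ-Ring.trans (ℂ-Ring.sym (undo z))
    (ℂ-Ring.trans (ℂ-Ring.*-congˡ {fromℝ (1/ n)} nz≈nw) (undo w))
    where
    undo : ∀ z → fromℝ (1/ n) * (fromℂ n * z) ≈ z
    undo z = ℂ-Ring.trans (ℂ-Ring.sym (ℂ-Ring.*-assoc (fromℝ (1/ n)) (fromℂ n) z)) (ℂ-Ring.trans
      (ℂ-Ring.*-congʳ {z} (ℂ-Ring.trans (ℂ-Ring.sym (fromℝ-* (1/ n) (fromℕ n))) (fromℝ-cong (1/n*n≈1 n))))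
      (ℂ-Ring.*-identityˡ z))

  -- In place of the binomial theorem: by the Leibniz rule and `expTerm-suc`, both sides satisfy n
  -- c(n) = (z + w) c(n - 1), with c(0) = 1.
  conv-expTerm : ∀ z w n → conv (expTerm z) (expTerm w) (suc n) ≈ expTerm (z + w) n
  conv-expTerm z w zero = ℂ-Ring.trans (ℂ-Ring.+-identityʳ (expTerm z 0 * expTerm w 0))
    (ℂ-Ring.trans (ℂ-Ring.*-cong (expTerm-0 z) (expTerm-0 w))
    (ℂ-Ring.trans (ℂ-Ring.*-identityˡ 1#) (ℂ-Ring.sym (expTerm-0 (z + w)))))
  conv-expTerm z w (suc n) = fromℂ-cancelˡ (suc n) (ℂ-Ring.trans (conv-weighted (expTerm z) (expTerm w) (suc n))
    (ℂ-Ring.trans (ℂ-Ring.+-cong left right)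
    (ℂ-Ring.trans (ℂ-Ring.sym (ℂ-Ring.distribʳ C z w))
    (ℂ-Ring.trans (ℂ-Ring.*-congˡ {z + w} (conv-expTerm z w n)) (ℂ-Ring.sym (expTerm-suc (z + w) n))))))
    where
    C = conv (expTerm z) (expTerm w) (suc n)
    left : conv (weighted (expTerm z)) (expTerm w) (suc (suc n)) ≈ z * C
    left = ℂ-Ring.trans (ℂ-Ring.+-cong
        (ℂ-Ring.trans (ℂ-Ring.*-congʳ {expTerm w (suc n)} (weighted-0 (expTerm z))) (ℂ-Ring.zeroˡ (expTerm w (suc n))))
        (ℂ-Ring.trans (conv-cong {g = expTerm w} (suc n) (expTerm-suc z) (λ _ → ℂ-Ring.refl)) (conv-*ˡ z (expTerm z) (expTerm w) (suc n))))
      (ℂ-Ring.+-identityˡ (z * C))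
    right : conv (expTerm z) (weighted (expTerm w)) (suc (suc n)) ≈ w * C
    right = ℂ-Ring.trans (conv-shiftʳ (expTerm z) (suc n) (weighted-0 (expTerm w)))
      (ℂ-Ring.trans (conv-cong {expTerm z} (suc n) (λ _ → ℂ-Ring.refl) (expTerm-suc w)) (conv-*ʳ w (expTerm z) (expTerm w) (suc n)))

  -- Each of the n products is at most A B ρ^n, since i + (j + 1) = n.
  ∣conv∣≤ : ∀ {ρ A B f g} n → 0ᵣ ≤ ρ → 0ᵣ ≤ A → 0ᵣ ≤ B → (∀ i → ∣ f i ∣≤ A *ᵣ ρ ^ᵣ i) → (∀ j → ∣ g j ∣≤ B *ᵣ ρ ^ᵣ suc j) →
            ∣ conv f g n ∣≤ fromℕ n *ᵣ (A *ᵣ B *ᵣ ρ ^ᵣ n)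
  ∣conv∣≤ zero 0≤ρ 0≤A 0≤B f≤ g≤ = ∣0∣≤ (≤-reflexive (sym (RealNumbers.zeroˡ R _)))
  ∣conv∣≤ {ρ} {A} {B} (suc n) 0≤ρ 0≤A 0≤B f≤ g≤ = ∣∣≤-weaken (≤-reflexive
    (ℝ-Solver.solve 5 (λ a b r p ν → a :* con (+ 1) :* (b :* (r :* p)) :+ ν :* (a :* r :* b :* p) := (con (+ 1) :+ ν) :* (a :* b :* (r :* p)))
      refl A B ρ (ρ ^ᵣ n) (fromℕ n)))
    (∣z+w∣≤ (∣z*w∣≤ (f≤ 0) (g≤ n)) (∣conv∣≤ n 0≤ρ (0≤* 0≤A 0≤ρ) 0≤B
      (λ i → ∣∣≤-weaken (≤-reflexive (sym (*-assoc A ρ (ρ ^ᵣ i)))) (f≤ (suc i))) g≤))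

  ½^n-bound⇒limit : ∀ {S s K} → 0ᵣ ≤ K → (∀ n → ∣ S n - s ∣≤ K *ᵣ ½ ^ᵣ n) → IsLimit S s
  ½^n-bound⇒limit {K = K} 0≤K near ε 0<ε = let (M , small) = ½^n-small K 0≤K 0<ε in
    M , λ n M≤n → ∣∣≤-weaken (<⇒≤ (small n M≤n)) (near n)

  ¼^n≈ : ∀ n → ¼ ^ᵣ n ≈ᵣ ½ ^ᵣ n *ᵣ ½ ^ᵣ n
  ¼^n≈ n = ^-distrib-* ½ ½ n

  ¼^n≤½^n : ∀ n → ¼ ^ᵣ n ≤ ½ ^ᵣ n
  ¼^n≤½^n n = ^-monoˡ-≤ n 0≤¼ ¼≤½

  n*¼^n≤½^n : ∀ n → fromℕ n *ᵣ ¼ ^ᵣ n ≤ ½ ^ᵣ n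
  n*¼^n≤½^n n = begin
    fromℕ n *ᵣ ¼ ^ᵣ n                    ≤⟨ *-monoˡ-≤ _ (0≤^ n 0≤¼) (fromℕ-mono-≤ (ℕ.n≤1+n n)) ⟩
    fromℕ (suc n) *ᵣ ¼ ^ᵣ n              ≈⟨ *-congˡ (¼^n≈ n) ⟩
    fromℕ (suc n) *ᵣ (h *ᵣ h)            ≈⟨ ℝ-Solver.solve 2 (λ ν h → ν :* (h :* h) := h :* (h :* ν)) refl (fromℕ (suc n)) h ⟩
    h *ᵣ (h *ᵣ fromℕ (suc n))            ≤⟨ *-monoʳ-≤ h (0≤^ n (<⇒≤ 0<½)) (½^n*[1+n]≤1 n) ⟩
    h *ᵣ 1ᵣ                              ≈⟨ *-identityʳ h ⟩
    h                                    ∎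
    where h = ½ ^ᵣ n

  -- The n-th partial sum for z + w differs from e^w times the one for z by the convolution of the
  -- terms for z with the tails for w. These are n products of size O(¼^n), and n ¼^n ≤ ½^n.
  exp-+ : ∀ z w → exp (z + w) ≈ exp z * exp w
  exp-+ z w = let (A , 0≤A , z≤) = ∣expTerm∣≤ z; (B , 0≤B , w≤) = ∣expTerm∣≤ w in
    limit-unique (exp-limit (z + w)) (½^n-bound⇒limit (0≤K 0≤A 0≤B) (near 0≤A 0≤B z≤ w≤))
    where
    W = bound (exp w)
    0≤W : 0ᵣ ≤ W
    0≤W = <⇒≤ (0<bound (exp w))
    K : ℝ → ℝ → ℝ
    K A B = (A +ᵣ A) *ᵣ W +ᵣ A *ᵣ (B +ᵣ B)
    0≤K : ∀ {A B} → 0ᵣ ≤ A → 0ᵣ ≤ B → 0ᵣ ≤ K A B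
    0≤K 0≤A 0≤B = 0≤+ (0≤* (0≤+ 0≤A 0≤A) 0≤W) (0≤* 0≤A (0≤+ 0≤B 0≤B))
    near : ∀ {A B} → 0ᵣ ≤ A → 0ᵣ ≤ B → (∀ n → ∣ expTerm z n ∣≤ A *ᵣ ¼ ^ᵣ n) → (∀ n → ∣ expTerm w n ∣≤ B *ᵣ ¼ ^ᵣ n) →
           ∀ n → ∣ Σ[ n ] (expTerm (z + w)) - exp z * exp w ∣≤ K A B *ᵣ ½ ^ᵣ n
    near {A} {B} 0≤A 0≤B z≤ w≤ n = ∣∣≤-cong split (∣∣≤-weaken bounds
      (∣-z∣≤ (∣z+w∣≤ (∣z*w∣≤ (GeometricSeries.sum-tail 0≤¼ ¼≤½ 0≤A z≤ (exp-limit z) n) (∣z∣≤bound (exp w)))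
                     (∣conv∣≤ n 0≤¼ 0≤A (0≤+ 0≤B 0≤B) z≤ λ j → ∣∣≤-weaken (≤-reflexive (sym (distribʳ _ B B)))
                       (GeometricSeries.sum-tail 0≤¼ ¼≤½ 0≤B w≤ (exp-limit w) (suc j))))))
      where
      h = ½ ^ᵣ n
      bounds : (A *ᵣ ¼ ^ᵣ n +ᵣ A *ᵣ ¼ ^ᵣ n) *ᵣ W +ᵣ fromℕ n *ᵣ (A *ᵣ (B +ᵣ B) *ᵣ ¼ ^ᵣ n) ≤ K A B *ᵣ h
      bounds = begin
        (A *ᵣ ¼ ^ᵣ n +ᵣ A *ᵣ ¼ ^ᵣ n) *ᵣ W +ᵣ fromℕ n *ᵣ (A *ᵣ (B +ᵣ B) *ᵣ ¼ ^ᵣ n)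
          ≈⟨ ℝ-Solver.solve 5 (λ a b q w ν → (a :* q :+ a :* q) :* w :+ ν :* (a :* (b :+ b) :* q) :=
               (a :+ a) :* w :* q :+ a :* (b :+ b) :* (ν :* q)) refl A B (¼ ^ᵣ n) W (fromℕ n) ⟩
        (A +ᵣ A) *ᵣ W *ᵣ ¼ ^ᵣ n +ᵣ A *ᵣ (B +ᵣ B) *ᵣ (fromℕ n *ᵣ ¼ ^ᵣ n)
          ≤⟨ +-mono-≤ (*-monoʳ-≤ _ (0≤* (0≤+ 0≤A 0≤A) 0≤W) (¼^n≤½^n n)) (*-monoʳ-≤ _ (0≤* 0≤A (0≤+ 0≤B 0≤B)) (n*¼^n≤½^n n)) ⟩
        (A +ᵣ A) *ᵣ W *ᵣ h +ᵣ A *ᵣ (B +ᵣ B) *ᵣ h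
          ≈⟨ distribʳ h _ _ ⟨
        K A B *ᵣ h ∎
      Sz = Σ[ n ] (expTerm z)
      remainder : conv (expTerm z) (λ j → exp w - Σ[ suc j ] (expTerm w)) n + Σ[ n ] (expTerm (z + w)) ≈ Sz * exp w
      remainder = ℂ-Ring.trans (ℂ-Ring.+-congˡ {conv (expTerm z) (λ j → exp w - Σ[ suc j ] (expTerm w)) n}
          (ℂ-Ring.trans (Σ-cong n λ k _ → ℂ-Ring.sym (conv-expTerm z w k)) (Σ-conv (expTerm z) (expTerm w) n)))
        (ℂ-Ring.trans (ℂ-Ring.sym (conv-+ʳ (expTerm z) _ (λ j → Σ[ suc j ] (expTerm w)) n))
        (ℂ-Ring.trans (conv-cong n (λ _ → ℂ-Ring.refl) (λ j →
            ℂ-Solver.solve 2 (λ a b → (a ⊖ b) ⊕ b ⊜ a) ℂ-Ring.refl (exp w) (Σ[ suc j ] (expTerm w))))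
          (conv-const (expTerm z) (exp w) n)))
      split : - ((exp z - Sz) * exp w + conv (expTerm z) (λ j → exp w - Σ[ suc j ] (expTerm w)) n) ≈ Σ[ n ] (expTerm (z + w)) - exp z * exp w
      split = ℂ-Ring.trans
        (ℂ-Solver.solve 5 (λ z s w c t → ⊖′ ((z ⊖ s) ⊗ w ⊕ c) ⊜ (t ⊖ z ⊗ w) ⊕ (s ⊗ w ⊖ (c ⊕ t))) ℂ-Ring.refl (exp z) Sz (exp w) c T′)
        (ℂ-Ring.trans (ℂ-Ring.+-congˡ {T′ - exp z * exp w} (ℂ-Ring.trans
            (ℂ-Ring.+-congˡ {Sz * exp w} (ℂ-Ring.-‿cong remainder)) (ℂ-Ring.-‿inverseʳ (Sz * exp w))))
          (ℂ-Ring.+-identityʳ (T′ - exp z * exp w)))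
        where
        c = conv (expTerm z) (λ j → exp w - Σ[ suc j ] (expTerm w)) n
        T′ = Σ[ n ] (expTerm (z + w))

  ∣∣≤0⇒≡0 : ∀ {z} → ∣ z ∣≤ 0ᵣ → z ≈ 0#
  ∣∣≤0⇒≡0 z≤0 = ∣∣≤0⇒≈0 λ ε 0<ε → ∣∣≤-weaken (<⇒≤ 0<ε) z≤0

  -≈0⇒≈ : ∀ {z w} → z - w ≈ 0# → z ≈ w
  -≈0⇒≈ {z} {w} z-w≈0 = ℂ-Ring.trans (ℂ-Solver.solve 2 (λ z w → z ⊜ (z ⊖ w) ⊕ w) ℂ-Ring.refl z w)
    (ℂ-Ring.trans (ℂ-Ring.+-congʳ {w} z-w≈0) (ℂ-Ring.+-identityˡ w))

  exp-0 : exp 0# ≈ 1#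
  exp-0 = -≈0⇒≈ (∣∣≤0⇒≡0 (limit-bound 1 (exp-limit 0#) partial))
    where
    partial : ∀ n → 1 ℕ.≤ n → ∣ Σ[ n ] (expTerm 0#) - 1# ∣≤ 0ᵣ
    partial (suc n) _ = ∣∣≤-cong (ℂ-Ring.sym (ℂ-Ring.trans
      (ℂ-Ring.+-congʳ { - 1#} (ℂ-Ring.trans (ℂ-Ring.+-cong (expTerm-0 0#) (Σ-zero {expTerm 0# ∘ suc} n λ i _ →
          ℂ-Ring.trans (ℂ-Ring.*-congˡ {fromℝ (1/! (suc i))} (ℂ-Ring.zeroˡ (0# ^ i))) (ℂ-Ring.zeroʳ (fromℝ (1/! (suc i))))))
        (ℂ-Ring.+-identityʳ 1#)))
      (ℂ-Ring.-‿inverseʳ 1#))) (∣0∣≤ ≤-refl)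

  exp-·ℕ : ∀ n z → exp (fromℂ n * z) ≈ exp z ^ n
  exp-·ℕ zero    z = ℂ-Ring.trans (exp-cong (ℂ-Ring.zeroˡ z)) exp-0
  exp-·ℕ (suc n) z = ℂ-Ring.trans (exp-cong (ℂ-Ring.trans (ℂ-Ring.*-congʳ {z} (fromℂ-suc n))
      (ℂ-Solver.solve 2 (λ ν z → (conℂ (+ 1) ⊕ ν) ⊗ z ⊜ z ⊕ ν ⊗ z) ℂ-Ring.refl (fromℂ n) z)))
    (ℂ-Ring.trans (exp-+ z (fromℂ n * z)) (ℂ-Ring.*-congˡ {exp z} (exp-·ℕ n z)))

  conj : ℂ → ℂ
  conj (x +i y) = x +i (-ᵣ y)

  conj-+ : ∀ z w → conj (z + w) ≈ conj z + conj w
  conj-+ (a +i b) (c +i d) = refl , ℝ-Solver.solve 2 (λ b d → :- (b :+ d) := :- b :+ :- d) refl b d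

  conj-* : ∀ z w → conj (z * w) ≈ conj z * conj w
  conj-* (a +i b) (c +i d) =
    ℝ-Solver.solve 4 (λ a b c d → a :* c :- b :* d := a :* c :- (:- b) :* (:- d)) refl a b c d ,
    ℝ-Solver.solve 4 (λ a b c d → :- (a :* d :+ b :* c) := a :* (:- d) :+ (:- b) :* c) refl a b c d

  conj-fromℝ : ∀ x → conj (fromℝ x) ≈ fromℝ x
  conj-fromℝ x = refl , ℝ-Solver.solve 0 (:- con (+ 0) := con (+ 0)) refl

  conj-^ : ∀ z n → conj (z ^ n) ≈ conj z ^ n
  conj-^ z zero    = conj-fromℝ 1ᵣ
  conj-^ z (suc n) = ℂ-Ring.trans (conj-* z (z ^ n)) (ℂ-Ring.*-congˡ {conj z} (conj-^ z n))

  conj-Σ : ∀ t n → conj (Σ[ n ] t) ≈ Σ[ n ] (conj ∘ t)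
  conj-Σ t zero    = conj-fromℝ 0ᵣ
  conj-Σ t (suc n) = ℂ-Ring.trans (conj-+ (t 0) _) (ℂ-Ring.+-congˡ {conj (t 0)} (conj-Σ (t ∘ suc) n))

  ∣conj∣≤ : ∀ {z r} → ∣ z ∣≤ r → ∣ conj z ∣≤ r
  ∣conj∣≤ {a +i b} (0≤r , z²≤) = 0≤r , ≤-trans (≤-reflexive
    (ℝ-Solver.solve 2 (λ a b → a :* a :+ (:- b) :* (:- b) := a :* a :+ b :* b) refl a b)) z²≤

  conj-limit : ∀ {S s} → IsLimit S s → IsLimit (conj ∘ S) (conj s)
  conj-limit {S} {s} lim ε 0<ε = let (M , near) = lim ε 0<ε in
    M , λ n M≤n → ∣∣≤-cong (conj-+ (S n) (- s)) (∣conj∣≤ (near n M≤n))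

  exp-conj : ∀ z → exp (conj z) ≈ conj (exp z)
  exp-conj z = limit-unique (exp-limit (conj z)) (limit-cong (λ n →
    ℂ-Ring.trans (conj-Σ (expTerm z) n) (Σ-cong {conj ∘ expTerm z} {expTerm (conj z)} n λ i _ →
      ℂ-Ring.trans (conj-* (fromℝ (1/! i)) (z ^ i)) (ℂ-Ring.*-cong (conj-fromℝ (1/! i)) (conj-^ z i))))
    ℂ-Ring.refl (conj-limit (exp-limit z)))

  x≈-x⇒x≈0 : ∀ {x} → x ≈ᵣ -ᵣ x → x ≈ᵣ 0ᵣ
  x≈-x⇒x≈0 {x} x≈-x = trans (sym (half-half x))
    (trans (+-congʳ (*-congˡ x≈-x)) (ℝ-Solver.solve 2 (λ h x → h :* (:- x) :+ h :* x := con (+ 0)) refl ½ x))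

  expᵣ : ℝ → ℝ
  expᵣ x = Re (exp (fromℝ x))

  -- A real argument equals its conjugate, so its exponential does too.
  exp-fromℝ : ∀ x → exp (fromℝ x) ≈ fromℝ (expᵣ x)
  exp-fromℝ x = refl , x≈-x⇒x≈0 (proj₂ (ℂ-Ring.trans (exp-cong (ℂ-Ring.sym (conj-fromℝ x))) (exp-conj (fromℝ x))))

  expᵣ-cong : ∀ {x y} → x ≈ᵣ y → expᵣ x ≈ᵣ expᵣ y
  expᵣ-cong x≈y = proj₁ (exp-cong (fromℝ-cong x≈y))

  expᵣ-+ : ∀ x y → expᵣ (x +ᵣ y) ≈ᵣ expᵣ x *ᵣ expᵣ y
  expᵣ-+ x y = proj₁ (ℂ-Ring.trans (exp-cong (fromℝ-+ x y)) (ℂ-Ring.trans (exp-+ (fromℝ x) (fromℝ y))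
    (ℂ-Ring.trans (ℂ-Ring.*-cong (exp-fromℝ x) (exp-fromℝ y)) (ℂ-Ring.sym (fromℝ-* (expᵣ x) (expᵣ y))))))

  expᵣ-0 : expᵣ 0ᵣ ≈ᵣ 1ᵣ
  expᵣ-0 = proj₁ exp-0

  expᵣ-·ℕ : ∀ n x → expᵣ (fromℕ n *ᵣ x) ≈ᵣ expᵣ x ^ᵣ n
  expᵣ-·ℕ zero    x = trans (expᵣ-cong (RealNumbers.zeroˡ R x)) expᵣ-0
  expᵣ-·ℕ (suc n) x = trans (expᵣ-cong (ℝ-Solver.solve 2 (λ ν x → (con (+ 1) :+ ν) :* x := x :+ ν :* x) refl (fromℕ n) x))
    (trans (expᵣ-+ x (fromℕ n *ᵣ x)) (*-congˡ (expᵣ-·ℕ n x)))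

  expᵣ-inverse : ∀ x → expᵣ x *ᵣ expᵣ (-ᵣ x) ≈ᵣ 1ᵣ
  expᵣ-inverse x = trans (sym (expᵣ-+ x (-ᵣ x))) (trans (expᵣ-cong (-‿inverseʳ x)) expᵣ-0)

  -- As the square of e^(x/2) it is nonnegative, and being invertible it is apart from 0.
  0<expᵣ : ∀ x → 0ᵣ < expᵣ x
  0<expᵣ x = 0≤∧#0⇒0< (≤-trans (0≤xx (expᵣ (½ *ᵣ x)))
    (≤-reflexive (trans (sym (expᵣ-+ (½ *ᵣ x) (½ *ᵣ x))) (expᵣ-cong (half-half x)))))
    (xy#0⇒x#0 (#-sym (<⇒# (<-respʳ-≈ (sym (expᵣ-inverse x)) 0<1))))

  limit-Re≥ : ∀ {S s b} j → IsLimit S s → (∀ n → j ℕ.≤ n → b ≤ Re (S n)) → b ≤ Re s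
  limit-Re≥ {S} {s} {b} j lim b≤S = ∀<⇒≤ λ ε 0<ε → let (M , near) = lim ε 0<ε; n = M ℕ.⊔ j in begin
    b                          ≤⟨ b≤S n (ℕ.m≤n⊔m M j) ⟩
    Re (S n)                   ≈⟨ ℝ-Solver.solve 2 (λ a b → a := b :+ (a :- b)) refl (Re (S n)) (Re s) ⟩
    Re s +ᵣ (Re (S n) -ᵣ Re s) ≤⟨ +-monoʳ-≤ (Re s) (Re≤ (near n (ℕ.m≤m⊔n M j))) ⟩
    Re s +ᵣ ε                  ∎

  0≤ReΣ : ∀ {t} n → (∀ i → 0ᵣ ≤ Re (t i)) → 0ᵣ ≤ Re (Σ[ n ] t)
  0≤ReΣ zero    0≤t = ≤-refl
  0≤ReΣ {t} (suc n) 0≤t = 0≤+ (0≤t 0) (0≤ReΣ {t ∘ suc} n (0≤t ∘ suc))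

  expTerm-fromℝ : ∀ x n → expTerm (fromℝ x) n ≈ fromℝ (1/! n *ᵣ x ^ᵣ n)
  expTerm-fromℝ x n = ℂ-Ring.sym (ℂ-Ring.trans (fromℝ-* (1/! n) (x ^ᵣ n)) (ℂ-Ring.*-congˡ {fromℝ (1/! n)} (fromℝ-^ x n)))

  1+x≤expᵣ : ∀ {x} → 0ᵣ ≤ x → 1ᵣ +ᵣ x ≤ expᵣ x
  1+x≤expᵣ {x} 0≤x = limit-Re≥ 2 (exp-limit (fromℝ x)) partial
    where
    t = expTerm (fromℝ x)
    0≤t : ∀ i → 0ᵣ ≤ Re (t i)
    0≤t i = ≤-trans (0≤* (0≤1/! i) (0≤^ i 0≤x)) (≤-reflexive (sym (proj₁ (expTerm-fromℝ x i))))
    partial : ∀ n → 2 ℕ.≤ n → 1ᵣ +ᵣ x ≤ Re (Σ[ n ] t)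
    partial (suc zero) (s≤s ())
    partial (suc (suc n)) _ = +-mono-≤ (≤-reflexive (sym (proj₁ (expTerm-0 (fromℝ x)))))
      (≤-trans (≤-reflexive (sym (trans (proj₁ (expTerm-fromℝ x 1)) (trans (*-cong 1/1≈1 (*-identityʳ x)) (*-identityˡ x)))))
        (x≤x+y (0≤ReΣ {t ∘ suc ∘ suc} n (0≤t ∘ suc ∘ suc))))

  -- If y < x, then e^x = e^(x-y) e^y > e^y, because e^d ≥ 1 + d for d ≥ 0.
  expᵣ-cancel-≤ : ∀ {x y} → expᵣ x ≤ expᵣ y → x ≤ y
  expᵣ-cancel-≤ {x} {y} ex≤ey y<x = ex≤ey (begin-strict
    expᵣ y                          ≈⟨ *-identityʳ (expᵣ y) ⟨
    expᵣ y *ᵣ 1ᵣ                    ≈⟨ *-comm (expᵣ y) 1ᵣ ⟩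
    1ᵣ *ᵣ expᵣ y                    <⟨ *-monoˡ-< (expᵣ y) (0<expᵣ y) (<-≤-trans 1<1+d (1+x≤expᵣ (<⇒≤ 0<d))) ⟩
    expᵣ (x -ᵣ y) *ᵣ expᵣ y         ≈⟨ expᵣ-+ (x -ᵣ y) y ⟨
    expᵣ ((x -ᵣ y) +ᵣ y)            ≈⟨ expᵣ-cong (ℝ-Solver.solve 2 (λ x y → (x :- y) :+ y := x) refl x y) ⟩
    expᵣ x                          ∎)
    where
    0<d = x<y⇒0<y-x y<x
    1<1+d : 1ᵣ < 1ᵣ +ᵣ (x -ᵣ y)
    1<1+d = 0<y-x⇒x<y (<-respʳ-≈ (ℝ-Solver.solve 1 (λ d → d := (con (+ 1) :+ d) :- con (+ 1)) refl (x -ᵣ y)) 0<d)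

  -- Without the factorials the series becomes the geometric one with sum 2, and `sum-tail` at 0 is
  -- that bound. In effect log 2 ≥ 1/2, the constant that converts binary into natural logarithms.
  expᵣ-½≤2 : expᵣ ½ ≤ fromℕ 2
  expᵣ-½≤2 = begin
    expᵣ ½                ≈⟨ ℝ-Solver.solve 1 (λ x → x := x :- con (+ 0)) refl (expᵣ ½) ⟩
    expᵣ ½ -ᵣ 0ᵣ          ≤⟨ Re≤ (GeometricSeries.sum-tail (<⇒≤ 0<½) ≤-refl 0≤1 term≤ (exp-limit (fromℝ ½)) 0) ⟩
    1ᵣ *ᵣ 1ᵣ +ᵣ 1ᵣ *ᵣ 1ᵣ  ≈⟨ ℝ-Solver.solve 0 (con (+ 1) :* con (+ 1) :+ con (+ 1) :* con (+ 1) := con (+ 1) :+ (con (+ 1) :+ con (+ 0))) refl ⟩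
    fromℕ 2               ∎
    where
    term≤ : ∀ i → ∣ expTerm (fromℝ ½) i ∣≤ 1ᵣ *ᵣ ½ ^ᵣ i
    term≤ i = ∣∣≤-cong (ℂ-Ring.sym (expTerm-fromℝ ½ i)) (∣∣≤-weaken
      (*-monoˡ-≤ (½ ^ᵣ i) (0≤^ i (<⇒≤ 0<½)) (1/n≤1 (i !) {{i ℕ.!≢0}}))
      (∣fromℝ∣≤ (0≤* (0≤1/! i) (0≤^ i (<⇒≤ 0<½)))))

  isLog⇒expᵣ≈ : ∀ {x l} → IsLog x l → expᵣ l ≈ᵣ x
  isLog⇒expᵣ≈ log = proj₁ (ℂ-Ring.sym (isExp⇒≈exp log))

  m/2≤log : ∀ {N l} m → IsLog (fromℕ N) l → 2 ℕ.^ m ℕ.≤ N → fromℕ m *ᵣ ½ ≤ l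
  m/2≤log {N} {l} m log 2^m≤N = expᵣ-cancel-≤ (begin
    expᵣ (fromℕ m *ᵣ ½)   ≈⟨ expᵣ-·ℕ m ½ ⟩
    expᵣ ½ ^ᵣ m           ≤⟨ ^-monoˡ-≤ m (<⇒≤ (0<expᵣ ½)) expᵣ-½≤2 ⟩
    fromℕ 2 ^ᵣ m          ≈⟨ fromℕ-^ 2 m ⟨
    fromℕ (2 ℕ.^ m)       ≤⟨ fromℕ-mono-≤ 2^m≤N ⟩
    fromℕ N               ≈⟨ isLog⇒expᵣ≈ log ⟨
    expᵣ l                ∎)

  0≤log : ∀ {x l} → IsLog x l → 1ᵣ ≤ x → 0ᵣ ≤ l
  0≤log log 1≤x = expᵣ-cancel-≤ (≤-trans (≤-reflexive expᵣ-0) (≤-trans 1≤x (≤-reflexive (sym (isLog⇒expᵣ≈ log)))))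

  0<realPower : ∀ {x r y} → IsRealPower x r y → 0ᵣ < y
  0<realPower {r = r} (l , _ , y-exp) = <-respʳ-≈ (isLog⇒expᵣ≈ y-exp) (0<expᵣ (r *ᵣ l))

-- Power series and asymptotic expansions along a geometric sequence

module Expansions (R : RealNumbers) where

  open Analysis R
  open RealProperties R
  open ComplexProperties R
  open Exponential R
  open ≤-Reasoning
  open import Data.Nat.DivMod using (_%_; _/_; m*n%n≡0; m*n/n≡m; m<n⇒m%n≡m; [m+n]%n≡m%n; +-distrib-/-∣ˡ; n/n≡1)
  open import Data.Nat.Divisibility using (∣-refl)
  open ℝ-Solver using (_:=_; _:+_; _:*_)
  open ℂ-Solver using () renaming (_:=_ to _⊜_; _:+_ to _⊕_; _:*_ to _⊗_; _:-_ to _⊖_; con to conℂ)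

  Bounded : (ℕ → ℂ) → Set
  Bounded t = ∃[ A ] 0ᵣ ≤ A × (∀ n → ∣ t n ∣≤ A)

  initially-bounded : ∀ t M → ∃[ A ] 0ᵣ ≤ A × (∀ n → n ℕ.< M → ∣ t n ∣≤ A)
  initially-bounded t zero    = 0ᵣ , ≤-refl , λ _ ()
  initially-bounded t (suc M) = let (A , 0≤A , bounded) = initially-bounded (t ∘ suc) M; 0≤b = <⇒≤ (0<bound (t 0)) in
    bound (t 0) +ᵣ A , 0≤+ 0≤b 0≤A , λ where
      zero    _         → ∣∣≤-weaken (x≤x+y 0≤A) (∣z∣≤bound (t 0))
      (suc n) (s≤s n<M) → ∣∣≤-weaken (≤-trans (x≤x+y 0≤b) (≤-reflexive (+-comm A (bound (t 0))))) (bounded n n<M)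

  -- From M on, a term is the difference of two partial sums within 1 of the limit, hence 1 + 1; A
  -- covers the finitely many earlier terms.
  limit⇒bounded : ∀ {t s} → IsLimit (Σ[_] t) s → Bounded t
  limit⇒bounded {t} {s} lim = let (M , near) = lim 1ᵣ 0<1; (A , 0≤A , initial) = initially-bounded t M in
    A +ᵣ (1ᵣ +ᵣ 1ᵣ) , 0≤+ 0≤A (0≤+ 0≤1 0≤1) , λ n →
      [ (λ n<M → ∣∣≤-weaken (x≤x+y (0≤+ 0≤1 0≤1)) (initial n n<M))
      , (λ M≤n → ∣∣≤-weaken (≤-trans (x≤x+y 0≤A) (≤-reflexive (+-comm _ A))) (∣∣≤-cong (term n)
          (∣z-w∣≤ (near (suc n) (ℕ.m≤n⇒m≤1+n M≤n)) (near n M≤n)))) ]′ (ℕ.<-≤-connex n M)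
    where
    term : ∀ n → (Σ[ suc n ] t - s) - (Σ[ n ] t - s) ≈ t n
    term n = ℂ-Ring.trans (ℂ-Ring.+-congʳ { - (Σ[ n ] t - s)} (ℂ-Ring.+-congʳ { - s} (Σ-snoc t n)))
      (ℂ-Solver.solve 3 (λ S u s → ((S ⊕ u) ⊖ s) ⊖ (S ⊖ s) ⊜ u) ℂ-Ring.refl (Σ[ n ] t) (t n) s)

  remainderCase : ℕ → ℂ → ℂ
  remainderCase zero    z = z
  remainderCase (suc _) z = 0#

  -- The coefficients of Σ d_m (w^p)^m as a power series in w.
  stretch : (p : ℕ) .{{_ : NonZero p}} → (ℕ → ℂ) → ℕ → ℂ
  stretch p d n = remainderCase (n % p) (d (n / p))

  stretch-multiple : ∀ p .{{_ : NonZero p}} d m → stretch p d (m ℕ.* p) ≡ d m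
  stretch-multiple p d m = ≡.cong₂ (λ r q → remainderCase r (d q)) (m*n%n≡0 m p) (m*n/n≡m m p)

  stretch-small : ∀ p .{{_ : NonZero p}} d n → suc n ℕ.< p → stretch p d (suc n) ≡ 0#
  stretch-small p d n n<p = ≡.cong (λ r → remainderCase r (d (suc n / p))) (m<n⇒m%n≡m n<p)

  stretch-+ : ∀ p .{{_ : NonZero p}} d n → stretch p d (p ℕ.+ n) ≡ stretch p (d ∘ suc) n
  stretch-+ p d n = ≡.cong₂ (λ r q → remainderCase r (d q))
    (≡.trans (≡.cong (_% p) (ℕ.+-comm p n)) ([m+n]%n≡m%n n p))
    (≡.trans (+-distrib-/-∣ˡ n ∣-refl) (≡.cong (ℕ._+ n / p) (n/n≡1 p)))

  -- One block of p exponents at a time: the first block carries d 0 and zeros, and the rest is x^p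
  -- times the stretch of the shifted sequence.
  Σ-stretch : ∀ p .{{_ : NonZero p}} d x J →
    Σ[ J ℕ.* p ] (λ n → stretch p d n * x ^ n) ≈ Σ[ J ] (λ m → d m * (x ^ p) ^ m)
  Σ-stretch p d x zero = ℂ-Ring.refl
  Σ-stretch p@(suc p′) d x (suc J) = ℂ-Ring.trans (Σ-split (λ n → stretch p d n * x ^ n) p (J ℕ.* p))
    (ℂ-Ring.+-cong
      (ℂ-Ring.trans (ℂ-Ring.+-congˡ {stretch p d 0 * x ^ 0} (Σ-zero p′ λ i i<p′ →
          ℂ-Ring.trans (ℂ-Ring.*-congʳ {x ^ suc i} (ℂ-Ring.reflexive (stretch-small p d i (s≤s i<p′)))) (ℂ-Ring.zeroˡ (x ^ suc i))))
        (ℂ-Ring.+-identityʳ (stretch p d 0 * x ^ 0)))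
      (ℂ-Ring.trans (Σ-cong (J ℕ.* p) λ i _ → ℂ-Ring.trans
          (ℂ-Ring.*-cong (ℂ-Ring.reflexive (stretch-+ p d i)) (^ℂ-homo-* x p i))
          (ℂ-Solver.solve 3 (λ a b c → a ⊗ (b ⊗ c) ⊜ b ⊗ (a ⊗ c)) ℂ-Ring.refl (stretch p (d ∘ suc) i) (x ^ p) (x ^ i)))
      (ℂ-Ring.trans (Σ-*ˡ (x ^ p) (λ i → stretch p (d ∘ suc) i * x ^ i) (J ℕ.* p))
      (ℂ-Ring.trans (ℂ-Ring.*-congˡ {x ^ p} (Σ-stretch p (d ∘ suc) x J))
      (ℂ-Ring.trans (ℂ-Ring.sym (Σ-*ˡ (x ^ p) (λ m → d (suc m) * (x ^ p) ^ m) J))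
        (Σ-cong J λ m _ → ℂ-Solver.solve 3 (λ a b c → b ⊗ (a ⊗ c) ⊜ a ⊗ (b ⊗ c)) ℂ-Ring.refl (d (suc m)) (x ^ p) ((x ^ p) ^ m)))))))

  module Scale {r : ℝ} (0<r : 0ᵣ < r) (r≤½ : r ≤ ½) where

    0≤r : 0ᵣ ≤ r
    0≤r = <⇒≤ 0<r

    r≤1 : r ≤ 1ᵣ
    r≤1 = ≤-trans r≤½ ½≤1

    -- The offset 2 keeps w k in the disc ∣ q ∣ ≤ r / 2, where a series whose terms
    -- are bounded at r converges geometrically.
    ∣w∣ : ℕ → ℝ
    ∣w∣ k = r ^ᵣ (2 ℕ.+ k)

    w : ℕ → ℂ
    w k = fromℝ (∣w∣ k)

    0≤∣w∣ : ∀ k → 0ᵣ ≤ ∣w∣ k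
    0≤∣w∣ k = 0≤^ (2 ℕ.+ k) 0≤r

    ∣w∣≤1 : ∀ k → ∣w∣ k ≤ 1ᵣ
    ∣w∣≤1 k = x^n≤1 (2 ℕ.+ k) 0≤r r≤1

    -- The estimate G = O(w^J) along w = `w k`, with one constant for all k.
    BigO : ℕ → (ℕ → ℂ) → Set
    BigO J G = ∃[ C ] 0ᵣ ≤ C × (∀ k → ∣ G k ∣≤ C *ᵣ ∣w∣ k ^ᵣ J)

    BigO-cong : ∀ {J G H} → (∀ k → G k ≈ H k) → BigO J G → BigO J H
    BigO-cong G≈H (C , 0≤C , G≤) = C , 0≤C , λ k → ∣∣≤-cong (G≈H k) (G≤ k)

    BigO-+ : ∀ {J G H} → BigO J G → BigO J H → BigO J (λ k → G k + H k)
    BigO-+ (C , 0≤C , G≤) (D , 0≤D , H≤) = C +ᵣ D , 0≤+ 0≤C 0≤D , λ k →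
      ∣∣≤-weaken (≤-reflexive (sym (distribʳ _ C D))) (∣z+w∣≤ (G≤ k) (H≤ k))

    BigO-* : ∀ {J G} c → BigO J G → BigO J (λ k → c * G k)
    BigO-* c (C , 0≤C , G≤) = bound c *ᵣ C , 0≤* (<⇒≤ (0<bound c)) 0≤C , λ k →
      ∣∣≤-weaken (≤-reflexive (sym (*-assoc (bound c) C _))) (∣z*w∣≤ (∣z∣≤bound c) (G≤ k))

    BigO-Σ : ∀ {J} (G : ℕ → ℕ → ℂ) n → (∀ b → BigO J (G b)) → BigO J (λ k → Σ[ n ] (λ b → G b k))
    BigO-Σ {J} G zero    G≤ = 0ᵣ , ≤-refl , λ k → ∣0∣≤ (0≤* ≤-refl (0≤^ J (0≤∣w∣ k)))
    BigO-Σ {J} G (suc n) G≤ = BigO-+ {J} (G≤ 0) (BigO-Σ {J} (G ∘ suc) n (G≤ ∘ suc))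

    poly : (ℕ → ℂ) → ℕ → ℕ → ℂ
    poly d J k = Σ[ J ] (λ n → d n * w k ^ n)

    horner : ∀ d J k → poly d (suc J) k ≈ d 0 * 1# + w k * poly (d ∘ suc) J k
    horner d J k = ℂ-Ring.+-congˡ {d 0 * 1#} (ℂ-Ring.trans
      (Σ-cong J λ n _ → ℂ-Solver.solve 3 (λ a b c → a ⊗ (b ⊗ c) ⊜ b ⊗ (a ⊗ c)) ℂ-Ring.refl (d (suc n)) (w k) (w k ^ n))
      (Σ-*ˡ (w k) (λ n → d (suc n) * w k ^ n) J))

    poly-bounded : ∀ d J → ∃[ B ] 0ᵣ ≤ B × (∀ k → ∣ poly d J k ∣≤ B)
    poly-bounded d zero    = 0ᵣ , ≤-refl , λ k → ∣0∣≤ ≤-refl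
    poly-bounded d (suc J) = let (B , 0≤B , bounded) = poly-bounded (d ∘ suc) J; 0≤b = <⇒≤ (0<bound (d 0)) in
      bound (d 0) *ᵣ 1ᵣ +ᵣ 1ᵣ *ᵣ B , 0≤+ (0≤* 0≤b 0≤1) (0≤* 0≤1 0≤B) , λ k →
        ∣∣≤-cong (ℂ-Ring.sym (horner d J k)) (∣z+w∣≤ (∣z*w∣≤ (∣z∣≤bound (d 0)) ∣1∣≤1)
          (∣z*w∣≤ (∣∣≤-weaken (∣w∣≤1 k) (∣fromℝ∣≤ (0≤∣w∣ k))) (bounded k)))

    private
      r⁻¹ : ℝ
      r⁻¹ = proj₁ (inverse 0<r)

      0≤r⁻¹ : 0ᵣ ≤ r⁻¹
      0≤r⁻¹ = <⇒≤ (proj₁ (proj₂ (inverse 0<r)))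

      r*r⁻¹≈1 : r *ᵣ r⁻¹ ≈ᵣ 1ᵣ
      r*r⁻¹≈1 = proj₂ (proj₂ (inverse 0<r))

    ∣w*z∣≤⇒∣z∣≤ : ∀ {z s} k → ∣ w k * z ∣≤ ∣w∣ k *ᵣ s → ∣ z ∣≤ s
    ∣w*z∣≤⇒∣z∣≤ {z} {s} k wz≤ = ∣∣≤-cong
      (ℂ-Ring.trans (ℂ-Ring.sym (ℂ-Ring.*-assoc (fromℝ (r⁻¹ ^ᵣ (2 ℕ.+ k))) (w k) z))
        (ℂ-Ring.trans (ℂ-Ring.*-congʳ {z} (ℂ-Ring.trans (ℂ-Ring.sym (fromℝ-* (r⁻¹ ^ᵣ (2 ℕ.+ k)) (∣w∣ k))) (fromℝ-cong r⁻ᵏrᵏ≈1)))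
          (ℂ-Ring.*-identityˡ z)))
      (∣∣≤-weaken (≤-reflexive (trans (sym (*-assoc _ _ s)) (trans (*-congʳ r⁻ᵏrᵏ≈1) (*-identityˡ s))))
        (∣z*w∣≤ (∣fromℝ∣≤ (0≤^ (2 ℕ.+ k) 0≤r⁻¹)) wz≤))
      where
      r⁻ᵏrᵏ≈1 : r⁻¹ ^ᵣ (2 ℕ.+ k) *ᵣ ∣w∣ k ≈ᵣ 1ᵣ
      r⁻ᵏrᵏ≈1 = trans (*-comm _ _) (inverse-^ (2 ℕ.+ k) r*r⁻¹≈1)

    constant-zero : ∀ {z B} → 0ᵣ ≤ B → (∀ k → ∣ z ∣≤ B *ᵣ ∣w∣ k) → z ≈ 0#
    constant-zero {z} {B} 0≤B z≤ = ∣∣≤0⇒≈0 λ ε 0<ε → let (M , small) = ½^n-small B 0≤B 0<ε in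
      ∣∣≤-weaken (≤-trans (*-monoʳ-≤ B 0≤B (^-monoˡ-≤ (2 ℕ.+ M) 0≤r r≤½)) (<⇒≤ (small (2 ℕ.+ M) (ℕ.m≤n+m M 2))))
        (z≤ M)

    -- Uniqueness of asymptotic expansions. The constant d 0 = P - w Q is O(w), hence 0, because
    -- `w k` tends to 0; then P = w Q, and dividing by w lowers the order by one.
    BigO-poly⇒zero : ∀ J d → BigO J (poly d J) → ∀ n → n ℕ.< J → d n ≈ 0#
    BigO-poly⇒zero (suc J) d (C , 0≤C , P≤) = λ where
        zero    _         → d₀≈0
        (suc n) (s≤s n<J) → BigO-poly⇒zero J (d ∘ suc) (C , 0≤C , quotient≤) n n<J
      where
      Q = poly (d ∘ suc) J
      d₀≈P-wQ : ∀ k → poly d (suc J) k - w k * Q k ≈ d 0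
      d₀≈P-wQ k = ℂ-Ring.trans (ℂ-Ring.+-congʳ { - (w k * Q k)} (horner d J k))
        (ℂ-Solver.solve 2 (λ d q → (d ⊗ conℂ (+ 1) ⊕ q) ⊖ q ⊜ d) ℂ-Ring.refl (d 0) (w k * Q k))
      d₀≈0 : d 0 ≈ 0#
      d₀≈0 = let (B , 0≤B , bounded) = poly-bounded (d ∘ suc) J in
        constant-zero (0≤+ 0≤C 0≤B) λ k → ∣∣≤-weaken (begin
          C *ᵣ (∣w∣ k *ᵣ ∣w∣ k ^ᵣ J) +ᵣ ∣w∣ k *ᵣ B
            ≤⟨ +-monoˡ-≤ _ (*-monoʳ-≤ C 0≤C (≤-trans (*-monoʳ-≤ (∣w∣ k) (0≤∣w∣ k)
                 (x^n≤1 J (0≤∣w∣ k) (∣w∣≤1 k))) (≤-reflexive (*-identityʳ (∣w∣ k))))) ⟩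
          C *ᵣ ∣w∣ k +ᵣ ∣w∣ k *ᵣ B
            ≈⟨ ℝ-Solver.solve 3 (λ c x b → c :* x :+ x :* b := (c :+ b) :* x) refl C (∣w∣ k) B ⟩
          (C +ᵣ B) *ᵣ ∣w∣ k ∎)
          (∣∣≤-cong (d₀≈P-wQ k) (∣z-w∣≤ (P≤ k) (∣z*w∣≤ (∣fromℝ∣≤ (0≤∣w∣ k)) (bounded k))))
      quotient≤ : ∀ k → ∣ Q k ∣≤ C *ᵣ ∣w∣ k ^ᵣ J
      quotient≤ k = ∣w*z∣≤⇒∣z∣≤ k (∣∣≤-weaken
        (≤-reflexive (ℝ-Solver.solve 3 (λ c x y → c :* (x :* y) := x :* (c :* y)) refl C (∣w∣ k) (∣w∣ k ^ᵣ J)))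
        (∣∣≤-cong (ℂ-Ring.trans (horner d J k) (ℂ-Ring.trans
          (ℂ-Ring.+-congʳ {w k * Q k} (ℂ-Ring.trans (ℂ-Ring.*-congʳ {1#} d₀≈0) (ℂ-Ring.zeroˡ 1#)))
          (ℂ-Ring.+-identityˡ (w k * Q k)))) (P≤ k)))

    -- Boundedness of the terms at the single radius r gives the Cauchy-type estimate |a n| ≤ A /
    -- r^n.
    module PowerSeries {a : ℕ → ℂ} {A : ℝ} (0≤A : 0ᵣ ≤ A) (a≤ : ∀ n → ∣ a n * fromℝ r ^ n ∣≤ A) where

      ∣a∣≤ : ∀ n → ∣ a n ∣≤ A *ᵣ r⁻¹ ^ᵣ n
      ∣a∣≤ n = ∣∣≤-cong (ℂ-Ring.trans (ℂ-Ring.*-assoc (a n) (fromℝ r ^ n) (fromℝ (r⁻¹ ^ᵣ n)))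
          (ℂ-Ring.trans (ℂ-Ring.*-congˡ {a n} (ℂ-Ring.trans
            (ℂ-Ring.*-congʳ {fromℝ (r⁻¹ ^ᵣ n)} (ℂ-Ring.sym (fromℝ-^ r n)))
            (ℂ-Ring.trans (ℂ-Ring.sym (fromℝ-* (r ^ᵣ n) (r⁻¹ ^ᵣ n))) (fromℝ-cong (inverse-^ n r*r⁻¹≈1)))))
            (ℂ-Ring.*-identityʳ (a n))))
        (∣z*w∣≤ (a≤ n) (∣fromℝ∣≤ (0≤^ n 0≤r⁻¹)))

      remainder : ℕ → ℝ
      remainder J = (A +ᵣ A) *ᵣ r⁻¹ ^ᵣ J

      0≤remainder : ∀ J → 0ᵣ ≤ remainder J
      0≤remainder J = 0≤* (0≤+ 0≤A 0≤A) (0≤^ J 0≤r⁻¹)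

      -- For |q| ≤ r^j the terms are at most A (r^(j-1))^n, and j ≥ 2 makes the ratio at most 1/2.
      -- The tail 2A (r^(j-1))^J is rewritten so that the constant `remainder J` does not depend on
      -- j.
      ∣F-partial∣≤ : ∀ {q F} j → 2 ℕ.≤ j → ∣ q ∣≤ r ^ᵣ j → IsLimit (Σ[_] (λ n → a n * q ^ n)) F →
                     ∀ J → ∣ F - Σ[ J ] (λ n → a n * q ^ n) ∣≤ remainder J *ᵣ (r ^ᵣ j) ^ᵣ J
      ∣F-partial∣≤ {q} (suc zero)      (s≤s ())
      ∣F-partial∣≤ {q} (suc i@(suc i′)) _ q≤ lim J = ∣∣≤-weaken (≤-reflexive (begin-equality
          A *ᵣ (r ^ᵣ i) ^ᵣ J +ᵣ A *ᵣ (r ^ᵣ i) ^ᵣ J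
            ≈⟨ +-cong (*-congˡ (scale J)) (*-congˡ (scale J)) ⟩
          A *ᵣ (r⁻¹ ^ᵣ J *ᵣ (r *ᵣ r ^ᵣ i) ^ᵣ J) +ᵣ A *ᵣ (r⁻¹ ^ᵣ J *ᵣ (r *ᵣ r ^ᵣ i) ^ᵣ J)
            ≈⟨ ℝ-Solver.solve 3 (λ a x y → a :* (x :* y) :+ a :* (x :* y) := (a :+ a) :* x :* y) refl A (r⁻¹ ^ᵣ J) ((r *ᵣ r ^ᵣ i) ^ᵣ J) ⟩
          remainder J *ᵣ (r *ᵣ r ^ᵣ i) ^ᵣ J ∎))
        (GeometricSeries.sum-tail (0≤^ i 0≤r) ρ≤½ 0≤A term≤ lim J)
        where
        scale : ∀ n → (r ^ᵣ i) ^ᵣ n ≈ᵣ r⁻¹ ^ᵣ n *ᵣ (r *ᵣ r ^ᵣ i) ^ᵣ n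
        scale n = trans (^-congˡ n (trans (sym (*-identityˡ (r ^ᵣ i)))
          (trans (*-congʳ (trans (sym r*r⁻¹≈1) (*-comm r r⁻¹))) (*-assoc r⁻¹ r (r ^ᵣ i)))))
          (^-distrib-* r⁻¹ (r *ᵣ r ^ᵣ i) n)
        ρ≤½ : r ^ᵣ i ≤ ½
        ρ≤½ = ≤-trans (*-mono-≤ 0≤r 0≤1 r≤½ (x^n≤1 i′ 0≤r r≤1)) (≤-reflexive (*-identityʳ ½))
        term≤ : ∀ n → ∣ a n * q ^ n ∣≤ A *ᵣ (r ^ᵣ i) ^ᵣ n
        term≤ n = ∣∣≤-weaken (≤-reflexive (trans (*-assoc A _ _) (*-congˡ (sym (scale n)))))
          (∣z*w∣≤ (∣a∣≤ n) (∣z^n∣≤ n q≤))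

-- Uniqueness of π, roots of unity and the nome

module Nome (R : RealNumbers) where

  open Analysis R
  open RealProperties R
  open ComplexProperties R
  open Exponential R
  open ≤-Reasoning
  open ℝ-Solver using (_:=_; _:+_; _:*_; _:-_; :-_; con)

  sin-unique : ∀ {x s s′} → IsSin x s → IsSin x s′ → s ≈ᵣ s′
  sin-unique (c , e) (c′ , e′) = proj₂ (ℂ-Ring.trans (isExp⇒≈exp e) (ℂ-Ring.sym (isExp⇒≈exp e′)))

  -- If π < π′, the sine at π would be both 0 and positive. Every nome comes with its own π, and
  -- uniqueness is what lets the nomes of different points share one.
  π-≮ : ∀ {π π′} → IsPi π → IsPi π′ → ¬ (π < π′)
  π-≮ {π} (0<π , sinπ≈0 , _) (_ , _ , sin-pos) π<π′ =
    let (s , sinπ≈s , 0<s) = sin-pos π 0<π π<π′ in <-irrefl (sin-unique sinπ≈0 sinπ≈s) 0<s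

  π-unique : ∀ {π π′} → IsPi π → IsPi π′ → π ≈ᵣ π′
  π-unique isPi isPi′ = ≤-antisym (π-≮ isPi′ isPi) (π-≮ isPi isPi′)

  cis : ℝ → ℂ
  cis θ = exp (0ᵣ +i θ)

  cis-cong : ∀ {θ φ} → θ ≈ᵣ φ → cis θ ≈ cis φ
  cis-cong θ≈φ = exp-cong (refl , θ≈φ)

  -- Conjugation commutes with the exponential and turns iθ into its negative.
  cis*conj≈1 : ∀ θ → cis θ * conj (cis θ) ≈ 1#
  cis*conj≈1 θ = ℂ-Ring.trans (ℂ-Ring.*-congˡ {cis θ} (ℂ-Ring.sym (exp-conj (0ᵣ +i θ))))
    (ℂ-Ring.trans (ℂ-Ring.sym (exp-+ (0ᵣ +i θ) (conj (0ᵣ +i θ))))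
      (ℂ-Ring.trans (exp-cong (+-identityˡ 0ᵣ , -‿inverseʳ θ)) exp-0))

  ∣cis∣≤1 : ∀ θ → ∣ cis θ ∣≤ 1ᵣ
  ∣cis∣≤1 θ = 0≤1 , ≤-reflexive (trans
    (ℝ-Solver.solve 2 (λ a b → a :* a :+ b :* b := a :* a :- b :* (:- b)) refl (Re (cis θ)) (Im (cis θ)))
    (trans (proj₁ (cis*conj≈1 θ)) (sym (*-identityˡ 1ᵣ))))

  cis-·ℕ : ∀ n θ → cis (fromℕ n *ᵣ θ) ≈ cis θ ^ n
  cis-·ℕ n θ = ℂ-Ring.trans (exp-cong
    ( ℝ-Solver.solve 2 (λ n θ → con (+ 0) := n :* con (+ 0) :- con (+ 0) :* θ) refl (fromℕ n) θ
    , ℝ-Solver.solve 2 (λ n θ → n :* θ := n :* θ :+ con (+ 0) :* con (+ 0)) refl (fromℕ n) θ))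
    (exp-·ℕ n (0ᵣ +i θ))

  module Period {π : ℝ} (isPi : IsPi π) where

    τ : ℝ
    τ = fromℕ 2 *ᵣ π *ᵣ 1/ 1

    nome : ℂ → ℂ
    nome z = exp ((0ᵣ +i τ) * z)

    isNome⇒≈nome : ∀ {z q} → IsNome 1 z q → q ≈ nome z
    isNome⇒≈nome {z} (π′ , isPi′ , q-exp) = ℂ-Ring.trans (isExp⇒≈exp q-exp)
      (exp-cong (ℂ-Ring.*-congʳ {z} (refl , *-congʳ (*-congˡ (π-unique isPi′ isPi)))))

    τ≈π+π : τ ≈ᵣ π +ᵣ π
    τ≈π+π = trans (*-congˡ 1/1≈1) (ℝ-Solver.solve 1 (λ π → (con (+ 1) :+ (con (+ 1) :+ con (+ 0))) :* π :* con (+ 1) := π :+ π) refl π)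

    0<τ : 0ᵣ < τ
    0<τ = <-respʳ-≈ (sym τ≈π+π) (0<+ (proj₁ isPi) (<⇒≤ (proj₁ isPi)))

    -- cis π = c is real because sin π = 0, so c² = |cis π|² = 1.
    cis-τ : cis τ ≈ 1#
    cis-τ = ℂ-Ring.trans (exp-cong (sym (+-identityˡ 0ᵣ) , τ≈π+π))
      (ℂ-Ring.trans (exp-+ (0ᵣ +i π) (0ᵣ +i π))
      (ℂ-Ring.trans (ℂ-Ring.*-congˡ {cis π} real) (cis*conj≈1 π)))
      where
      Im≈0 : Im (cis π) ≈ᵣ 0ᵣ
      Im≈0 = let (c , c-exp) = proj₁ (proj₂ isPi) in sym (proj₂ (isExp⇒≈exp c-exp))
      real : cis π ≈ conj (cis π)
      real = refl , trans Im≈0 (trans (ℝ-Solver.solve 0 (con (+ 0) := :- con (+ 0)) refl) (-‿cong (sym Im≈0)))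

    -- The scale y₀ makes r = e^{-2πy₀} at most 1/2.
    y₀-scale : ∃[ n ] 1ᵣ ≤ τ *ᵣ fromℕ (suc n)
    y₀-scale = let (i , 0<i , τi≈1) = inverse 0<τ; (n , i<n) = archimedean i in
      n , ≤-trans (≤-reflexive (sym τi≈1))
        (*-monoʳ-≤ τ (<⇒≤ 0<τ) (≤-trans (<⇒≤ i<n) (fromℕ-mono-≤ (ℕ.n≤1+n n))))

    y₀ : ℕ
    y₀ = suc (proj₁ y₀-scale)

    r : ℝ
    r = expᵣ (-ᵣ (τ *ᵣ fromℕ y₀))

    0<r : 0ᵣ < r
    0<r = 0<expᵣ _

    r≤½ : r ≤ ½
    r≤½ = *-cancelˡ-≤ (fromℕ 2) (fromℕ-pos 2) (begin
      fromℕ 2 *ᵣ r                         ≈⟨ *-comm (fromℕ 2) r ⟩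
      r *ᵣ fromℕ 2                         ≤⟨ *-monoʳ-≤ r (<⇒≤ 0<r) 2≤exp ⟩
      r *ᵣ expᵣ (τ *ᵣ fromℕ y₀)            ≈⟨ *-comm _ _ ⟩
      expᵣ (τ *ᵣ fromℕ y₀) *ᵣ r            ≈⟨ expᵣ-inverse (τ *ᵣ fromℕ y₀) ⟩
      1ᵣ                                   ≈⟨ n*1/n≈1 2 ⟨
      fromℕ 2 *ᵣ ½                         ∎)
      where
      2≤exp : fromℕ 2 ≤ expᵣ (τ *ᵣ fromℕ y₀)
      2≤exp = begin
        fromℕ 2                       ≈⟨ +-congˡ (+-identityʳ 1ᵣ) ⟩
        1ᵣ +ᵣ 1ᵣ                      ≤⟨ +-monoʳ-≤ 1ᵣ (proj₂ y₀-scale) ⟩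
        1ᵣ +ᵣ τ *ᵣ fromℕ y₀           ≤⟨ 1+x≤expᵣ (≤-trans 0≤1 (proj₂ y₀-scale)) ⟩
        expᵣ (τ *ᵣ fromℕ y₀)          ∎

    nome-value : ∀ {z x} j → Re z ≈ᵣ x → Im z ≈ᵣ fromℕ y₀ *ᵣ fromℕ j → nome z ≈ cis (τ *ᵣ x) * fromℝ (r ^ᵣ j)
    nome-value {u +i v} {x} j u≈x v≈y = ℂ-Ring.trans (exp-cong
      ( trans (ℝ-Solver.solve 3 (λ t u v → con (+ 0) :* u :- t :* v := con (+ 0) :+ (:- (t :* v))) refl τ u v) (+-congˡ (-‿cong (*-congˡ v≈y)))
      , trans (ℝ-Solver.solve 3 (λ t u v → con (+ 0) :* v :+ t :* u := t :* u :+ con (+ 0)) refl τ u v) (+-congʳ (*-congˡ u≈x)) ))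
      (ℂ-Ring.trans (exp-+ (0ᵣ +i (τ *ᵣ x)) (fromℝ (-ᵣ (τ *ᵣ (fromℕ y₀ *ᵣ fromℕ j)))))
      (ℂ-Ring.*-congˡ {cis (τ *ᵣ x)} (ℂ-Ring.trans (exp-fromℝ _) (fromℝ-cong (trans
        (expᵣ-cong (ℝ-Solver.solve 3 (λ t y j → :- (t :* (y :* j)) := j :* (:- (t :* y))) refl τ (fromℕ y₀) (fromℕ j)))
        (expᵣ-·ℕ j (-ᵣ (τ *ᵣ fromℕ y₀))))))))

    rootOfUnity : ∀ p .{{_ : NonZero p}} b → cis (τ *ᵣ (fromℕ b *ᵣ 1/ p)) ^ p ≈ 1#
    rootOfUnity p b = ℂ-Ring.trans (ℂ-Ring.sym (cis-·ℕ p _)) (ℂ-Ring.trans (cis-cong (trans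
        (ℝ-Solver.solve 4 (λ p t b i → p :* (t :* (b :* i)) := b :* t :* (i :* p)) refl (fromℕ p) τ (fromℕ b) (1/ p))
        (trans (*-congˡ (1/n*n≈1 p)) (*-identityʳ _))))
      (ℂ-Ring.trans (cis-·ℕ b τ) (ℂ-Ring.trans (^ℂ-congˡ b cis-τ) (1^ℂ≈1 b))))

-- Integer powers of a natural number

module IntegerPowers (R : RealNumbers) where

  open Analysis R
  open RealProperties R
  open Exponential R
  open ≤-Reasoning
  open import Data.Integer.Properties as ℤ using (<-cmp)
  open import Relation.Binary.Definitions using (Tri; tri<; tri≈; tri>)
  open IntegerRingSolver commutativeRing

  ^-mono-< : ∀ {x} → 1ᵣ < x → ∀ {m n} → m ℕ.< n → x ^ᵣ m < x ^ᵣ n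
  ^-mono-< {x} 1<x {m} {suc n} (s≤s m≤n) = begin-strict
    x ^ᵣ m          ≤⟨ x^m≤x^n m≤n ⟩
    x ^ᵣ n          ≈⟨ *-identityˡ (x ^ᵣ n) ⟨
    1ᵣ *ᵣ x ^ᵣ n    <⟨ *-monoˡ-< (x ^ᵣ n) (0<^ n 0<x) 1<x ⟩
    x *ᵣ x ^ᵣ n     ∎
    where
    0<x = <-trans 0<1 1<x
    x^m≤x^n : ∀ {m n} → m ℕ.≤ n → x ^ᵣ m ≤ x ^ᵣ n
    x^m≤x^n {n = zero}  z≤n       = ≤-refl
    x^m≤x^n {n = suc n} z≤n       = ≤-trans (≤-reflexive (sym (*-identityˡ 1ᵣ)))
      (*-mono-≤ 0≤1 (0≤^ n (<⇒≤ 0<x)) (<⇒≤ 1<x) (x^m≤x^n {n = n} z≤n))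
    x^m≤x^n         (s≤s m≤n) = *-monoʳ-≤ x (<⇒≤ 0<x) (x^m≤x^n m≤n)

  module _ (p : ℕ) .{{_ : NonZero p}} where

    p^-1*p≈1 : ∀ n → (1/ p) ^ᵣ n *ᵣ fromℕ p ^ᵣ n ≈ᵣ 1ᵣ
    p^-1*p≈1 n = inverse-^ n (1/n*n≈1 p)

    ^ℤ-mono-< : 1ᵣ < fromℕ p → ∀ {i j} → i ℤ.< j → p ^ℤ i < p ^ℤ j
    ^ℤ-mono-< 1<p (ℤ.+<+ m<n) = ^-mono-< 1<p m<n
    ^ℤ-mono-< 1<p (ℤ.-<+ {m} {n}) = begin-strict
      (1/ p) ^ᵣ suc m                       ≈⟨ *-identityʳ _ ⟨
      (1/ p) ^ᵣ suc m *ᵣ 1ᵣ                 ≈⟨ *-comm _ 1ᵣ ⟩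
      1ᵣ *ᵣ (1/ p) ^ᵣ suc m                 <⟨ *-monoˡ-< _ (0<^ (suc m) (1/-pos p)) (^-mono-< 1<p {0} {suc m} (s≤s z≤n)) ⟩
      fromℕ p ^ᵣ suc m *ᵣ (1/ p) ^ᵣ suc m   ≈⟨ trans (*-comm _ _) (p^-1*p≈1 (suc m)) ⟩
      1ᵣ                                    ≤⟨ 1≤p^ n ⟩
      fromℕ p ^ᵣ n                          ∎
      where
      1≤p^ : ∀ n → 1ᵣ ≤ fromℕ p ^ᵣ n
      1≤p^ zero    = ≤-refl
      1≤p^ (suc n) = <⇒≤ (^-mono-< 1<p {0} {suc n} (s≤s z≤n))
    ^ℤ-mono-< 1<p (ℤ.-<- {m} {n} n<m) = *-cancelˡ-< (pm *ᵣ pn) (*-pos (0<^ (suc m) (fromℕ-pos p)) (0<^ (suc n) (fromℕ-pos p))) (begin-strict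
      pm *ᵣ pn *ᵣ im      ≈⟨ solve 3 (λ a b c → a :* b :* c := b :* (c :* a)) refl pm pn im ⟩
      pn *ᵣ (im *ᵣ pm)    ≈⟨ trans (*-congˡ (p^-1*p≈1 (suc m))) (*-identityʳ pn) ⟩
      pn                  <⟨ ^-mono-< 1<p (s≤s n<m) ⟩
      pm                  ≈⟨ trans (*-congˡ (p^-1*p≈1 (suc n))) (*-identityʳ pm) ⟨
      pm *ᵣ (in′ *ᵣ pn)   ≈⟨ solve 3 (λ a b c → a :* (c :* b) := a :* b :* c) refl pm pn in′ ⟩
      pm *ᵣ pn *ᵣ in′     ∎)
      where
      pm = fromℕ p ^ᵣ suc m
      pn = fromℕ p ^ᵣ suc n
      im = (1/ p) ^ᵣ suc m
      in′ = (1/ p) ^ᵣ suc n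

    -- Strict monotonicity turns the decidable order of ℤ into apartness of reals.
    ^ℤ-injective-# : 1ᵣ < fromℕ p → ∀ {i j} → ¬ (i ≡ j) → p ^ℤ i #ᵣ p ^ℤ j
    ^ℤ-injective-# 1<p {i} {j} i≢j = go (<-cmp i j)
      where
      go : Tri (i ℤ.< j) (i ≡ j) (j ℤ.< i) → p ^ℤ i #ᵣ p ^ℤ j
      go (tri< i<j _ _) = <⇒# (^ℤ-mono-< 1<p i<j)
      go (tri≈ _ i≡j _) = ⊥-elim (i≢j i≡j)
      go (tri> _ _ j<i) = #-sym (<⇒# (^ℤ-mono-< 1<p j<i))

    -- The normalising factors of T_p times the number p of points (z + b)/p. Their product 1 makes
    -- this part of T_p f contribute a_n itself at exponents n divisible by p.
    ^ℤ-cancel : ∀ k → p ^ℤ (k ℤ.- 1ℤ) *ᵣ (p ^ℤ (ℤ.- k) *ᵣ fromℕ p) ≈ᵣ 1ᵣ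
    ^ℤ-cancel (+ zero) = trans (solve 2 (λ i p → i :* con (+ 1) :* (con (+ 1) :* p) := i :* p) refl (1/ p) (fromℕ p)) (1/n*n≈1 p)
    ^ℤ-cancel (+ suc m) = trans
      (solve 4 (λ pm i im p → pm :* (i :* im :* p) := im :* pm :* (i :* p)) refl (fromℕ p ^ᵣ m) (1/ p) ((1/ p) ^ᵣ m) (fromℕ p))
      (trans (*-cong (p^-1*p≈1 m) (1/n*n≈1 p)) (*-identityˡ 1ᵣ))
    -- The exponent k - 1 computes to a negative integer with m + 0 inside.
    ^ℤ-cancel -[1+ m ] = trans (*-congʳ (*-congˡ (*-congˡ (reflexive (≡.cong ((1/ p) ^ᵣ_) (ℕ.+-identityʳ m))))))
      (trans (solve 4 (λ pm i im p → i :* (i :* im) :* (p :* pm :* p) := im :* pm :* (i :* p :* (i :* p))) refl (fromℕ p ^ᵣ m) (1/ p) ((1/ p) ^ᵣ m) (fromℕ p))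
      (trans (*-cong (p^-1*p≈1 m) (trans (*-cong (1/n*n≈1 p) (1/n*n≈1 p)) (*-identityˡ 1ᵣ))) (*-identityˡ 1ᵣ)))

  1^ℤ≈1 : ∀ k → 1 ^ℤ k ≈ᵣ 1ᵣ
  1^ℤ≈1 (+ n)    = trans (^-congˡ n (+-identityʳ 1ᵣ)) (1^n≈1 n)
  1^ℤ≈1 -[1+ n ] = trans (^-congˡ (suc n) 1/1≈1) (1^n≈1 (suc n))

-- The Hecke operator at a prime

module HeckeRelation (R : RealNumbers) where

  open Analysis R
  open RealProperties R
  open ComplexProperties R
  open Exponential R
  open Expansions R
  open Nome R
  open IntegerPowers R
  open import Data.Bool.Base using (if_then_else_)
  open import Data.Nat.Coprimality using (Coprime; coprime?)
  open import Data.Nat.Divisibility using (_∣_; ∣1⇒≡1; divides)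
  open ℂ-Solver using () renaming (_:=_ to _⊜_; _:+_ to _⊕_; _:-_ to _⊖_)

  Σ-− : ∀ t u n → Σ[ n ] (λ i → t i - u i) ≈ Σ[ n ] t - Σ[ n ] u
  Σ-− t u zero    = ℂ-Ring.sym (ℂ-Ring.-‿inverseʳ 0#)
  Σ-− t u (suc n) = ℂ-Ring.trans (ℂ-Ring.+-congˡ {t 0 - u 0} (Σ-− (t ∘ suc) (u ∘ suc) n))
    (ℂ-Solver.solve 4 (λ a b c d → (a ⊖ b) ⊕ (c ⊖ d) ⊜ (a ⊕ c) ⊖ (b ⊕ d)) ℂ-Ring.refl (t 0) (u 0) (Σ[ n ] (t ∘ suc)) (Σ[ n ] (u ∘ suc)))

  Σ-first : ∀ {t} n → (∀ i → i ℕ.< n → t (suc i) ≈ 0#) → Σ[ suc n ] t ≈ t 0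
  Σ-first {t} n t≈0 = ℂ-Ring.trans (ℂ-Ring.+-congˡ {t 0} (Σ-zero {t ∘ suc} n t≈0)) (ℂ-Ring.+-identityʳ (t 0))

  Σ-last : ∀ {t} n → (∀ i → i ℕ.< n → t i ≈ 0#) → Σ[ suc n ] t ≈ t n
  Σ-last {t} n t≈0 = ℂ-Ring.trans (Σ-snoc t n)
    (ℂ-Ring.trans (ℂ-Ring.+-congʳ {t n} (Σ-zero {t} n t≈0)) (ℂ-Ring.+-identityˡ (t n)))

  if-yes : ∀ {P : Set} (P? : Dec P) {z w : ℂ} → P → (if does P? then z else w) ≈ z
  if-yes (yes _) _ = ℂ-Ring.refl
  if-yes (no ¬p) p = ⊥-elim (¬p p)

  if-no : ∀ {P : Set} (P? : Dec P) {z w : ℂ} → ¬ P → (if does P? then z else w) ≈ w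
  if-no (yes p) ¬p = ⊥-elim (¬p p)
  if-no (no _)  _  = ℂ-Ring.refl

  -- Cuspidal expansions are indexed from exponent 1, power series from 0; the shift costs a zero
  -- term.
  prepend-limit : ∀ {t s} → t 0 ≈ 0# → IsLimit (Σ[_] (t ∘ suc)) s → IsLimit (Σ[_] t) s
  prepend-limit {t} {s} t₀≈0 lim ε 0<ε = let (M , near) = lim ε 0<ε in suc M , λ where
    (suc n) (s≤s M≤n) → ∣∣≤-cong (ℂ-Ring.+-congʳ { - s} (ℂ-Ring.sym
      (ℂ-Ring.trans (ℂ-Ring.+-congʳ {Σ[ n ] (t ∘ suc)} t₀≈0) (ℂ-Ring.+-identityˡ (Σ[ n ] (t ∘ suc)))))) (near n M≤n)

  module _ {N : ℕ} .{{_ : NonZero N}} {k : ℤ} (m : ℕ) (prime-p : Prime (2 ℕ.+ m)) (p∤N : ¬ (2 ℕ.+ m ∣ N))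
           (f : Function UpperHalf) (z : ℍ) where

    private
      p = 2 ℕ.+ m

    heckeTerm : ℕ → ℕ → ℂ
    heckeTerm a′ d′ = let a = suc a′; d = suc d′ in
      if does (a ℕ.* d ℕ.≟ p ×-dec coprime? a N)
      then fromℝ (d ^ℤ (ℤ.- k)) * Σ[ d ] (λ b → to f (heckePoint a b d z))
      else 0#

    heckeTerm-yes : ∀ a′ d′ → let a = suc a′; d = suc d′ in a ℕ.* d ≡ p → Coprime a N →
      heckeTerm a′ d′ ≈ fromℝ (d ^ℤ (ℤ.- k)) * Σ[ d ] (λ b → to f (heckePoint a b d z))
    heckeTerm-yes a′ d′ ad≡p coprime = if-yes (suc a′ ℕ.* suc d′ ℕ.≟ p ×-dec coprime? (suc a′) N) (ad≡p , coprime)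

    heckeTerm-no : ∀ a′ d′ → ¬ (suc a′ ℕ.* suc d′ ≡ p) → heckeTerm a′ d′ ≈ 0#
    heckeTerm-no a′ d′ ad≢p = if-no (suc a′ ℕ.* suc d′ ℕ.≟ p ×-dec coprime? (suc a′) N) (ad≢p ∘ proj₁)

    -- Irreducibility of p leaves (a, d) = (1, p) and (p, 1). The second pair passes the coprimality
    -- test because p does not divide N; its factor is a power of 1, and its inner sum has the
    -- single term b = 0.
    T-prime : T N k p f z ≈ fromℝ (p ^ℤ (k ℤ.- 1ℤ)) *
      (fromℝ (p ^ℤ (ℤ.- k)) * Σ[ p ] (λ b → to f (heckePoint 1 b p z)) + to f (heckePoint p 0 1 z))
    T-prime = ℂ-Ring.*-congˡ {fromℝ (p ^ℤ (k ℤ.- 1ℤ))} (ℂ-Ring.+-cong row₁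
      (ℂ-Ring.trans (Σ-last {λ a″ → Σ[ p ] (heckeTerm (suc a″))} m middle) rowₚ))
      where
      row₁ : Σ[ p ] (heckeTerm 0) ≈ fromℝ (p ^ℤ (ℤ.- k)) * Σ[ p ] (λ b → to f (heckePoint 1 b p z))
      row₁ = ℂ-Ring.trans
        (Σ-last {heckeTerm 0} (suc m) λ d′ d′<1+m → heckeTerm-no 0 d′ λ d≡p →
          ℕ.<⇒≢ d′<1+m (ℕ.suc-injective (≡.trans (≡.sym (ℕ.*-identityˡ (suc d′))) d≡p)))
        (heckeTerm-yes 0 (suc m) (ℕ.*-identityˡ p) (∣1⇒≡1 ∘ proj₁))
      middle : ∀ i → i ℕ.< m → Σ[ p ] (heckeTerm (suc i)) ≈ 0#
      middle i i<m = Σ-zero {heckeTerm (suc i)} p λ d′ _ → heckeTerm-no (suc i) d′ λ ad≡p →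
        [ (λ ()) , (λ a≡p → ℕ.<⇒≢ i<m (ℕ.suc-injective (ℕ.suc-injective a≡p))) ]′
          (prime⇒irreducible prime-p (divides (suc d′) (≡.trans (≡.sym ad≡p) (ℕ.*-comm (2 ℕ.+ i) (suc d′)))))
      coprime : Coprime p N
      coprime (d∣p , d∣N) = [ (λ d≡1 → d≡1) , (λ d≡p → ⊥-elim (p∤N (≡.subst (_∣ N) d≡p d∣N))) ]′ (prime⇒irreducible prime-p d∣p)
      rowₚ : Σ[ p ] (heckeTerm (suc m)) ≈ to f (heckePoint p 0 1 z)
      rowₚ = ℂ-Ring.trans
        (Σ-first {heckeTerm (suc m)} (suc m) λ d′ _ → heckeTerm-no (suc m) (suc d′) λ pd≡p →
          ℕ.<⇒≢ (ℕ.m<m*n p (2 ℕ.+ d′) (s≤s (s≤s z≤n))) (≡.sym pd≡p))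
        (ℂ-Ring.trans (heckeTerm-yes (suc m) 0 (ℕ.*-identityʳ p) coprime)
        (ℂ-Ring.trans (ℂ-Ring.*-cong (fromℝ-cong (1^ℤ≈1 (ℤ.- k))) (ℂ-Ring.+-identityʳ (to f (heckePoint p 0 1 z))))
          (ℂ-Ring.*-identityˡ (to f (heckePoint p 0 1 z)))))

-- Fourier coefficients of an eigenform at p and p²

module Eigenform (R : RealNumbers) where

  open Analysis R
  open RealProperties R
  open ComplexProperties R
  open Exponential R
  open Expansions R
  open Nome R
  open IntegerPowers R
  open HeckeRelation R
  open ℝ-Solver using (_:=_; _:+_; _:*_; con)
  open ℂ-Solver using () renaming (_:=_ to _⊜_; _:+_ to _⊕_; _:*_ to _⊗_; _:-_ to _⊖_; :-_ to ⊖′_; con to conℂ)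
  open import Data.Nat.Divisibility using (_∣_)

  module _ {N : ℕ} .{{_ : NonZero N}} {κ : ℤ} (f : NormalisedEigenform N κ) {π : ℝ} (isPi : IsPi π) where

    private module f = NormalisedEigenform f
    open Period isPi
    open Scale 0<r r≤½

    F : ℍ → ℂ
    F = to f.form

    -- The expansion leaves `coeff 0` unspecified, while the constant term of a cusp form is 0.
    a : ℕ → ℂ
    a zero    = 0#
    a (suc n) = f.coeff (suc n)

    F-limit : ∀ z {q} → nome (proj₁ z) ≈ q → IsLimit (Σ[_] (λ n → a n * q ^ n)) (F z)
    F-limit z {q} nome≈q = let (q′ , q′-nome , sums) = f.expansion z (F z) ℂ-Ring.refl in
      prepend-limit {λ n → a n * q ^ n} (ℂ-Ring.zeroˡ 1#)
        (limit-cong (λ n → Σ-cong {λ i → f.coeff (suc i) * q′ ^ suc i} {λ i → f.coeff (suc i) * q ^ suc i} n λ i _ →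
            ℂ-Ring.*-congˡ {f.coeff (suc i)} (^ℂ-congˡ (suc i) (ℂ-Ring.trans (isNome⇒≈nome q′-nome) nome≈q)))
          ℂ-Ring.refl (hasSum⇒isLimit {λ i → f.coeff (suc i) * q′ ^ suc i} sums))

    cis-τ0≈1 : ∀ {x} → x ≈ᵣ 0ᵣ → cis (τ *ᵣ x) ≈ 1#
    cis-τ0≈1 x≈0 = ℂ-Ring.trans (cis-cong (trans (*-congˡ x≈0) (RealNumbers.zeroʳ R τ))) exp-0

    nome-imaginary : ∀ {z} j → Re z ≈ᵣ 0ᵣ → Im z ≈ᵣ fromℕ y₀ *ᵣ fromℕ j → nome z ≈ fromℝ (r ^ᵣ j)
    nome-imaginary j x≈0 y≈ = ℂ-Ring.trans (nome-value j x≈0 y≈)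
      (ℂ-Ring.trans (ℂ-Ring.*-congʳ {fromℝ (r ^ᵣ j)} (cis-τ0≈1 refl)) (ℂ-Ring.*-identityˡ (fromℝ (r ^ᵣ j))))

    0<y₀ : 0ᵣ < fromℕ y₀
    0<y₀ = fromℕ-pos (suc (proj₁ y₀-scale))

    -- At z = i y₀ the nome is r, and convergence at this one point controls all coefficients.
    a-bounded : Bounded (λ n → a n * fromℝ r ^ n)
    a-bounded = limit⇒bounded {λ n → a n * fromℝ r ^ n} (F-limit ((0ᵣ +i fromℕ y₀) , 0<y₀)
      (ℂ-Ring.trans (nome-imaginary 1 refl (ℝ-Solver.solve 1 (λ y → y := y :* (con (+ 1) :+ con (+ 0))) refl (fromℕ y₀)))
        (fromℝ-cong (*-identityʳ r))))

    open PowerSeries {a} (proj₁ (proj₂ a-bounded)) (proj₂ (proj₂ a-bounded))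

    ∣F-poly∣≤ : ∀ z j {q} → 2 ℕ.≤ j → nome (proj₁ z) ≈ q → ∣ q ∣≤ r ^ᵣ j →
                ∀ J → ∣ F z - Σ[ J ] (λ n → a n * q ^ n) ∣≤ remainder J *ᵣ (r ^ᵣ j) ^ᵣ J
    ∣F-poly∣≤ z j 2≤j nome≈q q≤ = ∣F-partial∣≤ j 2≤j q≤ (F-limit z nome≈q)

    -- When the nome is q = w^s, truncating after J powers of q amounts to truncating after J s
    -- powers of w.
    stretched-expansion : ∀ s .{{_ : NonZero s}} J {G : ℕ → ℂ} →
      (∀ k → let q = r ^ᵣ ((2 ℕ.+ k) ℕ.* s) in
        ∣ G k - Σ[ J ] (λ n → a n * fromℝ q ^ n) ∣≤ remainder J *ᵣ q ^ᵣ J) →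
      BigO (J ℕ.* s) (λ k → G k - poly (stretch s a) (J ℕ.* s) k)
    stretched-expansion s J {G} G≤ = remainder J , 0≤remainder J , λ k → ∣∣≤-weaken
      (≤-reflexive (*-congˡ (trans (^-congˡ J (sym (^-assocʳ r (2 ℕ.+ k) s)))
        (trans (^-assocʳ (∣w∣ k) s J) (reflexive (≡.cong (∣w∣ k ^ᵣ_) (ℕ.*-comm s J)))))))
      (∣∣≤-cong (ℂ-Ring.+-congˡ {G k} (ℂ-Ring.-‿cong (ℂ-Ring.sym (ℂ-Ring.trans (Σ-stretch s a (w k) J)
        (Σ-cong J λ n _ → ℂ-Ring.*-congˡ {a n} (^ℂ-congˡ n (ℂ-Ring.trans (ℂ-Ring.sym (fromℝ-^ (∣w∣ k) s))
          (fromℝ-cong (^-assocʳ r (2 ℕ.+ k) s)))))))))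
        (G≤ k))

    module _ (m : ℕ) (prime-p : Prime (2 ℕ.+ m)) (p∤N : ¬ (2 ℕ.+ m ∣ N)) where

      private
        p = 2 ℕ.+ m
        p² = p ℕ.* p

      -- The nome of (point k + b) / p is ζ b * w k.
      point : ℕ → ℍ
      point k = (0ᵣ +i fromℕ y₀ *ᵣ fromℕ ((2 ℕ.+ k) ℕ.* p)) , *-pos 0<y₀ (fromℕ-pos ((2 ℕ.+ k) ℕ.* p))

      ζ : ℕ → ℂ
      ζ b = cis (τ *ᵣ (fromℕ b *ᵣ 1/ p))

      ζ^p≈1 : ∀ b → ζ b ^ p ≈ 1#
      ζ^p≈1 = rootOfUnity p

      -- The character sum produced by the p points (z + b)/p; at exponents divisible by p it equals
      -- p.
      S : ℕ → ℂ
      S n = Σ[ p ] (λ b → ζ b ^ n)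

      F₁ : ℕ → ℕ → ℂ
      F₁ b k = F (heckePoint 1 b p (point k))

      F₂ F₃ : ℕ → ℂ
      F₂ k = F (heckePoint p 0 1 (point k))
      F₃ k = F (point k)

      F₁-nome : ∀ b k → nome (proj₁ (heckePoint 1 b p (point k))) ≈ ζ b * w k
      F₁-nome b k = nome-value (2 ℕ.+ k)
        (*-congʳ (ℝ-Solver.solve 1 (λ b → (con (+ 1) :+ con (+ 0)) :* con (+ 0) :+ b := b) refl (fromℕ b)))
        (trans (*-congʳ (*-congˡ (*-congˡ (fromℕ-* (2 ℕ.+ k) p))))
        (trans (ℝ-Solver.solve 4 (λ y k p i → (con (+ 1) :+ con (+ 0)) :* (y :* (k :* p)) :* i := y :* k :* (p :* i)) refl (fromℕ y₀) (fromℕ (2 ℕ.+ k)) (fromℕ p) (1/ p))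
        (trans (*-congˡ (n*1/n≈1 p)) (*-identityʳ _))))

      F₁-expansion : ∀ J b → BigO J (λ k → F₁ b k - Σ[ J ] (λ n → a n * (ζ b * w k) ^ n))
      F₁-expansion J b = remainder J , 0≤remainder J , λ k →
        ∣F-poly∣≤ (heckePoint 1 b p (point k)) (2 ℕ.+ k) (s≤s (s≤s z≤n)) (F₁-nome b k)
          (∣∣≤-weaken (≤-reflexive (*-identityˡ (∣w∣ k))) (∣z*w∣≤ (∣cis∣≤1 _) (∣fromℝ∣≤ (0≤∣w∣ k)))) J

      ΣF₁-expansion : ∀ J → BigO J (λ k → Σ[ p ] (λ b → F₁ b k) - poly (λ n → a n * S n) J k)
      ΣF₁-expansion J = BigO-cong {J} {λ k → Σ[ p ] (λ b → F₁ b k - P k b)} (λ k →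
          ℂ-Ring.trans (Σ-− (λ b → F₁ b k) (P k) p)
            (ℂ-Ring.+-congˡ {Σ[ p ] (λ b → F₁ b k)} (ℂ-Ring.-‿cong (collect k))))
        (BigO-Σ {J} (λ b k → F₁ b k - P k b) p (F₁-expansion J))
        where
        t : ℕ → ℕ → ℕ → ℂ
        t k b n = a n * (ζ b * w k) ^ n
        P : ℕ → ℕ → ℂ
        P k b = Σ[ J ] (t k b)
        collect : ∀ k → Σ[ p ] (P k) ≈ poly (λ n → a n * S n) J k
        collect k = ℂ-Ring.trans (Σ-swap (t k) p J) (Σ-cong J λ n _ →
          ℂ-Ring.trans (Σ-cong {λ b → t k b n} {λ b → a n * w k ^ n * ζ b ^ n} p λ b _ →
              ℂ-Ring.trans (ℂ-Ring.*-congˡ {a n} (^ℂ-distrib-* (ζ b) (w k) n))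
                (ℂ-Solver.solve 3 (λ a z w → a ⊗ (z ⊗ w) ⊜ a ⊗ w ⊗ z) ℂ-Ring.refl (a n) (ζ b ^ n) (w k ^ n)))
            (ℂ-Ring.trans (Σ-*ˡ (a n * w k ^ n) (λ b → ζ b ^ n) p)
              (ℂ-Solver.solve 3 (λ a w s → a ⊗ w ⊗ s ⊜ a ⊗ s ⊗ w) ℂ-Ring.refl (a n) (w k ^ n) (S n))))

      -- The nome of p times `point k` is w^(p²). Two terms, at exponents 0 and p², reach order 2p²,
      -- the common order of the three expansions, which leaves p² in range.
      F₂-expansion : BigO (2 ℕ.* p²) (λ k → F₂ k - poly (stretch p² a) (2 ℕ.* p²) k)
      F₂-expansion = stretched-expansion p² 2 λ k →
        ∣F-poly∣≤ (heckePoint p 0 1 (point k)) ((2 ℕ.+ k) ℕ.* p²) (s≤s (s≤s z≤n))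
          (nome-imaginary ((2 ℕ.+ k) ℕ.* p²)
            (trans (*-congˡ 1/1≈1) (ℝ-Solver.solve 1 (λ p → (p :* con (+ 0) :+ con (+ 0)) :* con (+ 1) := con (+ 0)) refl (fromℕ p)))
            (trans (*-congˡ 1/1≈1) (trans
              (ℝ-Solver.solve 3 (λ p y j → p :* (y :* j) :* con (+ 1) := y :* (j :* p)) refl (fromℕ p) (fromℕ y₀) (fromℕ ((2 ℕ.+ k) ℕ.* p)))
              (*-congˡ (trans (sym (fromℕ-* ((2 ℕ.+ k) ℕ.* p) p)) (reflexive (≡.cong fromℕ (ℕ.*-assoc (2 ℕ.+ k) p p))))))))
          (∣fromℝ∣≤ (0≤^ ((2 ℕ.+ k) ℕ.* p²) 0≤r)) 2

      F₃-expansion : BigO (2 ℕ.* p²) (λ k → F₃ k - poly (stretch p a) (2 ℕ.* p²) k)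
      F₃-expansion = ≡.subst (λ J → BigO J (λ k → F₃ k - poly (stretch p a) J k)) (ℕ.*-assoc 2 p p)
        (stretched-expansion p (2 ℕ.* p) λ k →
          ∣F-poly∣≤ (point k) ((2 ℕ.+ k) ℕ.* p) (s≤s (s≤s z≤n)) (nome-imaginary ((2 ℕ.+ k) ℕ.* p) refl refl)
            (∣fromℝ∣≤ (0≤^ ((2 ℕ.+ k) ℕ.* p) 0≤r)) (2 ℕ.* p))

      c₁ c₂ eigenvalue : ℂ
      c₁ = fromℝ (p ^ℤ (κ ℤ.- 1ℤ))
      c₂ = fromℝ (p ^ℤ (ℤ.- κ))
      eigenvalue = proj₁ (f.eigen p)

      eigen-equation : ∀ k → c₁ * (c₂ * Σ[ p ] (λ b → F₁ b k) + F₂ k) ≈ eigenvalue * F₃ k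
      eigen-equation k = ℂ-Ring.trans (ℂ-Ring.sym (T-prime {N} {κ} m prime-p p∤N f.form (point k))) (proj₂ (f.eigen p) (point k))

      -- The coefficient of w^n in T_p f - λ f; its three summands belong to the values of f at (z +
      -- b)/p, at pz and at z.
      D : ℕ → ℂ
      D n = c₁ * (c₂ * (a n * S n) + stretch p² a n) - eigenvalue * stretch p a n

      -- The eigenvalue equation cancels the function values, so the polynomial with coefficients D
      -- is a combination of the three truncation errors, each O(w^(2p²)).
      D≈0 : ∀ n → n ℕ.< 2 ℕ.* p² → D n ≈ 0#
      D≈0 = BigO-poly⇒zero J D (BigO-cong {J} (λ k → ℂ-Ring.sym (ℂ-Ring.trans (linear k) (defect k)))
        (BigO-+ {J} (BigO-* {J} (- c₁) (BigO-+ {J} (BigO-* {J} c₂ (ΣF₁-expansion J)) F₂-expansion))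
                    (BigO-* {J} eigenvalue F₃-expansion)))
        where
        J = 2 ℕ.* p²
        P₁ P₂ P₃ : ℕ → ℂ
        P₁ = poly (λ n → a n * S n) J
        P₂ = poly (stretch p² a) J
        P₃ = poly (stretch p a) J
        linear : ∀ k → poly D J k ≈ c₁ * (c₂ * P₁ k + P₂ k) - eigenvalue * P₃ k
        linear k = ℂ-Ring.trans
          (Σ-cong {u = λ n → c₁ * (c₂ * t₁ n + t₂ n) - eigenvalue * t₃ n} J λ n _ →
            ℂ-Ring.trans (ℂ-Solver.solve 5 (λ c u e z w → (c ⊗ u ⊖ e ⊗ z) ⊗ w ⊜ c ⊗ (u ⊗ w) ⊖ e ⊗ (z ⊗ w))
                ℂ-Ring.refl c₁ (c₂ * (a n * S n) + stretch p² a n) eigenvalue (stretch p a n) (w k ^ n))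
              (ℂ-Ring.+-congʳ { - (eigenvalue * t₃ n)} (ℂ-Ring.*-congˡ {c₁}
                (ℂ-Solver.solve 4 (λ d x y w → (d ⊗ x ⊕ y) ⊗ w ⊜ d ⊗ (x ⊗ w) ⊕ y ⊗ w)
                  ℂ-Ring.refl c₂ (a n * S n) (stretch p² a n) (w k ^ n)))))
          (ℂ-Ring.trans (Σ-− (λ n → c₁ * (c₂ * t₁ n + t₂ n)) (λ n → eigenvalue * t₃ n) J)
          (ℂ-Ring.+-cong
            (ℂ-Ring.trans (Σ-*ˡ c₁ (λ n → c₂ * t₁ n + t₂ n) J) (ℂ-Ring.*-congˡ {c₁}
              (ℂ-Ring.trans (Σ-+ (λ n → c₂ * t₁ n) t₂ J) (ℂ-Ring.+-congʳ {P₂ k} (Σ-*ˡ c₂ t₁ J)))))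
            (ℂ-Ring.-‿cong (Σ-*ˡ eigenvalue t₃ J))))
          where
          t₁ t₂ t₃ : ℕ → ℂ
          t₁ n = a n * S n * w k ^ n
          t₂ n = stretch p² a n * w k ^ n
          t₃ n = stretch p a n * w k ^ n
        defect : ∀ k → c₁ * (c₂ * P₁ k + P₂ k) - eigenvalue * P₃ k ≈
          - c₁ * (c₂ * (Σ[ p ] (λ b → F₁ b k) - P₁ k) + (F₂ k - P₂ k)) + eigenvalue * (F₃ k - P₃ k)
        defect k = ℂ-Ring.sym (ℂ-Ring.trans
          (ℂ-Ring.+-congʳ {eigenvalue * (F₃ k - P₃ k)} (ℂ-Ring.*-congˡ { - c₁}
            (ℂ-Solver.solve 5 (λ d f g x y → d ⊗ (f ⊖ x) ⊕ (g ⊖ y) ⊜ (d ⊗ f ⊕ g) ⊖ (d ⊗ x ⊕ y))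
              ℂ-Ring.refl c₂ (Σ[ p ] (λ b → F₁ b k)) (F₂ k) (P₁ k) (P₂ k))))
          (ℂ-Ring.trans
          (ℂ-Solver.solve 6 (λ c u v e h z → ⊖′ c ⊗ (u ⊖ v) ⊕ e ⊗ (h ⊖ z) ⊜ (c ⊗ v ⊖ e ⊗ z) ⊕ (e ⊗ h ⊖ c ⊗ u))
            ℂ-Ring.refl c₁ (c₂ * Σ[ p ] (λ b → F₁ b k) + F₂ k) (c₂ * P₁ k + P₂ k) eigenvalue (F₃ k) (P₃ k))
          (ℂ-Ring.trans (ℂ-Ring.+-congˡ {c₁ * (c₂ * P₁ k + P₂ k) - eigenvalue * P₃ k}
              (ℂ-Ring.trans (ℂ-Ring.+-congˡ {eigenvalue * F₃ k} (ℂ-Ring.-‿cong (eigen-equation k)))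
                (ℂ-Ring.-‿inverseʳ (eigenvalue * F₃ k))))
            (ℂ-Ring.+-identityʳ (c₁ * (c₂ * P₁ k + P₂ k) - eigenvalue * P₃ k)))))

      S≈p : ∀ n → (∀ b → ζ b ^ n ≈ 1#) → S n ≈ fromℂ p
      S≈p n ζ^n≈1 = ℂ-Ring.trans (Σ-cong p λ b _ → ζ^n≈1 b) (Σ1≈ p)
        where
        Σ1≈ : ∀ n → Σ[ n ] (λ _ → 1#) ≈ fromℂ n
        Σ1≈ zero    = ℂ-Ring.refl
        Σ1≈ (suc n) = ℂ-Ring.trans (ℂ-Ring.+-congˡ {1#} (Σ1≈ n)) (ℂ-Ring.sym (fromℂ-suc n))

      ζ^p²≈1 : ∀ b → ζ b ^ p² ≈ 1#
      ζ^p²≈1 b = ℂ-Ring.trans (ℂ-Ring.sym (^ℂ-assocʳ (ζ b) p p)) (ℂ-Ring.trans (^ℂ-congˡ p (ζ^p≈1 b)) (1^ℂ≈1 p))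

      c₁c₂p≈1 : c₁ * (c₂ * fromℂ p) ≈ 1#
      c₁c₂p≈1 = ℂ-Ring.trans (ℂ-Ring.*-congˡ {c₁} (ℂ-Ring.sym (fromℝ-* _ (fromℕ p))))
        (ℂ-Ring.trans (ℂ-Ring.sym (fromℝ-* _ _)) (fromℝ-cong (^ℤ-cancel p κ)))

      -- Where every ζ b ^ n is 1, S n = p, and c₁ c₂ p = 1 reduces the first part to a n.
      D-value : ∀ n s t → (∀ b → ζ b ^ n ≈ 1#) → stretch p² a n ≡ s → stretch p a n ≡ t → n ℕ.< 2 ℕ.* p² →
                a n + c₁ * s ≈ eigenvalue * t
      D-value n s t ζ^n≈1 s≡ t≡ n<J = -≈0⇒≈ (ℂ-Ring.trans (ℂ-Ring.sym simplified) (D≈0 n n<J))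
        where
        aS≈ap : a n * S n ≈ a n * fromℂ p
        aS≈ap = ℂ-Ring.*-congˡ {a n} (S≈p n ζ^n≈1)
        regroup : ∀ c d a p s → c * (d * (a * p) + s) ≈ c * (d * p) * a + c * s
        regroup = ℂ-Solver.solve 5 (λ c d a p s → c ⊗ (d ⊗ (a ⊗ p) ⊕ s) ⊜ c ⊗ (d ⊗ p) ⊗ a ⊕ c ⊗ s) ℂ-Ring.refl
        inner : c₂ * (a n * S n) + stretch p² a n ≈ c₂ * (a n * fromℂ p) + s
        inner = ℂ-Ring.+-cong (ℂ-Ring.*-congˡ {c₂} aS≈ap) (ℂ-Ring.reflexive s≡)
        first : c₁ * (c₂ * (a n * S n) + stretch p² a n) ≈ a n + c₁ * s
        first = ℂ-Ring.trans (ℂ-Ring.*-congˡ {c₁} inner)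
          (ℂ-Ring.trans (regroup c₁ c₂ (a n) (fromℂ p) s)
          (ℂ-Ring.+-congʳ {c₁ * s} (ℂ-Ring.trans (ℂ-Ring.*-congʳ {a n} c₁c₂p≈1) (ℂ-Ring.*-identityˡ (a n)))))
        simplified : D n ≈ (a n + c₁ * s) - eigenvalue * t
        simplified = ℂ-Ring.+-cong first (ℂ-Ring.-‿cong (ℂ-Ring.*-congˡ {eigenvalue} (ℂ-Ring.reflexive t≡)))

      p<p² : p ℕ.< p²
      p<p² = ℕ.m<m*n p p (s≤s (s≤s z≤n))

      p²<J : p² ℕ.< 2 ℕ.* p²
      p²<J = ℕ.m<m+n p² (s≤s z≤n)

      -- At exponent p the value at pz contributes nothing, as p < p², and the value at z
      -- contributes a 1 = 1.
      eigenvalue≈a[p] : eigenvalue ≈ f.coeff p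
      eigenvalue≈a[p] = ℂ-Ring.sym (ℂ-Ring.trans
        (ℂ-Ring.trans (ℂ-Solver.solve 2 (λ a c → a ⊜ a ⊕ c ⊗ conℂ (+ 0)) ℂ-Ring.refl (a p) c₁)
          (D-value p 0# (a 1) ζ^p≈1 (stretch-small p² a (suc m) p<p²)
            (≡.subst (λ n → stretch p a n ≡ a 1) (ℕ.*-identityˡ p) (stretch-multiple p a 1)) (ℕ.<-trans p<p² p²<J)))
        (ℂ-Ring.trans (ℂ-Ring.*-congˡ {eigenvalue} f.normalised) (ℂ-Ring.*-identityʳ eigenvalue)))

      -- At exponent p² the value at pz contributes a 1 = 1, with the factor p^(κ-1), and the value
      -- at z contributes a p.
      hecke-relation : f.coeff p * f.coeff p ≈ f.coeff p² + fromℝ (p ^ℤ (κ ℤ.- 1ℤ))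
      hecke-relation = ℂ-Ring.sym (ℂ-Ring.trans
        (ℂ-Ring.+-congˡ {f.coeff p²} (ℂ-Ring.sym (ℂ-Ring.trans (ℂ-Ring.*-congˡ {c₁} f.normalised) (ℂ-Ring.*-identityʳ c₁))))
        (ℂ-Ring.trans (D-value p² (a 1) (a p) ζ^p²≈1
            (≡.subst (λ n → stretch p² a n ≡ a 1) (ℕ.*-identityˡ p²) (stretch-multiple p² a 1)) (stretch-multiple p a p) p²<J)
          (ℂ-Ring.*-congʳ {a p} eigenvalue≈a[p])))

-- Separating the weights and comparing with the bounds

module Distinguishing (R : RealNumbers) where

  open Analysis R
  open RealProperties R
  open ComplexProperties R
  open Exponential R
  open IntegerPowers R
  open Eigenform R
  open ≤-Reasoning
  open import Algebra.Apartness.Properties.HeytingCommutativeRing heytingCommutativeRing using (#-congʳ)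
  open import Algebra.Properties.Group (AbelianGroup.group ℤ.+-0-abelianGroup) using (∙-cancelʳ)
  open import Data.Nat.Divisibility using (_∣_)
  open ℝ-Solver using (_:=_; _:+_; _:*_; _:-_; :-_; con)
  open SmallNonDivisor using (N₀; primeNonDivisor)

  -- Cotransitivity through y: either x + y is apart from y, or y is apart from 0.
  +#0⇒#0⊎#0 : ∀ {x y} → x +ᵣ y #ᵣ 0ᵣ → x #ᵣ 0ᵣ ⊎ y #ᵣ 0ᵣ
  +#0⇒#0⊎#0 {x} {y} x+y#0 = [ (λ x+y#y → inj₁ (#-congʳ (ℝ-Solver.solve 2 (λ x y → (x :+ y) :- y := x) refl x y) (#⇒-#0 x+y#y))) , inj₂ ]′
    (#-cotrans x+y#0 y)

  [x-y]*z#0⇒x#y : ∀ {x y z} → (x -ᵣ y) *ᵣ z #ᵣ 0ᵣ → x #ᵣ y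
  [x-y]*z#0⇒x#y = -#0⇒# ∘ xy#0⇒x#0

  -- c = α² - β is strongly extensional in α and β.
  coefficients-apart : ∀ {α β α′ β′ c c′} → α * α ≈ β + fromℝ c → α′ * α′ ≈ β′ + fromℝ c′ → c #ᵣ c′ →
                       α # α′ ⊎ β # β′
  coefficients-apart {x +i y} {u +i v} {x′ +i y′} {u′ +i v′} {c} {c′} (eq , _) (eq′ , _) c#c′ =
    [ (λ s#0 → inj₁ ([ inj₁ ∘ [x-y]*z#0⇒x#y , inj₂ ∘ [x-y]*z#0⇒x#y ]′ (+#0⇒#0⊎#0 s#0)))
    , (λ t#0 → inj₂ (inj₁ ([x-y]*z#0⇒x#y t#0))) ]′ (+#0⇒#0⊎#0 (#-congʳ split (#⇒-#0 c#c′)))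
    where
    c≈ : ∀ {x y u c} → x *ᵣ x -ᵣ y *ᵣ y ≈ᵣ u +ᵣ c → c ≈ᵣ (x *ᵣ x -ᵣ y *ᵣ y) -ᵣ u
    c≈ {x} {y} {u} {c} eq = trans (ℝ-Solver.solve 2 (λ u c → c := (u :+ c) :- u) refl u c) (+-congʳ (sym eq))
    -- As c is real, the real part c = x² - y² - u suffices. Differences of squares factor, so each
    -- summand contains the difference of one real coordinate.
    split : c -ᵣ c′ ≈ᵣ ((x -ᵣ x′) *ᵣ (x +ᵣ x′) +ᵣ (y -ᵣ y′) *ᵣ (-ᵣ (y +ᵣ y′))) +ᵣ (u -ᵣ u′) *ᵣ (-ᵣ 1ᵣ)
    split = trans (-‿cong₂ (c≈ eq) (c≈ eq′))
      (ℝ-Solver.solve 6 (λ x y u x′ y′ u′ →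
        ((x :* x :- y :* y) :- u) :- ((x′ :* x′ :- y′ :* y′) :- u′) :=
        ((x :- x′) :* (x :+ x′) :+ (y :- y′) :* (:- (y :+ y′))) :+ (u :- u′) :* (:- con (+ 1))) refl x y u x′ y′ u′)

  -- Each nome in an expansion carries a witness of π; the point z = i is an arbitrary choice.
  period : ∀ {N} .{{_ : NonZero N}} {k} → NormalisedEigenform N k → ∃[ π ] IsPi π
  period f = let (_ , (π , isPi , _) , _) = NormalisedEigenform.expansion f ((0ᵣ +i 1ᵣ) , 0<1) _ ℂ-Ring.refl in π , isPi

  relation : ∀ {N} .{{_ : NonZero N}} {k} (f : NormalisedEigenform N k) m → Prime (2 ℕ.+ m) → ¬ (2 ℕ.+ m ∣ N) → let p = 2 ℕ.+ m in
    coeff f p * coeff f p ≈ coeff f (p ℕ.* p) + fromℝ (p ^ℤ (k ℤ.- 1ℤ))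
  relation f m prime-p p∤N = hecke-relation f (proj₂ (period f)) m prime-p p∤N

  distinguished-at-p-or-p² : ∀ {N} .{{_ : NonZero N}} {k₁ k₂} → ¬ (k₁ ≡ k₂) →
    (f : NormalisedEigenform N k₁) (g : NormalisedEigenform N k₂) → ∀ p → Prime p → ¬ (p ∣ N) →
    coeff f p # coeff g p ⊎ coeff f (p ℕ.* p) # coeff g (p ℕ.* p)
  distinguished-at-p-or-p² k₁≢k₂ f g zero          prime-p p∤N = ⊥-elim (¬prime[0] prime-p)
  distinguished-at-p-or-p² k₁≢k₂ f g (suc zero)    prime-p p∤N = ⊥-elim (¬prime[1] prime-p)
  distinguished-at-p-or-p² {k₁ = k₁} {k₂} k₁≢k₂ f g p@(suc (suc m)) prime-p p∤N =
    coefficients-apart (relation f m prime-p p∤N) (relation g m prime-p p∤N)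
      (^ℤ-injective-# p 1<p λ k₁-1≡k₂-1 → k₁≢k₂ (∙-cancelʳ (ℤ.- 1ℤ) k₁ k₂ k₁-1≡k₂-1))
    where
    1<p : 1ᵣ < fromℕ p
    1<p = <-respˡ-≈ (+-identityʳ 1ᵣ) (<-respˡ-≈ (+-comm 0ᵣ 1ᵣ) (<-respʳ-≈ (+-comm (fromℕ (suc m)) 1ᵣ) (+-monoˡ-< 1ᵣ (fromℕ-pos (suc m)))))

  -- The 8 is that of p ≤ 8m, and the 2 that of m ≤ 2 log N.
  √C : ℝ
  √C = fromℕ 8 *ᵣ fromℕ 2

  0<√C : 0ᵣ < √C
  0<√C = *-pos (fromℕ-pos 8) (fromℕ-pos 2)

  -- From p ≤ √C log N follows p ≤ p² ≤ C log² N, which serves both alternatives; a bound B has only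
  -- to dominate log² N from N₀ on.
  distinguishedWithinO : ∀ {B : ℕ → ℝ → Set} →
    (∀ {N x} → N₀ ℕ.≤ N → B N x → ∃[ l ] IsLog (fromℕ N) l × l *ᵣ l ≤ x) → DistinguishedWithinO B
  distinguishedWithinO B≥log² = √C *ᵣ √C , *-pos 0<√C 0<√C , N₀ , λ N N₀≤N k₁ k₂ k₁≢k₂ f g x Bx →
    let (l , log , l²≤x) = B≥log² N₀≤N Bx
        (p , m , prime-p , p∤N , p≤8m , 2^m≤N) = primeNonDivisor N N₀≤N
        p²≤ = p²≤Cx p l²≤x (p≤√C*l p m (m/2≤log m log 2^m≤N) p≤8m)
        1≤p = ℕ.>-nonZero⁻¹ p {{prime⇒nonZero prime-p}}
    in [ (λ a#b → p , 1≤p , ≤-trans (fromℕ-mono-≤ (ℕ.m≤m*n p p {{prime⇒nonZero prime-p}})) p²≤ , a#b)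
       , (λ a#b → p ℕ.* p , ℕ.*-mono-≤ 1≤p 1≤p , p²≤ , a#b)
       ]′ (distinguished-at-p-or-p² k₁≢k₂ f g p prime-p p∤N)
    where
    p≤√C*l : ∀ p m {l} → fromℕ m *ᵣ ½ ≤ l → p ℕ.≤ 8 ℕ.* m → fromℕ p ≤ √C *ᵣ l
    p≤√C*l p m {l} m/2≤l p≤8m = begin
      fromℕ p                              ≤⟨ fromℕ-mono-≤ p≤8m ⟩
      fromℕ (8 ℕ.* m)                      ≈⟨ fromℕ-* 8 m ⟩
      fromℕ 8 *ᵣ fromℕ m                   ≈⟨ *-identityʳ _ ⟨
      fromℕ 8 *ᵣ fromℕ m *ᵣ 1ᵣ             ≈⟨ *-congˡ (n*1/n≈1 2) ⟨
      fromℕ 8 *ᵣ fromℕ m *ᵣ (fromℕ 2 *ᵣ ½) ≈⟨ ℝ-Solver.solve 4 (λ e m t h → e :* m :* (t :* h) := e :* t :* (m :* h)) refl (fromℕ 8) (fromℕ m) (fromℕ 2) ½ ⟩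
      √C *ᵣ (fromℕ m *ᵣ ½)                ≤⟨ *-monoʳ-≤ √C (<⇒≤ 0<√C) m/2≤l ⟩
      √C *ᵣ l                             ∎
    p²≤Cx : ∀ p {l x} → l *ᵣ l ≤ x → fromℕ p ≤ √C *ᵣ l → fromℕ (p ℕ.* p) ≤ √C *ᵣ √C *ᵣ x
    p²≤Cx p {l} {x} l²≤x p≤√C*l = begin
      fromℕ (p ℕ.* p)              ≈⟨ fromℕ-* p p ⟩
      fromℕ p *ᵣ fromℕ p           ≤⟨ *-mono-≤ (0≤fromℕ p) (≤-trans (0≤fromℕ p) p≤√C*l) p≤√C*l p≤√C*l ⟩
      √C *ᵣ l *ᵣ (√C *ᵣ l)       ≈⟨ ℝ-Solver.solve 2 (λ c l → c :* l :* (c :* l) := c :* c :* (l :* l)) refl √C l ⟩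
      √C *ᵣ √C *ᵣ (l *ᵣ l)       ≤⟨ *-monoʳ-≤ _ (<⇒≤ (*-pos 0<√C 0<√C)) l²≤x ⟩
      √C *ᵣ √C *ᵣ x              ∎

  l²≤[l+s]² : ∀ {l s x} → 0ᵣ ≤ l → 0ᵣ ≤ s → x ≈ᵣ (l +ᵣ s) ^ᵣ 2 → l *ᵣ l ≤ x
  l²≤[l+s]² {l} {s} {x} 0≤l 0≤s x≈ = begin
    l *ᵣ l                  ≤⟨ *-mono-≤ 0≤l (0≤+ 0≤l 0≤s) (x≤x+y 0≤s) (x≤x+y 0≤s) ⟩
    (l +ᵣ s) *ᵣ (l +ᵣ s)    ≈⟨ *-congˡ (*-identityʳ (l +ᵣ s)) ⟨
    (l +ᵣ s) ^ᵣ 2           ≈⟨ x≈ ⟨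
    x                       ∎

  -- It makes log log N nonnegative, so that the additional summands in the bounds do not lower
  -- them.
  1≤log : ∀ {N l} → N₀ ℕ.≤ N → IsLog (fromℕ N) l → 1ᵣ ≤ l
  1≤log N₀≤N log = ≤-trans (≤-reflexive (sym (n*1/n≈1 2)))
    -- The exponent of N₀ is 2 · 4^3 = 128 = 2 + 126.
    (m/2≤log 2 log (ℕ.≤-trans (ℕ.^-monoʳ-≤ 2 (ℕ.m≤m+n 2 126)) N₀≤N))

  0≤log[N] : ∀ {N l} → N₀ ℕ.≤ N → IsLog (fromℕ N) l → 0ᵣ ≤ l
  0≤log[N] N₀≤N log = ≤-trans 0≤1 (1≤log N₀≤N log)

  distinguished₁ : DistinguishedWithinO Bound₁
  distinguished₁ = distinguishedWithinO λ N₀≤N (l , s , log , power , x≈) →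
    l , log , l²≤[l+s]² (0≤log[N] N₀≤N log) (<⇒≤ (0<realPower power)) x≈

  distinguished₂ : DistinguishedWithinO Bound₂
  distinguished₂ = distinguishedWithinO λ N₀≤N (l , s , ll , log , power , loglog , x≈) →
    l , log , l²≤[l+s]² (0≤log[N] N₀≤N log) (0≤* (<⇒≤ (0<realPower power)) (0≤log loglog (1≤log N₀≤N log))) x≈

  distinguished₃ : DistinguishedWithinO Bound₃
  distinguished₃ = distinguishedWithinO λ N₀≤N (l , ll , log , loglog , x≈) →
    l , log , l²≤[l+s]² (0≤log[N] N₀≤N log) (0≤^ 2 (0≤log loglog (1≤log N₀≤N log))) x≈

theorem5 : (R : RealNumbers) → let open Analysis R in
    DistinguishedWithinO Bound₁ ×
    (RiemannHypothesis → DistinguishedWithinO Bound₂) ×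
    (CramérConjecture → DistinguishedWithinO Bound₃)
theorem5 R = distinguished₁ , (λ _ → distinguished₂) , (λ _ → distinguished₃)
  where open Distinguishing R
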